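{- There are absolute constants $k_0\in\mathbb N$ and $\alpha,\varepsilon>0$ such that for all integers $d\ge k\ge k_0$ and every $n\ge \alpha d^8k^6$ there is a pair of $k$-ary relational structures $\mathfrak A$ and $\mathfrak B$ with $|V(\mathfrak A)|=|V(\mathfrak B)|=n$ that are distinguished by $k$-WL, but $d$-WL does not distinguish $\mathfrak A$ and $\mathfrak B$ after $n^{\varepsilon k}$ refinement rounds.
   Context: A relational structure $\mathfrak A$ of arity at most $k$ consists of a finite universe $V(\mathfrak A)$ and relations $R_i^{\mathfrak A}\subseteq V(\mathfrak A)^{k_i}$ with $k_i\le k$; a $k$-ary structure is one whose relations have arity at most $k$. For $\vec v=(v_1,\dots,v_m)\in V(\mathfrak A)^m$, the atomic type $\mathrm{atp}_{\mathfrak A}(\vec v)$ is the isomorphism type of the ordered induced substructure on $\{v_1,\dots,v_m\}$ (two tuples in possibly different structures have the same atomic type iff $v_i\mapsto w_i$ is a well-defined isomorphism of the induced substructures). For a coloring $\chi$ of $V^m$, its $m$-WL refinement is $\chi'(\vec v)=\big(\chi(\vec v),\{\!\{(\chi(\vec v[w/1]),\dots,\chi(\vec v[w/m]))\mid w\in V\}\!\}\big)$, where $\vec v[w/i]$ replaces the $i$-th entry by $w$. The $m$-WL algorithm (for structures of arity at most $m$) computes $\chi^{(0)}_{\mathfrak A}=\mathrm{atp}_{\mathfrak A}$ on $V(\mathfrak A)^m$ and $\chi^{(r+1)}_{\mathfrak A}=(\chi^{(r)}_{\mathfrak A})'$, with colors defined uniformly so they can be compared across structures. $m$-WL distinguishes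 $\mathfrak A$ and $\mathfrak B$ after $r$ rounds if for some color $c$ the numbers of tuples of color $c$ under $\chi^{(r)}_{\mathfrak A}$ and under $\chi^{(r)}_{\mathfrak B}$ differ; it distinguishes them if it does so after some number of rounds. -}

module Defs where

open import Data.Nat using (ℕ; zero; suc; _≡ᵇ_)
open import Data.Fin using (Fin; _≟_)
open import Data.Bool using (Bool; true; false; _∧_; not; _xor_; if_then_else_)
open import Data.List using (List; []; _∷_; [_]; length; lookup; allFin; map; concatMap; filterᵇ)
open import Data.Product using (Σ)
open import Data.Sum using (_⊎_)
open import Relation.Nullary using (does)
open import Relation.Binary.PropositionalEquality using (_≢_)

Tuple : ℕ → ℕ → Set
Tuple n m = Fin m → Fin n

record Structure (n : ℕ) (σ : List ℕ) : Set where
  field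
    rel : (i : Fin (length σ)) → Tuple n (lookup σ i) → Bool
open Structure public

allFuns : ∀ a n → List (Tuple n a)
allFuns zero n = [ (λ ()) ]
allFuns (suc a) n =
  concatMap (λ x → map (λ f → λ { Fin.zero → x ; (Fin.suc j) → f j }) (allFuns a n)) (allFin n)

allᵇ : {A : Set} → (A → Bool) → List A → Bool
allᵇ p [] = true
allᵇ p (x ∷ xs) = p x ∧ allᵇ p xs

_⇔ᵇ_ : Bool → Bool → Bool
b ⇔ᵇ c = not (b xor c)

count : {A : Set} → (A → Bool) → List A → ℕ
count p xs = length (filterᵇ p xs)

upd : ∀ {n m} → Tuple n m → Fin m → Fin n → Tuple n m
upd v i x j = if does (j ≟ i) then x else v j

-- same atomic type: v_i ↦ w_i is a well-defined isomorphism of the induced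
-- (ordered) substructures: same equality pattern, and every relation holds on
-- every tuple built from entries of v iff it holds on the corresponding tuple of w.
sameAtp : ∀ {n n' σ m} → Structure n σ → Structure n' σ → Tuple n m → Tuple n' m → Bool
sameAtp {σ = σ} {m} A B v w =
  allᵇ (λ i → allᵇ (λ j → does (v i ≟ v j) ⇔ᵇ does (w i ≟ w j)) (allFin m)) (allFin m)
  ∧ allᵇ (λ r → allᵇ (λ f → rel A r (λ t → v (f t)) ⇔ᵇ rel B r (λ t → w (f t)))
                   (allFuns (lookup σ r) m))
        (allFin (length σ))

-- sameCol r A B v w : χ^(r)_A(v) = χ^(r)_B(w) for the m-WL colouring (m = length of tuples)
mutual
  sameCol : ℕ → ∀ {n n' σ m} → Structure n σ → Structure n' σ → Tuple n m → Tuple n' m → Bool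
  sameCol zero A B v w = sameAtp A B v w
  sameCol (suc r) A B v w = sameCol r A B v w ∧ msetEq r A B v w

  nbrEq : ℕ → ∀ {n n' σ m} → Structure n σ → Structure n' σ → Tuple n m → Tuple n' m
        → Fin n → Fin n' → Bool
  nbrEq r {m = m} A B v w x y = allᵇ (λ i → sameCol r A B (upd v i x) (upd w i y)) (allFin m)

  -- equality of the multisets {{(χ(v[x/1]),…,χ(v[x/m])) | x}} and
  -- {{(χ(w[y/1]),…,χ(w[y/m])) | y}}: every element occurs equally often in both
  msetEq : ℕ → ∀ {n n' σ m} → Structure n σ → Structure n' σ → Tuple n m → Tuple n' m → Bool
  msetEq r {n} {n'} A B v w =
    allᵇ (λ x → count (λ x' → nbrEq r A A v v x' x) (allFin n)
               ≡ᵇ count (λ y → nbrEq r B A w v y x) (allFin n')) (allFin n)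
    ∧ allᵇ (λ y → count (λ x → nbrEq r A B v w x y) (allFin n)
                 ≡ᵇ count (λ y' → nbrEq r B B w w y' y) (allFin n')) (allFin n')

colCount : ∀ m → ℕ → ∀ {n n' σ} → Structure n σ → Structure n' σ → Tuple n' m → ℕ
colCount m r {n} X Y t = count (λ u → sameCol r X Y u t) (allFuns m n)

-- m-WL distinguishes A and B after r rounds: some colour c (the colour of some
-- tuple of A or of B) has different numbers of tuples in A and in B.
DistAfter : ∀ m → ℕ → ∀ {n σ} → Structure n σ → Structure n σ → Set
DistAfter m r {n} A B =
  Σ (Tuple n m) (λ t → colCount m r A A t ≢ colCount m r B A t)
  ⊎ Σ (Tuple n m) (λ t → colCount m r A B t ≢ colCount m r B B t)

Distinguishes : ∀ m → ∀ {n σ} → Structure n σ → Structure n σ → Set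
Distinguishes m A B = Σ ℕ (λ r → DistAfter m r A B)

{-# OPTIONS --safe #-}
module Submission where

-- The structures encode XOR systems: every variable has two elements, and flipping a set of
-- variables is Duplicator's only kind of move.  The base system is layered: each variable is the sum
-- of eight variables one layer below, layer 0 vanishes, and one variable of the top layer is 0 in 𝔄
-- and 1 in 𝔅.  Spoiler walks from the top to the bottom along odd variables with few pebbles.  With
-- d pebbles he cannot do much better: the sums between consecutive layers form an expander, so
-- pebbles determine nothing across a gap of more than 2(d + 1) layers, and Duplicator can keep
-- everything below a slowly descending gap equal to 0.  To pack n^Ω(k) base variables into n elements
-- (hardness condensation), each base variable is replaced by the sum of Θ(k) out of n/2 variables
-- along a second expander; then d pebbles determine at most d base variables.  Both expanders come from
-- a derandomised counting argument, and in both systems the assignments are extended by peeling off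
-- constraints that own a private variable.

open import Defs
open import Data.Bool using (Bool; true; false; _∧_; _∨_; not; _xor_; if_then_else_)
open import Data.Bool.Properties using (xor-assoc) renaming (_≟_ to _≟ᵇ_)
open import Data.Empty using (⊥; ⊥-elim)
open import Data.Fin using (Fin; toℕ; fromℕ; fromℕ<; inject₁; inject≤; _↑ˡ_; _↑ʳ_; splitAt; combine; remQuot; _≟_)
open import Data.Fin.Properties using (toℕ<n; toℕ-fromℕ; toℕ-fromℕ<; toℕ-inject₁; toℕ-inject≤; inject₁-injective; fromℕ<-cong; fromℕ<-toℕ; splitAt-↑ˡ; splitAt-↑ʳ; splitAt⁻¹-↑ˡ; splitAt⁻¹-↑ʳ; remQuot-combine; combine-remQuot; combine-injective; all?; ¬∀⟶∃¬)
open import Data.List using (List; []; _∷_; _++_; length; map; concatMap; allFin; tabulate; lookup)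
open import Data.List.Membership.Propositional using (_∈_; lose)
open import Data.List.Membership.Propositional.Properties using (∈-allFin; ∈-concatMap⁺; ∈-map⁺; ∈-++⁺ˡ; ∈-++⁺ʳ)
open import Data.List.Properties using (length-tabulate)
open import Data.List.Relation.Unary.All using (All; universal)
open import Data.List.Relation.Unary.All.Properties using (map⁺)
open import Data.List.Relation.Unary.Any using (here; there)
open import Data.Maybe using (Maybe; just; nothing)
open import Data.Maybe.Properties using (just-injective) renaming (≡-dec to maybe-≡-dec)
open import Data.Nat using (ℕ; zero; suc; _+_; _*_; _∸_; _^_; _≤_; _<_; z≤n; s≤s; s≤s⁻¹; _≡ᵇ_; _≤?_; _<?_; NonZero; >-nonZero)
open import Data.Nat.DivMod using (_/_; _%_; m≡m%n+[m/n]*n; m%n<n; m/n*n≤m)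
open import Data.Nat.Properties hiding (_≟_)
open import Data.Nat.Properties using () renaming (_≟_ to _≟ℕ_)
open import Data.Nat.Solver using (module +-*-Solver)
open import Data.Nat.Tactic.RingSolver using (solve-∀)
open import Data.Product using (Σ; ∃; _×_; _,_; proj₁; proj₂)
open import Data.Sum using (_⊎_; inj₁; inj₂)
open import Data.Vec using (Vec) renaming (lookup to lookupᵛ; tabulate to tabulateᵛ)
open import Data.Vec.Properties using (lookup∘tabulate) renaming (tabulate-cong to tabulateᵛ-cong)
open import Function using (_∘_; id)
open import Relation.Binary.Definitions using (tri<; tri≈; tri>)
open import Relation.Binary.PropositionalEquality using (_≡_; _≢_; _≗_; refl; sym; trans; cong; cong₂; subst; subst₂; module ≡-Reasoning)
open import Relation.Nullary using (¬_; Dec; yes; no; does)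
open import Relation.Nullary.Decidable using (dec-true; dec-false; toWitness; _×-dec_; _→-dec_)

-- No assignment satisfies the whole base system with the top variable equal to 1, so Duplicator
-- commits only to a closure of what is pebbled. A set of constraints is stuck if every variable
-- private to one of its members is already known. Expansion above half the degree gives small sets
-- many private variables, so small stuck sets are no larger than the number of pebbles, and their
-- union is again stuck and small. Constraints outside this closure can be given prescribed values.
-- The contradiction hides in the gap, which descends by a bounded number of layers per round; hence
-- n^Ω(k) layers are needed, far more than n elements can carry without condensation.
--
-- The bound `d ^ 8 * k ^ 6` comes from the condensing expander: degree `3 * h` and expansion
-- `2 * h` leave an exponent `h` to absorb ranges of size up to `k * d` taken to the power `3 * h`.
-- This costs a factor `(k * d) ^ 3` in the number `v` of variables. The other factor `z` of `v` has
-- to reach both the square root of `n` and `32 * d`, which asks for `n` of order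
-- `(k * d) ^ 6 * d ^ 2`.

∧-true : ∀ {a b} → a ∧ b ≡ true → a ≡ true × b ≡ true
∧-true {true} {true} _ = refl , refl

∧-intro : ∀ {a b} → a ≡ true → b ≡ true → a ∧ b ≡ true
∧-intro refl refl = refl

∨-introˡ : ∀ {a} b → a ≡ true → a ∨ b ≡ true
∨-introˡ b refl = refl

∨-introʳ : ∀ a {b} → b ≡ true → a ∨ b ≡ true
∨-introʳ true _ = refl
∨-introʳ false p = p

∨-elim : ∀ a {b} → a ∨ b ≡ true → a ≡ true ⊎ b ≡ true
∨-elim true _ = inj₁ refl
∨-elim false p = inj₂ p

true≢false : ∀ {b} → b ≡ true → b ≡ false → ⊥
true≢false refl ()

≢true⇒false : ∀ {b} → ¬ (b ≡ true) → b ≡ false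
≢true⇒false {true} p = ⊥-elim (p refl)
≢true⇒false {false} p = refl

bool-ext : ∀ {a b} → (a ≡ true → b ≡ true) → (b ≡ true → a ≡ true) → a ≡ b
bool-ext {true} p q = sym (p refl)
bool-ext {false} {true} p q = q refl
bool-ext {false} {false} p q = refl

does-true : ∀ {ℓ} {P : Set ℓ} (P? : Dec P) → does P? ≡ true → P
does-true (yes p) _ = p

allᵇ-elim : {A : Set} {p : A → Bool} {xs : List A} {x : A} → allᵇ p xs ≡ true → x ∈ xs → p x ≡ true
allᵇ-elim h (here refl) = proj₁ (∧-true h)
allᵇ-elim h (there x∈) = allᵇ-elim (proj₂ (∧-true h)) x∈

allᵇ-intro : {A : Set} {p : A → Bool} (xs : List A) → (∀ x → p x ≡ true) → allᵇ p xs ≡ true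
allᵇ-intro [] h = refl
allᵇ-intro (x ∷ xs) h = ∧-intro (h x) (allᵇ-intro xs h)

allᵇ-fin : ∀ {n} {p : Fin n → Bool} → allᵇ p (allFin n) ≡ true → ∀ i → p i ≡ true
allᵇ-fin h i = allᵇ-elim h (∈-allFin i)

⟦_⟧ : Bool → ℕ
⟦ true ⟧ = 1
⟦ false ⟧ = 0

⟦⟧≤1 : ∀ b → ⟦ b ⟧ ≤ 1
⟦⟧≤1 true = ≤-refl
⟦⟧≤1 false = z≤n

⟦⟧-pos : ∀ {b} → 1 ≤ ⟦ b ⟧ → b ≡ true
⟦⟧-pos {true} _ = refl

⟦⟧-mono : ∀ {a b} → (a ≡ true → b ≡ true) → ⟦ a ⟧ ≤ ⟦ b ⟧
⟦⟧-mono {true} h rewrite h refl = ≤-refl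
⟦⟧-mono {false} h = z≤n

⟦⟧-∨ : ∀ a b → ⟦ a ∨ b ⟧ ≤ ⟦ a ⟧ + ⟦ b ⟧
⟦⟧-∨ true b = s≤s z≤n
⟦⟧-∨ false b = ≤-refl

-- Sums over lists

∑ : {A : Set} → List A → (A → ℕ) → ℕ
∑ [] f = 0
∑ (x ∷ xs) f = f x + ∑ xs f

module _ {A : Set} where

  ∑-cong : ∀ (xs : List A) {f g : A → ℕ} → (∀ x → f x ≡ g x) → ∑ xs f ≡ ∑ xs g
  ∑-cong [] h = refl
  ∑-cong (x ∷ xs) h = cong₂ _+_ (h x) (∑-cong xs h)

  ∑-mono : ∀ (xs : List A) {f g : A → ℕ} → (∀ x → f x ≤ g x) → ∑ xs f ≤ ∑ xs g
  ∑-mono [] h = z≤n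
  ∑-mono (x ∷ xs) h = +-mono-≤ (h x) (∑-mono xs h)

  ∑-+ : ∀ (xs : List A) (f g : A → ℕ) → ∑ xs (λ x → f x + g x) ≡ ∑ xs f + ∑ xs g
  ∑-+ [] f g = refl
  ∑-+ (x ∷ xs) f g rewrite ∑-+ xs f g = interchange (f x) (g x) (∑ xs f) (∑ xs g)
    where
    interchange : ∀ a b c d → a + b + (c + d) ≡ a + c + (b + d)
    interchange = solve-∀

  ∑-*ˡ : ∀ (xs : List A) c (f : A → ℕ) → ∑ xs (λ x → c * f x) ≡ c * ∑ xs f
  ∑-*ˡ [] c f = sym (*-zeroʳ c)
  ∑-*ˡ (x ∷ xs) c f = trans (cong (c * f x +_) (∑-*ˡ xs c f)) (sym (*-distribˡ-+ c (f x) (∑ xs f)))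

  ∑-*ʳ : ∀ (xs : List A) c (f : A → ℕ) → ∑ xs (λ x → f x * c) ≡ ∑ xs f * c
  ∑-*ʳ xs c f = trans (∑-cong xs (λ x → *-comm (f x) c)) (trans (∑-*ˡ xs c f) (*-comm c (∑ xs f)))

  ∑-const : ∀ (xs : List A) c → ∑ xs (λ _ → c) ≡ length xs * c
  ∑-const [] c = refl
  ∑-const (x ∷ xs) c = cong (c +_) (∑-const xs c)

  ∑-0 : ∀ (xs : List A) → ∑ xs (λ _ → 0) ≡ 0
  ∑-0 xs = trans (∑-const xs 0) (*-zeroʳ (length xs))

  ∑-++ : ∀ (xs ys : List A) f → ∑ (xs ++ ys) f ≡ ∑ xs f + ∑ ys f
  ∑-++ [] ys f = refl
  ∑-++ (x ∷ xs) ys f = trans (cong (f x +_) (∑-++ xs ys f)) (sym (+-assoc (f x) (∑ xs f) (∑ ys f)))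

  ∑-∈ : ∀ {xs : List A} {x} (f : A → ℕ) → x ∈ xs → f x ≤ ∑ xs f
  ∑-∈ f (here refl) = m≤m+n _ _
  ∑-∈ f (there x∈) = ≤-trans (∑-∈ f x∈) (m≤n+m _ _)

  ∑-pos : ∀ (xs : List A) (f : A → ℕ) → 1 ≤ ∑ xs f → ∃ λ x → x ∈ xs × 1 ≤ f x
  ∑-pos (x ∷ xs) f h with f x in eq
  ... | suc m = x , here refl , subst (1 ≤_) (sym eq) (s≤s z≤n)
  ... | zero with ∑-pos xs f h
  ...   | y , y∈ , py = y , there y∈ , py

  -- This replaces the random choice in the greedy construction, and serves as the pigeonhole
  -- principle for layers.
  ∑-average : ∀ (xs : List A) (f : A → ℕ) → 1 ≤ length xs → ∃ λ x → length xs * f x ≤ ∑ xs f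
  ∑-average (x ∷ []) f _ = x , ≤-refl
  ∑-average (x ∷ y ∷ ys) f _ with ∑-average (y ∷ ys) f (s≤s z≤n)
  ... | z , hz with ≤-total (f x) (f z)
  ... | inj₁ x≤z = x , +-monoʳ-≤ (f x) (≤-trans (*-monoʳ-≤ (length (y ∷ ys)) x≤z) hz)
  ... | inj₂ z≤x = z , +-mono-≤ z≤x hz

∑-map : {A B : Set} (xs : List A) (h : A → B) (f : B → ℕ) → ∑ (map h xs) f ≡ ∑ xs (λ x → f (h x))
∑-map [] h f = refl
∑-map (x ∷ xs) h f = cong (f (h x) +_) (∑-map xs h f)

∑-concatMap : {A B : Set} (xs : List A) (h : A → List B) (f : B → ℕ) →
  ∑ (concatMap h xs) f ≡ ∑ xs (λ x → ∑ (h x) f)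
∑-concatMap [] h f = refl
∑-concatMap (x ∷ xs) h f = trans (∑-++ (h x) (concatMap h xs) f) (cong (∑ (h x) f +_) (∑-concatMap xs h f))

∑-swap : {A B : Set} (xs : List A) (ys : List B) (f : A → B → ℕ) →
  ∑ xs (λ x → ∑ ys (f x)) ≡ ∑ ys (λ y → ∑ xs (λ x → f x y))
∑-swap [] ys f = sym (∑-0 ys)
∑-swap (x ∷ xs) ys f = trans (cong (∑ ys (f x) +_) (∑-swap xs ys f))
  (sym (∑-+ ys (f x) (λ y → ∑ xs (λ z → f z y))))

length-∑ : {A : Set} (xs : List A) → length xs ≡ ∑ xs (λ _ → 1)
length-∑ xs = trans (sym (*-identityʳ (length xs))) (sym (∑-const xs 1))

count-∑ : {A : Set} (p : A → Bool) (xs : List A) → count p xs ≡ ∑ xs (λ x → ⟦ p x ⟧)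
count-∑ p [] = refl
count-∑ p (x ∷ xs) with p x
... | true = cong suc (count-∑ p xs)
... | false = count-∑ p xs

-- The list enumerates its type only up to `E`, so reindexing is done by double counting: `f (φ a)`
-- is spread over all `x` equivalent to `φ a`, the sums are swapped, and `symE`, which states that
-- `φ` is an involution up to `E`, collapses the inner sum to 1.
∑-involution : {A : Set} (xs : List A) (E : A → A → Bool) → (∀ a → ∑ xs (λ x → ⟦ E x a ⟧) ≡ 1) →
  (f : A → ℕ) → (∀ {x a} → E x a ≡ true → f x ≡ f a) →
  (φ : A → A) → (∀ x a → E x (φ a) ≡ E a (φ x)) → ∑ xs (λ x → f (φ x)) ≡ ∑ xs f
∑-involution xs E enum f resp φ symE = begin
  ∑ xs (λ a → f (φ a))                                  ≡⟨ ∑-cong xs (λ a → spread (φ a)) ⟩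
  ∑ xs (λ a → ∑ xs (λ x → ⟦ E x (φ a) ⟧ * f x))         ≡⟨ ∑-swap xs xs _ ⟩
  ∑ xs (λ x → ∑ xs (λ a → ⟦ E x (φ a) ⟧ * f x))         ≡⟨ ∑-cong xs (λ x → ∑-*ʳ xs (f x) (λ a → ⟦ E x (φ a) ⟧)) ⟩
  ∑ xs (λ x → ∑ xs (λ a → ⟦ E x (φ a) ⟧) * f x)
    ≡⟨ ∑-cong xs (λ x → cong (_* f x) (∑-cong xs (λ a → cong ⟦_⟧ (symE x a)))) ⟩
  ∑ xs (λ x → ∑ xs (λ a → ⟦ E a (φ x) ⟧) * f x)
    ≡⟨ ∑-cong xs (λ x → trans (cong (_* f x) (enum (φ x))) (*-identityˡ (f x))) ⟩
  ∑ xs f ∎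
  where
  open ≡-Reasoning
  pointwise : ∀ x b → ⟦ E x b ⟧ * f b ≡ ⟦ E x b ⟧ * f x
  pointwise x b with E x b in eq
  ... | true = cong (1 *_) (sym (resp eq))
  ... | false = refl
  spread : ∀ b → f b ≡ ∑ xs (λ x → ⟦ E x b ⟧ * f x)
  spread b = begin
    f b                                ≡⟨ sym (*-identityˡ (f b)) ⟩
    1 * f b                            ≡⟨ cong (_* f b) (sym (enum b)) ⟩
    ∑ xs (λ x → ⟦ E x b ⟧) * f b       ≡⟨ sym (∑-*ʳ xs (f b) _) ⟩
    ∑ xs (λ x → ⟦ E x b ⟧ * f b)       ≡⟨ ∑-cong xs (λ x → pointwise x b) ⟩
    ∑ xs (λ x → ⟦ E x b ⟧ * f x)       ∎

∑-tabulate : ∀ {n} {A : Set} (g : Fin n → A) (f : A → ℕ) → ∑ (tabulate g) f ≡ ∑ (allFin n) (λ i → f (g i))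
∑-tabulate {zero} g f = refl
∑-tabulate {suc n} g f = cong (f (g Fin.zero) +_)
  (trans (∑-tabulate (λ i → g (Fin.suc i)) f) (sym (∑-tabulate Fin.suc (λ i → f (g i)))))

∑-suc : ∀ {n} (f : Fin (suc n) → ℕ) → ∑ (allFin (suc n)) f ≡ f Fin.zero + ∑ (allFin n) (λ i → f (Fin.suc i))
∑-suc f = cong (f Fin.zero +_) (∑-tabulate Fin.suc f)

length-allFin : ∀ n → length (allFin n) ≡ n
length-allFin n = length-tabulate id

_==_ : ∀ {n} → Fin n → Fin n → Bool
i == j = does (i ≟ j)

==-true : ∀ {n} {i j : Fin n} → i == j ≡ true → i ≡ j
==-true {i = i} {j} = does-true (i ≟ j)

==-refl : ∀ {n} (i : Fin n) → i == i ≡ true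
==-refl i = dec-true (i ≟ i) refl

==-sym : ∀ {n} (i j : Fin n) → i == j ≡ j == i
==-sym i j = bool-ext (λ p → subst (λ z → z == i ≡ true) (==-true {i = i} p) (==-refl i))
                      (λ p → subst (λ z → z == j ≡ true) (==-true {i = j} p) (==-refl j))

∑-δ : ∀ {n} (a : Fin n) (f : Fin n → ℕ) → ∑ (allFin n) (λ x → ⟦ x == a ⟧ * f x) ≡ f a
∑-δ {suc n} Fin.zero f = trans (∑-suc (λ x → ⟦ x == Fin.zero ⟧ * f x))
  (trans (cong (f Fin.zero + 0 +_) (∑-0 (allFin n))) (trans (+-identityʳ _) (+-identityʳ _)))
∑-δ {suc n} (Fin.suc a) f = trans (∑-suc (λ x → ⟦ x == Fin.suc a ⟧ * f x)) (∑-δ a (λ i → f (Fin.suc i)))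

∑-δ1 : ∀ {n} (a : Fin n) → ∑ (allFin n) (λ x → ⟦ x == a ⟧) ≡ 1
∑-δ1 a = trans (∑-cong (allFin _) (λ x → sym (*-identityʳ ⟦ x == a ⟧))) (∑-δ a (λ _ → 1))

∑-δ1′ : ∀ {n} (a : Fin n) → ∑ (allFin n) (λ x → ⟦ a == x ⟧) ≡ 1
∑-δ1′ a = trans (∑-cong (allFin _) (λ x → cong ⟦_⟧ (==-sym a x))) (∑-δ1 a)

-- Subsets of Fin n

Sub : ℕ → Set
Sub n = Fin n → Bool

_⊆_ : ∀ {n} → Sub n → Sub n → Set
S ⊆ U = ∀ i → S i ≡ true → U i ≡ true

_∪_ : ∀ {n} → Sub n → Sub n → Sub n
(S ∪ U) i = S i ∨ U i

card : ∀ {n} → Sub n → ℕ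
card {n} S = ∑ (allFin n) (λ i → ⟦ S i ⟧)

card-mono : ∀ {n} {S U : Sub n} → S ⊆ U → card S ≤ card U
card-mono h = ∑-mono (allFin _) (λ i → ⟦⟧-mono (h i))

card-∪ : ∀ {n} (S U : Sub n) → card (S ∪ U) ≤ card S + card U
card-∪ {n} S U = ≤-trans (∑-mono (allFin n) (λ i → ⟦⟧-∨ (S i) (U i)))
  (≤-reflexive (∑-+ (allFin n) (λ i → ⟦ S i ⟧) (λ i → ⟦ U i ⟧)))

card-cong : ∀ {n} {S U : Sub n} → S ≗ U → card S ≡ card U
card-cong h = ∑-cong (allFin _) (λ i → cong ⟦_⟧ (h i))

card-pos : ∀ {n} (S : Sub n) {i} → S i ≡ true → 1 ≤ card S
card-pos S {i} p = ≤-trans (≤-reflexive (cong ⟦_⟧ (sym p))) (∑-∈ (λ j → ⟦ S j ⟧) (∈-allFin i))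

card-zero : ∀ {n} (S : Sub n) → card S ≡ 0 → ∀ i → S i ≡ false
card-zero S e i = ≢true⇒false (λ p → <⇒≢ (card-pos S p) (sym e))

single : ∀ {n} → Fin n → Sub n
single a i = i == a

-- Enumeration of tuples

consF : ∀ {n a} → Fin n → Tuple n a → Tuple n (suc a)
consF x f Fin.zero = x
consF x f (Fin.suc j) = f j

-- `allFuns` conses with a pattern-matching lambda that equals `consF` only pointwise, so the
-- summand has to respect pointwise equality.
∑-allFuns : ∀ {n} a (F : Tuple n (suc a) → ℕ) → (∀ {f g} → f ≗ g → F f ≡ F g) →
  ∑ (allFuns (suc a) n) F ≡ ∑ (allFin n) (λ x → ∑ (allFuns a n) (λ f → F (consF x f)))
∑-allFuns {n} a F resp = trans (∑-concatMap (allFin n) _ F)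
  (∑-cong (allFin n) (λ x → trans (∑-map (allFuns a n) _ F)
    (∑-cong (allFuns a n) (λ f → resp λ { Fin.zero → refl ; (Fin.suc j) → refl }))))

length-allFuns : ∀ a n → length (allFuns a n) ≡ n ^ a
length-allFuns zero n = refl
length-allFuns (suc a) n = begin
  length (allFuns (suc a) n)                           ≡⟨ length-∑ (allFuns (suc a) n) ⟩
  ∑ (allFuns (suc a) n) (λ _ → 1)                      ≡⟨ ∑-allFuns {n} a (λ _ → 1) (λ _ → refl) ⟩
  ∑ (allFin n) (λ _ → ∑ (allFuns a n) (λ _ → 1))       ≡⟨ ∑-const (allFin n) _ ⟩
  length (allFin n) * ∑ (allFuns a n) (λ _ → 1)
    ≡⟨ cong₂ _*_ (length-allFin n) (trans (sym (length-∑ (allFuns a n))) (length-allFuns a n)) ⟩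
  n * n ^ a                                            ∎
  where open ≡-Reasoning

allF : ∀ {a} → Sub a → Bool
allF {zero} p = true
allF {suc a} p = p Fin.zero ∧ allF (λ i → p (Fin.suc i))

allF-intro : ∀ {a} {p : Sub a} → (∀ i → p i ≡ true) → allF p ≡ true
allF-intro {zero} h = refl
allF-intro {suc a} h = ∧-intro (h Fin.zero) (allF-intro (λ i → h (Fin.suc i)))

allF-elim : ∀ {a} {p : Sub a} → allF p ≡ true → ∀ i → p i ≡ true
allF-elim {suc a} h Fin.zero = proj₁ (∧-true h)
allF-elim {suc a} h (Fin.suc i) = allF-elim (proj₂ (∧-true h)) i

allF-cong : ∀ {a} {p q : Sub a} → p ≗ q → allF p ≡ allF q
allF-cong {zero} h = refl
allF-cong {suc a} h = cong₂ _∧_ (h Fin.zero) (allF-cong (λ i → h (Fin.suc i)))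

⟦⟧-∧ : ∀ a b → ⟦ a ∧ b ⟧ ≡ ⟦ a ⟧ * ⟦ b ⟧
⟦⟧-∧ true b = sym (+-identityʳ ⟦ b ⟧)
⟦⟧-∧ false b = refl

-- Entries are chosen independently, so counts multiply. With `c = 1` this shows that each tuple is
-- listed once; with constant `X` it counts the codes that hit a test.
∑-allFuns-allF : ∀ {n} a (X : Fin a → Sub n) c → (∀ i → card (X i) ≡ c) →
  ∑ (allFuns a n) (λ f → ⟦ allF (λ i → X i (f i)) ⟧) ≡ c ^ a
∑-allFuns-allF zero X c h = refl
∑-allFuns-allF {n} (suc a) X c h = begin
  ∑ (allFuns (suc a) n) (λ f → ⟦ allF (λ i → X i (f i)) ⟧)
    ≡⟨ ∑-allFuns a _ (λ e → cong ⟦_⟧ (allF-cong (λ i → cong (X i) (e i)))) ⟩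
  ∑ (allFin n) (λ x → ∑ (allFuns a n) (λ f → ⟦ X Fin.zero x ∧ allF (λ i → X (Fin.suc i) (f i)) ⟧))
    ≡⟨ ∑-cong (allFin n) (λ x → ∑-cong (allFuns a n) (λ f → ⟦⟧-∧ (X Fin.zero x) _)) ⟩
  ∑ (allFin n) (λ x → ∑ (allFuns a n) (λ f → ⟦ X Fin.zero x ⟧ * ⟦ allF (λ i → X (Fin.suc i) (f i)) ⟧))
    ≡⟨ ∑-cong (allFin n) (λ x → ∑-*ˡ (allFuns a n) ⟦ X Fin.zero x ⟧ _) ⟩
  ∑ (allFin n) (λ x → ⟦ X Fin.zero x ⟧ * ∑ (allFuns a n) (λ f → ⟦ allF (λ i → X (Fin.suc i) (f i)) ⟧))
    ≡⟨ ∑-*ʳ (allFin n) _ (λ x → ⟦ X Fin.zero x ⟧) ⟩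
  card (X Fin.zero) * ∑ (allFuns a n) (λ f → ⟦ allF (λ i → X (Fin.suc i) (f i)) ⟧)
    ≡⟨ cong₂ _*_ (h Fin.zero) (∑-allFuns-allF a (λ i → X (Fin.suc i)) c (λ i → h (Fin.suc i))) ⟩
  c * c ^ a ∎
  where open ≡-Reasoning

eqT : ∀ {n a} → Tuple n a → Tuple n a → Bool
eqT f g = allF (λ i → f i == g i)

eqT-true : ∀ {n a} {f g : Tuple n a} → eqT f g ≡ true → f ≗ g
eqT-true h i = ==-true (allF-elim h i)

eqT-intro : ∀ {n a} {f g : Tuple n a} → f ≗ g → eqT f g ≡ true
eqT-intro {f = f} h = allF-intro (λ i → subst (λ z → f i == z ≡ true) (h i) (==-refl (f i)))

∑-eqT : ∀ {n a} (g : Tuple n a) → ∑ (allFuns a n) (λ f → ⟦ eqT f g ⟧) ≡ 1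
∑-eqT {n} {a} g = trans (∑-allFuns-allF a (λ i x → x == g i) 1 (λ i → ∑-δ1 (g i))) (^-zeroˡ a)

allFuns-complete : ∀ {n a} (g : Tuple n a) → ∃ λ f → f ∈ allFuns a n × f ≗ g
allFuns-complete {n} {a} g with ∑-pos (allFuns a n) (λ f → ⟦ eqT f g ⟧) (≤-reflexive (sym (∑-eqT g)))
... | f , f∈ , p = f , f∈ , eqT-true (⟦⟧-pos p)

-- Colour equality is an equivalence relation

allᵇ-map : {A : Set} {p q : A → Bool} (xs : List A) → (∀ x → p x ≡ true → q x ≡ true) →
  allᵇ p xs ≡ true → allᵇ q xs ≡ true
allᵇ-map [] h _ = refl
allᵇ-map (x ∷ xs) h e = ∧-intro (h x (proj₁ (∧-true e))) (allᵇ-map xs h (proj₂ (∧-true e)))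

allᵇ-intro-∈ : {A : Set} {p : A → Bool} (xs : List A) → (∀ x → x ∈ xs → p x ≡ true) → allᵇ p xs ≡ true
allᵇ-intro-∈ [] h = refl
allᵇ-intro-∈ (x ∷ xs) h = ∧-intro (h x (here refl)) (allᵇ-intro-∈ xs (λ y y∈ → h y (there y∈)))

allᵇ-map₂ : {A : Set} {p q r : A → Bool} (xs : List A) → (∀ x → p x ≡ true → q x ≡ true → r x ≡ true) →
  allᵇ p xs ≡ true → allᵇ q xs ≡ true → allᵇ r xs ≡ true
allᵇ-map₂ [] h _ _ = refl
allᵇ-map₂ (x ∷ xs) h e e′ = ∧-intro (h x (proj₁ (∧-true e)) (proj₁ (∧-true e′)))
  (allᵇ-map₂ xs h (proj₂ (∧-true e)) (proj₂ (∧-true e′)))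

⇔ᵇ-≡ : ∀ b c → b ⇔ᵇ c ≡ true → b ≡ c
⇔ᵇ-≡ true true _ = refl
⇔ᵇ-≡ false false _ = refl

≡-⇔ᵇ : ∀ b c → b ≡ c → b ⇔ᵇ c ≡ true
≡-⇔ᵇ true _ refl = refl
≡-⇔ᵇ false _ refl = refl

≡ᵇ-≡ : ∀ m n → (m ≡ᵇ n) ≡ true → m ≡ n
≡ᵇ-≡ zero zero _ = refl
≡ᵇ-≡ (suc m) (suc n) p = cong suc (≡ᵇ-≡ m n p)

≡-≡ᵇ : ∀ {m n} → m ≡ n → (m ≡ᵇ n) ≡ true
≡-≡ᵇ {zero} refl = refl
≡-≡ᵇ {suc m} refl = ≡-≡ᵇ {m} refl

count-cong : {A : Set} {p q : A → Bool} (xs : List A) → (∀ x → p x ≡ q x) → count p xs ≡ count q xs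
count-cong {p = p} {q} xs h = trans (count-∑ p xs) (trans (∑-cong xs (λ x → cong ⟦_⟧ (h x))) (sym (count-∑ q xs)))

module _ {n : ℕ} {σ : List ℕ} {m : ℕ} where

  sameAtp-eq : (A B : Structure n σ) (v w : Tuple n m) → sameAtp A B v w ≡ true →
    ∀ i j → does (v i ≟ v j) ≡ does (w i ≟ w j)
  sameAtp-eq A B v w h i j = ⇔ᵇ-≡ (does (v i ≟ v j)) (does (w i ≟ w j))
    (allᵇ-fin {p = λ j → does (v i ≟ v j) ⇔ᵇ does (w i ≟ w j)}
      (allᵇ-fin {p = λ i → allᵇ (λ j → does (v i ≟ v j) ⇔ᵇ does (w i ≟ w j)) (allFin m)} (proj₁ (∧-true h)) i) j)

  -- Restricted to listed `f`, because a relation is an arbitrary Boolean function and may fail to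
  -- respect pointwise equality of tuples.
  sameAtp-rel : (A B : Structure n σ) (v w : Tuple n m) → sameAtp A B v w ≡ true →
    ∀ r f → f ∈ allFuns (lookup σ r) m → rel A r (λ t → v (f t)) ≡ rel B r (λ t → w (f t))
  sameAtp-rel A B v w h r f f∈ = ⇔ᵇ-≡ (rel A r (λ t → v (f t))) (rel B r (λ t → w (f t)))
    (allᵇ-elim {p = λ f → rel A r (λ t → v (f t)) ⇔ᵇ rel B r (λ t → w (f t))}
      (allᵇ-fin {p = λ r → allᵇ (λ f → rel A r (λ t → v (f t)) ⇔ᵇ rel B r (λ t → w (f t))) (allFuns (lookup σ r) m)}
        (proj₂ (∧-true {allᵇ (λ i → allᵇ (λ j → does (v i ≟ v j) ⇔ᵇ does (w i ≟ w j)) (allFin m)) (allFin m)} h)) r) f∈)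

  sameAtp-intro : (A B : Structure n σ) (v w : Tuple n m) →
    (∀ i j → does (v i ≟ v j) ≡ does (w i ≟ w j)) →
    (∀ r f → f ∈ allFuns (lookup σ r) m → rel A r (λ t → v (f t)) ≡ rel B r (λ t → w (f t))) →
    sameAtp A B v w ≡ true
  sameAtp-intro A B v w p q = ∧-intro
    (allᵇ-intro (allFin m) (λ i → allᵇ-intro (allFin m) (λ j → ≡-⇔ᵇ (does (v i ≟ v j)) (does (w i ≟ w j)) (p i j))))
    (allᵇ-intro (allFin (length σ)) (λ r → allᵇ-intro-∈ (allFuns (lookup σ r) m)
      (λ f f∈ → ≡-⇔ᵇ (rel A r (λ t → v (f t))) (rel B r (λ t → w (f t))) (q r f f∈))))

  sameAtp-refl : (A : Structure n σ) (v : Tuple n m) → sameAtp A A v v ≡ true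
  sameAtp-refl A v = sameAtp-intro A A v v (λ i j → refl) (λ r f _ → refl)

  sameAtp-sym : (A B : Structure n σ) (v w : Tuple n m) → sameAtp A B v w ≡ true → sameAtp B A w v ≡ true
  sameAtp-sym A B v w h = sameAtp-intro B A w v (λ i j → sym (sameAtp-eq A B v w h i j))
    (λ r f f∈ → sym (sameAtp-rel A B v w h r f f∈))

  sameAtp-trans : (A B C : Structure n σ) (u v w : Tuple n m) →
    sameAtp A B u v ≡ true → sameAtp B C v w ≡ true → sameAtp A C u w ≡ true
  sameAtp-trans A B C u v w h h′ = sameAtp-intro A C u w
    (λ i j → trans (sameAtp-eq A B u v h i j) (sameAtp-eq B C v w h′ i j))
    (λ r f f∈ → trans (sameAtp-rel A B u v h r f f∈) (sameAtp-rel B C v w h′ r f f∈))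

  sameCol-refl : ∀ r (A : Structure n σ) (v : Tuple n m) → sameCol r A A v v ≡ true
  sameCol-refl zero A v = sameAtp-refl A v
  sameCol-refl (suc r) A v = ∧-intro (sameCol-refl r A v)
    (∧-intro (allᵇ-intro (allFin n) (λ x → ≡-≡ᵇ {count (λ x′ → nbrEq r A A v v x′ x) (allFin n)} refl))
             (allᵇ-intro (allFin n) (λ x → ≡-≡ᵇ {count (λ x′ → nbrEq r A A v v x′ x) (allFin n)} refl)))

  msetEq-fst : ∀ r (A B : Structure n σ) (v w : Tuple n m) → msetEq r A B v w ≡ true → ∀ x →
    count (λ x′ → nbrEq r A A v v x′ x) (allFin n) ≡ count (λ y → nbrEq r B A w v y x) (allFin n)
  msetEq-fst r A B v w h x = ≡ᵇ-≡ _ _ (allᵇ-fin (proj₁ (∧-true h)) x)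

  msetEq-snd : ∀ r (A B : Structure n σ) (v w : Tuple n m) → msetEq r A B v w ≡ true → ∀ y →
    count (λ x → nbrEq r A B v w x y) (allFin n) ≡ count (λ y′ → nbrEq r B B w w y′ y) (allFin n)
  msetEq-snd r A B v w h y = ≡ᵇ-≡ _ _ (allᵇ-fin (proj₂ (∧-true h)) y)

  msetEq-intro : ∀ r (A B : Structure n σ) (v w : Tuple n m) →
    (∀ x → count (λ x′ → nbrEq r A A v v x′ x) (allFin n) ≡ count (λ y → nbrEq r B A w v y x) (allFin n)) →
    (∀ y → count (λ x → nbrEq r A B v w x y) (allFin n) ≡ count (λ y′ → nbrEq r B B w w y′ y) (allFin n)) →
    msetEq r A B v w ≡ true
  msetEq-intro r A B v w p q = ∧-intro (allᵇ-intro (allFin n) (λ x → ≡-≡ᵇ (p x))) (allᵇ-intro (allFin n) (λ y → ≡-≡ᵇ (q y)))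

  msetEq-sym : ∀ r (A B : Structure n σ) (v w : Tuple n m) → msetEq r A B v w ≡ true → msetEq r B A w v ≡ true
  msetEq-sym r A B v w q =
    msetEq-intro r B A w v (λ y → sym (msetEq-snd r A B v w q y)) (λ x → sym (msetEq-fst r A B v w q x))

  sameCol-sym : ∀ r (A B : Structure n σ) (v w : Tuple n m) → sameCol r A B v w ≡ true → sameCol r B A w v ≡ true
  sameCol-sym zero A B v w h = sameAtp-sym A B v w h
  sameCol-sym (suc r) A B v w h with ∧-true h
  ... | p , q = ∧-intro (sameCol-sym r A B v w p) (msetEq-sym r A B v w q)

  nbrEq-refl : ∀ r (A : Structure n σ) (v : Tuple n m) x → nbrEq r A A v v x x ≡ true
  nbrEq-refl r A v x = allᵇ-intro (allFin m) (λ i → sameCol-refl r A (upd v i x))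

  nbrEq-sym : ∀ r (A B : Structure n σ) (v w : Tuple n m) x y → nbrEq r A B v w x y ≡ true → nbrEq r B A w v y x ≡ true
  nbrEq-sym r A B v w x y = allᵇ-map (allFin m) (λ i → sameCol-sym r A B (upd v i x) (upd w i y))

  -- By reflexivity `x` is counted in its own class, so the equal count on the other side is
  -- positive.
  msetEq-reply : ∀ r (A B : Structure n σ) (v w : Tuple n m) → msetEq r A B v w ≡ true →
    ∀ x → ∃ λ y → nbrEq r A B v w x y ≡ true
  msetEq-reply r A B v w h x
    with ∑-pos (allFin n) (λ y → ⟦ nbrEq r B A w v y x ⟧)
      (≤-trans (card-pos (λ x′ → nbrEq r A A v v x′ x) (nbrEq-refl r A v x))
        (≤-reflexive (trans (sym (count-∑ _ (allFin n))) (trans (msetEq-fst r A B v w h x) (count-∑ _ (allFin n))))))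
  ... | y , _ , p = y , nbrEq-sym r B A w v y x (⟦⟧-pos p)

  private
    NbrTrans : ℕ → Set
    NbrTrans r = ∀ (A B C : Structure n σ) (u v w : Tuple n m) x y z →
      nbrEq r A B u v x y ≡ true → nbrEq r B C v w y z ≡ true → nbrEq r A C u w x z ≡ true

    nbr-swap : ∀ r → NbrTrans r → (A B C : Structure n σ) (u v w : Tuple n m) → ∀ x y z →
      nbrEq r B C v w y z ≡ true → nbrEq r A B u v x y ≡ nbrEq r A C u w x z
    nbr-swap r tr A B C u v w x y z h = bool-ext (λ p → tr A B C u v w x y z p h)
      (λ p → tr A C B u w v x z y p (nbrEq-sym r B C v w y z h))

    -- `msetEq` counts only colour vectors that occur in one of its two structures. A reply `y` in
    -- `B` to `x` represents the same class there and carries the count from `A` through `B` to `C`.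
    msetEq-half : ∀ r → NbrTrans r → (A B C : Structure n σ) (u v w : Tuple n m) →
      msetEq r A B u v ≡ true → msetEq r B C v w ≡ true → ∀ x →
      count (λ x′ → nbrEq r A A u u x′ x) (allFin n) ≡ count (λ z → nbrEq r C A w u z x) (allFin n)
    msetEq-half r tr A B C u v w p q x with msetEq-reply r A B u v p x
    ... | y , hy = begin
      count (λ x′ → nbrEq r A A u u x′ x) (allFin n) ≡⟨ msetEq-fst r A B u v p x ⟩
      count (λ y′ → nbrEq r B A v u y′ x) (allFin n) ≡⟨ count-cong (allFin n) (λ y′ → nbr-swap r tr B A B v u v y′ x y hy) ⟩
      count (λ y′ → nbrEq r B B v v y′ y) (allFin n) ≡⟨ msetEq-fst r B C v w q y ⟩
      count (λ z → nbrEq r C B w v z y) (allFin n)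
        ≡⟨ count-cong (allFin n) (λ z → nbr-swap r tr C B A w v u z y x (nbrEq-sym r A B u v x y hy)) ⟩
      count (λ z → nbrEq r C A w u z x) (allFin n) ∎
      where open ≡-Reasoning

  mutual
    sameCol-trans : ∀ r (A B C : Structure n σ) (u v w : Tuple n m) →
      sameCol r A B u v ≡ true → sameCol r B C v w ≡ true → sameCol r A C u w ≡ true
    sameCol-trans zero A B C u v w h h′ = sameAtp-trans A B C u v w h h′
    sameCol-trans (suc r) A B C u v w h h′ with ∧-true h | ∧-true h′
    ... | p , q | p′ , q′ = ∧-intro (sameCol-trans r A B C u v w p p′)
      (msetEq-intro r A C u w (msetEq-half r (nbrEq-trans r) A B C u v w q q′)
        (λ z → sym (msetEq-half r (nbrEq-trans r) C B A w v u (msetEq-sym r B C v w q′) (msetEq-sym r A B u v q) z)))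

    nbrEq-trans : ∀ r → NbrTrans r
    nbrEq-trans r A B C u v w x y z = allᵇ-map₂ (allFin m)
      (λ i → sameCol-trans r A B C (upd u i x) (upd v i y) (upd w i z))

  sameCol-swapˡ : ∀ r (A B C : Structure n σ) (u v w : Tuple n m) →
    sameCol r A B u v ≡ true → sameCol r A C u w ≡ sameCol r B C v w
  sameCol-swapˡ r A B C u v w h = bool-ext
    (λ p → sameCol-trans r B A C v u w (sameCol-sym r A B u v h) p)
    (λ p → sameCol-trans r A B C u v w h p)

  nbrEq-swapˡ : ∀ r (A B C : Structure n σ) (u v w : Tuple n m) x y z →
    nbrEq r A B u v x y ≡ true → nbrEq r A C u w x z ≡ nbrEq r B C v w y z
  nbrEq-swapˡ r A B C u v w x y z h = bool-ext
    (λ p → nbrEq-trans r B A C v u w y x z (nbrEq-sym r A B u v x y h) p)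
    (λ p → nbrEq-trans r A B C u v w x y z h p)

  count-involution : (p : Fin n → Bool) (β : Fin n → Fin n) → (∀ x → β (β x) ≡ x) →
    count (λ x → p (β x)) (allFin n) ≡ count p (allFin n)
  count-involution p β inv = trans (count-∑ _ (allFin n)) (trans
    (∑-involution (allFin n) _==_ ∑-δ1 (λ x → ⟦ p x ⟧) (λ {x} {a} e → cong (λ z → ⟦ p z ⟧) (==-true {i = x} e)) β
      (λ x a → bool-ext (λ e → sw x a (==-true {i = x} e)) (λ e → sw a x (==-true {i = a} e))))
    (sym (count-∑ p (allFin n))))
    where
    sw : ∀ x a → x ≡ β a → a == β x ≡ true
    sw x a refl = subst (λ z → a == z ≡ true) (sym (inv a)) (==-refl a)

  -- The form in which Duplicator survives a round: one bijection, fixed before the replaced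
  -- position `i` is named. It is taken to be an involution because flipping variables is one.
  msetEq-bijection : ∀ r (A B : Structure n σ) (v w : Tuple n m) (β : Fin n → Fin n) → (∀ x → β (β x) ≡ x) →
    (∀ x i → sameCol r A B (upd v i x) (upd w i (β x)) ≡ true) → msetEq r A B v w ≡ true
  msetEq-bijection r A B v w β inv h = msetEq-intro r A B v w
    (λ x → trans (count-cong (allFin n) (λ x′ → nbrEq-swapˡ r A B A v w v x′ (β x′) x (nb x′)))
                 (count-involution (λ y → nbrEq r B A w v y x) β inv))
    (λ y → trans (count-cong (allFin n) (λ x → nbrEq-swapˡ r A B B v w w x (β x) y (nb x)))
                 (count-involution (λ y′ → nbrEq r B B w w y′ y) β inv))
    where
    nb : ∀ x → nbrEq r A B v w x (β x) ≡ true
    nb x = allᵇ-intro (allFin m) (h x)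

-- Greedy construction of expanders

-- Method of conditional expectations: the estimator `Φ` charges a test a factor `B` per hit. A
-- random code hits a given test with probability at most `1 / (2 N B)`, so some code raises `Φ` by
-- a factor of at most `1 + 1 / (2 N)`, and `N` such choices at most double it.
module Greedy {Code Test : Set} (codes : List Code) (tests : List Test)
              (hit : Test → Code → Bool) (weight : Test → ℕ) (B N : ℕ)
              (codes-nonempty : 1 ≤ length codes) (N-pos : 1 ≤ N)
              (rarely-hit : ∀ τ → 2 * N * (B * ∑ codes (λ c → ⟦ hit τ c ⟧)) ≤ length codes) where

  hits : ∀ {j} → (Fin j → Code) → Test → ℕ
  hits {j} g τ = ∑ (allFin j) (λ i → ⟦ hit τ (g i) ⟧)

  Φ : ∀ {j} → (Fin j → Code) → ℕ
  Φ g = ∑ tests (λ τ → weight τ * B ^ hits g τ)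

  Φ₀ : ℕ
  Φ₀ = ∑ tests weight

  _▹_ : ∀ {j} → Code → (Fin j → Code) → (Fin (suc j) → Code)
  (c ▹ g) Fin.zero = c
  (c ▹ g) (Fin.suc i) = g i

  hits-▹ : ∀ {j} c (g : Fin j → Code) τ → hits (c ▹ g) τ ≡ ⟦ hit τ c ⟧ + hits g τ
  hits-▹ c g τ = ∑-suc (λ i → ⟦ hit τ ((c ▹ g) i) ⟧)

  -- For a bit `b`, `B ^ b ≤ 1 + B * b`; the right side is linear in the hit and can be averaged
  -- over the codes.
  growth : ∀ {j} c (g : Fin j → Code) τ →
    weight τ * B ^ hits (c ▹ g) τ ≤ (1 + B * ⟦ hit τ c ⟧) * (weight τ * B ^ hits g τ)
  growth c g τ rewrite hits-▹ c g τ with hit τ c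
  ... | true = ≤-trans (≤-reflexive (rearrange (weight τ) B (B ^ hits g τ))) (m≤n+m _ (weight τ * B ^ hits g τ))
    where
    rearrange : ∀ w b p → w * (b * p) ≡ b * 1 * (w * p)
    rearrange = solve-∀
  ... | false = m≤m+n _ _

  step : ∀ {j} (g : Fin j → Code) → ∃ λ c → 2 * N * Φ (c ▹ g) ≤ (2 * N + 1) * Φ g
  step g with ∑-average codes (λ c → Φ (c ▹ g)) codes-nonempty
  ... | c , avg = c , *-cancelˡ-≤ (length codes) {{>-nonZero codes-nonempty}} (begin
    len * (2 * N * Φ (c ▹ g))                   ≡⟨ left-comm len (2 * N) (Φ (c ▹ g)) ⟩
    2 * N * (len * Φ (c ▹ g))                   ≤⟨ *-monoʳ-≤ (2 * N) avg ⟩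
    2 * N * ∑ codes (λ c → Φ (c ▹ g))
      ≤⟨ *-monoʳ-≤ (2 * N) (∑-mono codes (λ c → ∑-mono tests (growth c g))) ⟩
    2 * N * ∑ codes (λ c → ∑ tests (λ τ → (1 + B * ⟦ hit τ c ⟧) * ψ τ))
      ≡⟨ cong (2 * N *_) (trans (∑-swap codes tests _) (∑-cong tests inner)) ⟩
    2 * N * ∑ tests (λ τ → (len + B * ∑ codes (λ c → ⟦ hit τ c ⟧)) * ψ τ)
      ≡⟨ sym (∑-*ˡ tests (2 * N) _) ⟩
    ∑ tests (λ τ → 2 * N * ((len + B * ∑ codes (λ c → ⟦ hit τ c ⟧)) * ψ τ))
      ≤⟨ ∑-mono tests bound ⟩
    ∑ tests (λ τ → len * (2 * N + 1) * ψ τ)     ≡⟨ ∑-*ˡ tests (len * (2 * N + 1)) ψ ⟩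
    len * (2 * N + 1) * Φ g                     ≡⟨ *-assoc len (2 * N + 1) (Φ g) ⟩
    len * ((2 * N + 1) * Φ g)                   ∎)
    where
    open ≤-Reasoning
    len : ℕ
    len = length codes
    ψ : Test → ℕ
    ψ τ = weight τ * B ^ hits g τ
    left-comm : ∀ a b c → a * (b * c) ≡ b * (a * c)
    left-comm = solve-∀
    inner : ∀ τ → ∑ codes (λ c → (1 + B * ⟦ hit τ c ⟧) * ψ τ) ≡ (len + B * ∑ codes (λ c → ⟦ hit τ c ⟧)) * ψ τ
    inner τ = trans (∑-*ʳ codes (ψ τ) _) (cong (_* ψ τ) (trans (∑-+ codes (λ _ → 1) _)
      (cong₂ _+_ (sym (length-∑ codes)) (∑-*ˡ codes B _))))
    distr : ∀ n l x p → n * ((l + x) * p) ≡ (n * l + n * x) * p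
    distr = solve-∀
    total : ∀ n l → n * l + l ≡ l * (n + 1)
    total = solve-∀
    bound : ∀ τ → 2 * N * ((len + B * ∑ codes (λ c → ⟦ hit τ c ⟧)) * ψ τ) ≤ len * (2 * N + 1) * ψ τ
    bound τ = begin
      2 * N * ((len + B * ∑ codes (λ c → ⟦ hit τ c ⟧)) * ψ τ)   ≡⟨ distr (2 * N) len _ (ψ τ) ⟩
      (2 * N * len + 2 * N * (B * ∑ codes (λ c → ⟦ hit τ c ⟧))) * ψ τ
        ≤⟨ *-monoˡ-≤ (ψ τ) (+-monoʳ-≤ (2 * N * len) (rarely-hit τ)) ⟩
      (2 * N * len + len) * ψ τ                                 ≡⟨ cong (_* ψ τ) (total (2 * N) len) ⟩
      len * (2 * N + 1) * ψ τ                                   ∎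

  -- The factor (1 + 1/2N) lost in each step is absorbed by the linearly decreasing factor m.
  choose : ∀ j m → m + j ≡ 2 * N → ∃ λ (g : Fin j → Code) → Φ g * m ≤ 2 * N * Φ₀
  choose zero m e = (λ ()) , ≤-reflexive (trans (cong₂ _*_ (∑-cong tests (λ τ → *-identityʳ (weight τ)))
    (trans (sym (+-identityʳ m)) e)) (*-comm Φ₀ (2 * N)))
  choose (suc j) m e with choose j (suc m) (trans (sym (+-suc m j)) e)
  ... | g , hg with step g
  ... | c , hc = c ▹ g , ≤-trans
    (*-cancelˡ-≤ (2 * N) {{>-nonZero (≤-trans N-pos (m≤m+n N _))}} (begin
      2 * N * (Φ (c ▹ g) * m)            ≡⟨ sym (*-assoc (2 * N) (Φ (c ▹ g)) m) ⟩
      2 * N * Φ (c ▹ g) * m              ≤⟨ *-monoˡ-≤ m hc ⟩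
      (2 * N + 1) * Φ g * m              ≡⟨ expand (2 * N) (Φ g) m ⟩
      2 * N * (Φ g * m) + Φ g * m        ≤⟨ +-monoʳ-≤ (2 * N * (Φ g * m)) (*-monoʳ-≤ (Φ g) m≤2N) ⟩
      2 * N * (Φ g * m) + Φ g * (2 * N)  ≡⟨ collect (2 * N) (Φ g) m ⟩
      2 * N * (Φ g * suc m)              ∎)) hg
    where
    open ≤-Reasoning
    m≤2N : m ≤ 2 * N
    m≤2N = ≤-trans (m≤m+n m (suc j)) (≤-reflexive e)
    expand : ∀ n p m → (n + 1) * p * m ≡ n * (p * m) + p * m
    expand = solve-∀
    collect : ∀ n p m → n * (p * m) + p * n ≡ n * (p * (1 + m))
    collect = solve-∀

  greedy : ∃ λ (g : Fin N → Code) → ∀ τ → τ ∈ tests → weight τ * B ^ hits g τ ≤ 2 * Φ₀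
  greedy with choose N N (cong (N +_) (sym (+-identityʳ N)))
  ... | g , hg = g , λ τ τ∈ → ≤-trans (∑-∈ (λ τ → weight τ * B ^ hits g τ) τ∈)
    (*-cancelʳ-≤ (Φ g) (2 * Φ₀) N {{>-nonZero N-pos}} (≤-trans hg (≤-reflexive (regroup N Φ₀))))
    where
    regroup : ∀ n p → 2 * n * p ≡ 2 * p * n
    regroup = solve-∀

-- Multiplicities in hypergraphs

inc : ∀ {M δ v} → (Fin M → Fin δ → Fin v) → Fin M → Fin v → ℕ
inc {δ = δ} nb c x = ∑ (allFin δ) (λ i → ⟦ nb c i == x ⟧)

-- Incidences are counted with multiplicity, as the entries of `nb c` may repeat. Value 1 means that
-- `x` is private to one constraint of `T`.
mult : ∀ {M δ v} → (Fin M → Fin δ → Fin v) → Sub M → Fin v → ℕ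
mult {M} nb T x = ∑ (allFin M) (λ c → ⟦ T c ⟧ * inc nb c x)

nbhd : ∀ {M δ v} → (Fin M → Fin δ → Fin v) → Sub M → Sub v
nbhd nb T x = does (1 ≤? mult nb T x)

-- In both uses `e` exceeds half of `δ` (5 of 8 and `2 * h` of `3 * h`). This forces private
-- variables, since every other neighbour uses up at least two incidences.
IsExpander : ∀ {M δ v} → ℕ → ℕ → (Fin M → Fin δ → Fin v) → Set
IsExpander {M} s e nb = ∀ T → card T ≤ s → e * card T ≤ card (nbhd nb T)

inc-pos : ∀ {M δ v} (nb : Fin M → Fin δ → Fin v) c i → 1 ≤ inc nb c (nb c i)
inc-pos nb c i = card-pos (λ j → nb c j == nb c i) {i} (==-refl (nb c i))

mult-∈ : ∀ {M δ v} (nb : Fin M → Fin δ → Fin v) T {c} x → T c ≡ true → inc nb c x ≤ mult nb T x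
mult-∈ nb T {c} x p = ≤-trans (≤-reflexive (sym (trans (cong (λ b → ⟦ b ⟧ * inc nb c x) p) (+-identityʳ _))))
  (∑-∈ (λ c → ⟦ T c ⟧ * inc nb c x) (∈-allFin c))

∑-inc : ∀ {M δ v} (nb : Fin M → Fin δ → Fin v) c → ∑ (allFin v) (inc nb c) ≡ δ
∑-inc {M} {δ} {v} nb c = trans (∑-swap (allFin v) (allFin δ) _) (trans (∑-cong (allFin δ) (λ i → ∑-δ1′ (nb c i)))
  (trans (∑-const (allFin δ) 1) (trans (*-identityʳ _) (length-allFin δ))))

∑-mult : ∀ {M δ v} (nb : Fin M → Fin δ → Fin v) T → ∑ (allFin v) (mult nb T) ≡ card T * δ
∑-mult {M} {δ} {v} nb T = trans (∑-swap (allFin v) (allFin M) _) (trans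
  (∑-cong (allFin M) (λ c → trans (∑-*ˡ (allFin v) ⟦ T c ⟧ (inc nb c)) (cong (⟦ T c ⟧ *_) (∑-inc nb c))))
  (∑-*ʳ (allFin M) δ (λ c → ⟦ T c ⟧)))

covered : ∀ {D v} → Tuple v D → Sub v
covered {D} f x = does (1 ≤? ∑ (allFin D) (λ i → ⟦ f i == x ⟧))

⟦1≤?⟧ : ∀ m → ⟦ does (1 ≤? m) ⟧ ≤ m
⟦1≤?⟧ zero = z≤n
⟦1≤?⟧ (suc m) = s≤s z≤n

card-covered : ∀ {D v} (f : Tuple v D) → card (covered f) ≤ D
card-covered {D} {v} f = ≤-trans (∑-mono (allFin v) (λ x → ⟦1≤?⟧ (∑ (allFin D) (λ i → ⟦ f i == x ⟧))))
  (≤-reflexive (trans (∑-swap (allFin v) (allFin D) _) (trans (∑-cong (allFin D) (λ i → ∑-δ1′ (f i)))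
  (trans (∑-const (allFin D) 1) (trans (*-identityʳ _) (length-allFin D))))))

covered-intro : ∀ {D v} (f : Tuple v D) {x} i → f i ≡ x → covered f x ≡ true
covered-intro {D} f {x} i refl = dec-true (1 ≤? _) (card-pos (λ j → f j == f i) {i} (==-refl (f i)))

cover-list : ∀ {v} → Fin v → (Z : Sub v) (ys : List (Fin v)) → ∀ D → ∑ ys (λ y → ⟦ Z y ⟧) ≤ D →
  ∃ λ (f : Tuple v D) → ∀ x → x ∈ ys → Z x ≡ true → ∃ λ i → f i ≡ x
cover-list x₀ Z [] D h = (λ _ → x₀) , λ x ()
cover-list x₀ Z (y ∷ ys) D h with Z y in eq
cover-list x₀ Z (y ∷ ys) D h | false with cover-list x₀ Z ys D h
... | f , hf = f , λ { x (here refl) p → ⊥-elim (true≢false p eq) ; x (there x∈) p → hf x x∈ p }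
cover-list x₀ Z (y ∷ ys) (suc D) (s≤s h) | true with cover-list x₀ Z ys D h
... | f , hf = consF y f , λ { x (here refl) p → Fin.zero , refl
                             ; x (there x∈) p → Fin.suc (proj₁ (hf x x∈ p)) , proj₂ (hf x x∈ p) }

cover : ∀ {v} → Fin v → (Z : Sub v) → ∀ D → card Z ≤ D → ∃ λ (f : Tuple v D) → ∀ x → Z x ≡ true → ∃ λ i → f i ≡ x
cover x₀ Z D h with cover-list x₀ Z (allFin _) D h
... | f , hf = f , λ x → hf x (∈-allFin x)

-- Union bound over the ranges of `e * t` entries that might contain all neighbours of `t`
-- constraints. A random `δ`-tuple falls into such a range with probability at most
-- `(e * s / v) ^ δ`; `sparse` says that this is at most `1 / (2 N B)`.
module ExpanderExists (v δ N e s : ℕ) (v-pos : 1 ≤ v) (N-pos : 1 ≤ N)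
                      (sparse : 2 * N * (4 * s * v ^ e * (e * s) ^ δ) ≤ v ^ δ) where

  Test : Set
  Test = Σ (Fin s) (λ t → Tuple v (e * suc (toℕ t)))

  -- A test is a potential neighbourhood of suc t vertices that is too small.
  tests : List Test
  tests = concatMap (λ t → map (λ f → t , f) (allFuns (e * suc (toℕ t)) v)) (allFin s)

  -- Makes the total weight of the tests of each size equal to v ^ (e * s).
  weight : Test → ℕ
  weight (t , _) = v ^ (e * (s ∸ suc (toℕ t)))

  hit : Test → Tuple v δ → Bool
  hit (t , f) c = allF (λ i → covered f (c i))

  -- Per hit, `v ^ e` pays for the `v ^ (e * t)` tests of size `t`; `4 * s` outweighs the `s` sizes
  -- and the factor 2 lost by the greedy choice.
  B : ℕ
  B = 4 * s * v ^ e

  hit-count : ∀ τ → ∑ (allFuns δ v) (λ c → ⟦ hit τ c ⟧) ≤ (e * s) ^ δ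
  hit-count (t , f) = ≤-trans (≤-reflexive (∑-allFuns-allF δ (λ _ → covered f) _ (λ _ → refl)))
    (^-monoˡ-≤ δ (≤-trans (card-covered f) (*-monoʳ-≤ e (toℕ<n t))))

  v^-pos : ∀ a → 1 ≤ v ^ a
  v^-pos = m^n>0 v {{>-nonZero v-pos}}

  open Greedy (allFuns δ v) tests hit weight B N
    (≤-trans (v^-pos δ) (≤-reflexive (sym (length-allFuns δ v)))) N-pos
    (λ τ → ≤-trans (*-monoʳ-≤ (2 * N) (*-monoʳ-≤ B (hit-count τ)))
      (≤-trans sparse (≤-reflexive (sym (length-allFuns δ v)))))

  split-power : ∀ {t} → t ≤ s → v ^ (e * t) * v ^ (e * (s ∸ t)) ≡ v ^ (e * s)
  split-power {t} t≤s = trans (sym (^-distribˡ-+-* v (e * t) (e * (s ∸ t))))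
    (cong (v ^_) (trans (sym (*-distribˡ-+ e t (s ∸ t))) (cong (e *_) (m+[n∸m]≡n t≤s))))

  total-weight : Φ₀ ≡ s * v ^ (e * s)
  total-weight = begin
    ∑ tests weight
      ≡⟨ ∑-concatMap (allFin s) (λ t → map (λ f → t , f) (allFuns (e * suc (toℕ t)) v)) weight ⟩
    ∑ (allFin s) (λ t → ∑ (map (λ f → t , f) (allFuns (e * suc (toℕ t)) v)) weight)
      ≡⟨ ∑-cong (allFin s) (λ t → trans (∑-map (allFuns (e * suc (toℕ t)) v) (λ f → t , f) weight)
           (trans (∑-const (allFuns (e * suc (toℕ t)) v) (v ^ (e * (s ∸ suc (toℕ t)))))
           (trans (cong (_* v ^ (e * (s ∸ suc (toℕ t)))) (length-allFuns (e * suc (toℕ t)) v))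
             (split-power (toℕ<n t))))) ⟩
    ∑ (allFin s) (λ _ → v ^ (e * s)) ≡⟨ trans (∑-const (allFin s) _) (cong (_* v ^ (e * s)) (length-allFin s)) ⟩
    s * v ^ (e * s) ∎
    where open ≡-Reasoning

  ∈-tests : ∀ t (f : Tuple v (e * suc (toℕ t))) → f ∈ allFuns (e * suc (toℕ t)) v → (t , f) ∈ tests
  ∈-tests t f f∈ = ∈-concatMap⁺ (λ t → map (λ f → t , f) (allFuns (e * suc (toℕ t)) v))
    (lose (∈-allFin t) (∈-map⁺ (λ f → t , f) f∈))

  B-large : ∀ {t} → 1 ≤ t → t ≤ s → B ^ t ≤ 2 * s * v ^ (e * t) → ⊥
  B-large {suc t} _ t≤s h = <⇒≱ (begin-strict
    2 * s * v ^ (e * suc t)               <⟨ *-monoˡ-< (v ^ (e * suc t)) {{>-nonZero (v^-pos (e * suc t))}} 2s<4s ⟩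
    4 * s * v ^ (e * suc t)               ≡⟨ cong (4 * s *_) (sym (^-*-assoc v e (suc t))) ⟩
    4 * s * (v ^ e * (v ^ e) ^ t)         ≡⟨ sym (*-assoc (4 * s) (v ^ e) _) ⟩
    B * (v ^ e) ^ t                       ≤⟨ *-monoʳ-≤ B (^-monoˡ-≤ t (m≤n*m (v ^ e) (4 * s) {{>-nonZero 4s-pos}})) ⟩
    B * B ^ t                             ∎) h
    where
    open ≤-Reasoning
    s-pos : 1 ≤ s
    s-pos = ≤-trans (s≤s z≤n) t≤s
    4s-pos : 1 ≤ 4 * s
    4s-pos = ≤-trans s-pos (m≤m+n s _)
    2s<4s : 2 * s < 4 * s
    2s<4s = *-monoˡ-< s {{>-nonZero s-pos}} {2} {4} (s≤s (s≤s (s≤s z≤n)))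

  expander : ∃ λ (nb : Fin N → Fin δ → Fin v) → IsExpander s e nb
  expander with greedy
  ... | nb , light = nb , expands
    where
    x₀ : Fin v
    x₀ = fromℕ< v-pos
    -- All members of `T` hit a test that covers their neighbourhood, which raises its term to
    -- `weight τ * B ^ card T`, beyond the bound `2 * Φ₀`.
    dense : ∀ T → (t : Fin s) → card T ≡ suc (toℕ t) → card (nbhd nb T) ≤ e * suc (toℕ t) → ⊥
    dense T t eq small with cover x₀ (nbhd nb T) (e * suc (toℕ t)) small
    ... | f′ , cov with allFuns-complete f′
    ... | f , f∈ , f≗ = B-large {suc (toℕ t)} (s≤s z≤n) (toℕ<n t)
      (*-cancelˡ-≤ (weight τ) {{>-nonZero (v^-pos (e * (s ∸ suc (toℕ t))))}} (begin
        weight τ * B ^ suc (toℕ t)                 ≤⟨ *-monoʳ-≤ (weight τ) B^t≤ ⟩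
        weight τ * B ^ hits nb τ                   ≤⟨ light τ (∈-tests t f f∈) ⟩
        2 * Φ₀                                     ≡⟨ cong (2 *_) total-weight ⟩
        2 * (s * v ^ (e * s))                      ≡⟨ cong (λ z → 2 * (s * z)) (sym (split-power (toℕ<n t))) ⟩
        2 * (s * (v ^ (e * suc (toℕ t)) * weight τ)) ≡⟨ regroup s (v ^ (e * suc (toℕ t))) (weight τ) ⟩
        weight τ * (2 * s * v ^ (e * suc (toℕ t))) ∎))
      where
      open ≤-Reasoning
      τ : Test
      τ = t , f
      regroup : ∀ s p w → 2 * (s * (p * w)) ≡ w * (2 * s * p)
      regroup = solve-∀
      is-hit : ∀ c → T c ≡ true → hit τ (nb c) ≡ true
      is-hit c p = allF-intro hit-at
        where
        hit-at : ∀ i → covered f (nb c i) ≡ true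
        hit-at i with cov (nb c i) (dec-true (1 ≤? mult nb T (nb c i))
                        (≤-trans (inc-pos nb c i) (mult-∈ nb T (nb c i) p)))
        ... | j , fj = covered-intro f j (trans (f≗ j) fj)
      B^t≤ : B ^ suc (toℕ t) ≤ B ^ hits nb τ
      B^t≤ = ^-monoʳ-≤ B {{>-nonZero (≤-trans (≤-trans (≤-trans (s≤s z≤n) (toℕ<n t)) (m≤m+n s _))
          (m≤m*n (4 * s) (v ^ e) {{>-nonZero (v^-pos e)}}))}}
        (≤-trans (≤-reflexive (sym eq)) (card-mono is-hit))
    expands : IsExpander s e nb
    expands T T≤s with card T in eq
    ... | zero = ≤-trans (≤-reflexive (*-zeroʳ e)) z≤n
    ... | suc t with ≤-total (e * suc t) (card (nbhd nb T))
    ... | inj₁ ok = ok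
    ... | inj₂ small = ⊥-elim (dense T (fromℕ< T≤s) (trans eq (cong suc (sym (toℕ-fromℕ< T≤s))))
      (subst (λ z → card (nbhd nb T) ≤ e * suc z) (sym (toℕ-fromℕ< T≤s)) small))

-- Parities

⨁ : ∀ {a} → (Fin a → Bool) → Bool
⨁ {zero} f = false
⨁ {suc a} f = f Fin.zero xor ⨁ (λ i → f (Fin.suc i))

⨁-cong : ∀ {a} {f g : Fin a → Bool} → f ≗ g → ⨁ f ≡ ⨁ g
⨁-cong {zero} h = refl
⨁-cong {suc a} h = cong₂ _xor_ (h Fin.zero) (⨁-cong (λ i → h (Fin.suc i)))

xor-interchange : ∀ a b c d → (a xor b) xor (c xor d) ≡ (a xor c) xor (b xor d)
xor-interchange true true true true = refl
xor-interchange true true true false = refl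
xor-interchange true true false true = refl
xor-interchange true true false false = refl
xor-interchange true false true true = refl
xor-interchange true false true false = refl
xor-interchange true false false true = refl
xor-interchange true false false false = refl
xor-interchange false true true true = refl
xor-interchange false true true false = refl
xor-interchange false true false true = refl
xor-interchange false true false false = refl
xor-interchange false false c d = refl

⨁-xor : ∀ {a} (f g : Fin a → Bool) → ⨁ (λ i → f i xor g i) ≡ ⨁ f xor ⨁ g
⨁-xor {zero} f g = refl
⨁-xor {suc a} f g = trans (cong ((f Fin.zero xor g Fin.zero) xor_) (⨁-xor (λ i → f (Fin.suc i)) (λ i → g (Fin.suc i))))
  (xor-interchange (f Fin.zero) (g Fin.zero) _ _)

odd : ℕ → Bool
odd zero = false
odd (suc m) = not (odd m)

⨁-odd : ∀ {a} (f : Fin a → Bool) → ⨁ f ≡ odd (∑ (allFin a) (λ i → ⟦ f i ⟧))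
⨁-odd {zero} f = refl
⨁-odd {suc a} f rewrite ∑-suc (λ i → ⟦ f i ⟧) with f Fin.zero
... | true = cong not (⨁-odd (λ i → f (Fin.suc i)))
... | false = ⨁-odd (λ i → f (Fin.suc i))

⨁-false : ∀ {a} {f : Fin a → Bool} → (∀ i → f i ≡ false) → ⨁ f ≡ false
⨁-false {zero} h = refl
⨁-false {suc a} h rewrite h Fin.zero = ⨁-false (λ i → h (Fin.suc i))

-- Enumeration of subsets

allSubs : ∀ N → List (Sub N)
allSubs zero = (λ ()) ∷ []
allSubs (suc N) = concatMap (λ T → (λ { Fin.zero → false ; (Fin.suc i) → T i }) ∷
                                   (λ { Fin.zero → true ; (Fin.suc i) → T i }) ∷ []) (allSubs N)

allSubs-complete : ∀ {N} (T : Sub N) → ∃ λ U → U ∈ allSubs N × U ≗ T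
allSubs-complete {zero} T = _ , here refl , λ ()
allSubs-complete {suc N} T with allSubs-complete (λ i → T (Fin.suc i)) | T Fin.zero in eq
... | U , U∈ , h | false = _ , ∈-concatMap⁺ _ (lose U∈ (here refl)) , λ { Fin.zero → sym eq ; (Fin.suc i) → h i }
... | U , U∈ , h | true = _ , ∈-concatMap⁺ _ (lose U∈ (there (here refl))) , λ { Fin.zero → sym eq ; (Fin.suc i) → h i }

⋃ : ∀ {N} → (Sub N → Bool) → List (Sub N) → Sub N
⋃ ok [] = λ _ → false
⋃ ok (T ∷ Ts) = if ok T then T ∪ ⋃ ok Ts else ⋃ ok Ts

⋃-closed : ∀ {N} (ok : Sub N → Bool) (P : Sub N → Set) → (∀ {T} → ok T ≡ true → P T) → P (λ _ → false) →
  (∀ {T U} → P T → P U → P (T ∪ U)) → ∀ Ts → P (⋃ ok Ts)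
⋃-closed ok P emb p∅ p∪ [] = p∅
⋃-closed ok P emb p∅ p∪ (T ∷ Ts) with ok T in eq
... | true = p∪ (emb eq) (⋃-closed ok P emb p∅ p∪ Ts)
... | false = ⋃-closed ok P emb p∅ p∪ Ts

⋃-∈ : ∀ {N} (ok : Sub N → Bool) {T Ts} → T ∈ Ts → ok T ≡ true → T ⊆ ⋃ ok Ts
⋃-∈ ok (here {_} {Ts} refl) p i q rewrite p = ∨-introˡ _ q
⋃-∈ ok {Ts = U ∷ Ts} (there T∈) p i q with ok U
... | true = ∨-introʳ (U i) (⋃-∈ ok T∈ p i q)
... | false = ⋃-∈ ok T∈ p i q

⟦⟧*-pos : ∀ b {m} → 1 ≤ ⟦ b ⟧ * m → b ≡ true × 1 ≤ m
⟦⟧*-pos true h = refl , ≤-trans h (≤-reflexive (+-identityʳ _))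

_∖_ : ∀ {N} → Sub N → Fin N → Sub N
(T ∖ c) i = T i ∧ not (i == c)

-- XOR systems, where constraint c sums the variables nb c i

module System {M δ v : ℕ} (nb : Fin M → Fin δ → Fin v) where

  mult-mono : ∀ {T U} → T ⊆ U → ∀ x → mult nb T x ≤ mult nb U x
  mult-mono h x = ∑-mono (allFin M) (λ c → *-monoˡ-≤ (inc nb c x) (⟦⟧-mono (h c)))

  mult-cong : ∀ {T U} → T ≗ U → ∀ x → mult nb T x ≡ mult nb U x
  mult-cong h x = ∑-cong (allFin M) (λ c → cong (λ b → ⟦ b ⟧ * inc nb c x) (h c))

  mult-∪ : ∀ T U x → mult nb (T ∪ U) x ≤ mult nb T x + mult nb U x
  mult-∪ T U x = ≤-trans
    (∑-mono (allFin M) (λ c → ≤-trans (*-monoˡ-≤ (inc nb c x) (⟦⟧-∨ (T c) (U c)))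
      (≤-reflexive (*-distribʳ-+ (inc nb c x) ⟦ T c ⟧ ⟦ U c ⟧))))
    (≤-reflexive (∑-+ (allFin M) (λ c → ⟦ T c ⟧ * inc nb c x) (λ c → ⟦ U c ⟧ * inc nb c x)))

  indicator-∖ : ∀ (T : Sub M) {c₀} → T c₀ ≡ true → ∀ c → ⟦ T c ⟧ ≡ ⟦ c == c₀ ⟧ + ⟦ (T ∖ c₀) c ⟧
  indicator-∖ T {c₀} p c with c ≟ c₀
  ... | yes refl rewrite p = refl
  ... | no _ with T c
  ...   | true = refl
  ...   | false = refl

  card-∖ : ∀ T {c₀} → T c₀ ≡ true → card T ≡ suc (card (T ∖ c₀))
  card-∖ T {c₀} p = trans (∑-cong (allFin M) (indicator-∖ T p))
    (trans (∑-+ (allFin M) (λ c → ⟦ c == c₀ ⟧) (λ c → ⟦ (T ∖ c₀) c ⟧)) (cong (_+ card (T ∖ c₀)) (∑-δ1 c₀)))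

  mult-∖ : ∀ T {c₀} → T c₀ ≡ true → ∀ x → mult nb T x ≡ inc nb c₀ x + mult nb (T ∖ c₀) x
  mult-∖ T {c₀} p x = trans
    (∑-cong (allFin M) (λ c → trans (cong (_* inc nb c x) (indicator-∖ T p c))
      (*-distribʳ-+ (inc nb c x) ⟦ c == c₀ ⟧ ⟦ (T ∖ c₀) c ⟧)))
    (trans (∑-+ (allFin M) (λ c → ⟦ c == c₀ ⟧ * inc nb c x) (λ c → ⟦ (T ∖ c₀) c ⟧ * inc nb c x))
      (cong (_+ mult nb (T ∖ c₀) x) (∑-δ c₀ (λ c → inc nb c x))))

  val : (Fin v → Bool) → Fin M → Bool
  val g c = ⨁ (λ i → g (nb c i))

  toggle : Fin v → (Fin v → Bool) → (Fin v → Bool)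
  toggle u g x = (x == u) xor g x

  -- Toggling matters exactly for an odd number of occurrences; in `peel` the toggled variable
  -- occurs once in one constraint and not at all in the others.
  val-toggle : ∀ u g c → val (toggle u g) c ≡ odd (inc nb c u) xor val g c
  val-toggle u g c = trans (⨁-xor (λ i → nb c i == u) (λ i → g (nb c i)))
    (cong (_xor val g c) (⨁-odd (λ i → nb c i == u)))

  -- The values on S constrain T only if T is stuck; otherwise some constraint of T owns a private variable.
  Stuck : Sub v → Sub M → Set
  Stuck S T = ∀ x → mult nb T x ≡ 1 → S x ≡ true

  Stuck? : ∀ S T → Dec (Stuck S T)
  Stuck? S T = all? (λ x → (mult nb T x ≟ℕ 1) →-dec (S x ≟ᵇ true))

  -- A variable counted once by the union is counted at most once by each part and at least once by
  -- one of them, so it is already private there.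
  stuck-∪ : ∀ {S T U} → Stuck S T → Stuck S U → Stuck S (T ∪ U)
  stuck-∪ {S} {T} {U} p q x e with mult nb T x in eT | mult nb U x in eU
  ... | suc zero | _ = p x eT
  ... | zero | suc zero = q x eU
  ... | zero | zero = ⊥-elim (1+n≰n (subst₂ _≤_ e (cong₂ _+_ eT eU) (mult-∪ T U x)))
  ... | suc (suc m) | _ = ⊥-elim (<⇒≱ (s≤s (s≤s z≤n)) (subst₂ _≤_ eT e (mult-mono {T} {T ∪ U} (λ i → ∨-introˡ (U i)) x)))
  ... | zero | suc (suc m) = ⊥-elim (<⇒≱ (s≤s (s≤s z≤n)) (subst₂ _≤_ eU e (mult-mono {U} {T ∪ U} (λ i → ∨-introʳ (T i)) x)))

  ¬stuck : ∀ {S T} → ¬ Stuck S T → ∃ λ x → mult nb T x ≡ 1 × S x ≡ false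
  ¬stuck {S} {T} h with ¬∀⟶∃¬ v (λ x → mult nb T x ≡ 1 → S x ≡ true) (λ x → (mult nb T x ≟ℕ 1) →-dec (S x ≟ᵇ true)) h
  ... | x , nx with mult nb T x ≟ℕ 1 | S x in eq
  ... | yes p | false = x , p , eq
  ... | yes p | true = ⊥-elim (nx (λ _ → refl))
  ... | no p | _ = ⊥-elim (nx (λ e → ⊥-elim (p e)))

  Ok : Sub M → ℕ → Sub v → Sub M → Set
  Ok dom K S T = (∀ c → T c ≡ true → dom c ≡ true) × Stuck S T × card T ≤ K

  Ok? : ∀ dom K S T → Dec (Ok dom K S T)
  Ok? dom K S T = all? (λ c → (T c ≟ᵇ true) →-dec (dom c ≟ᵇ true)) ×-dec Stuck? S T ×-dec card T ≤? K

  Ok-cong : ∀ {dom K S T U} → T ≗ U → Ok dom K S T → Ok dom K S U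
  Ok-cong h (p , q , r) = (λ c e → p c (trans (h c) e)) , (λ x e → q x (trans (mult-cong h x) e)) ,
    ≤-trans (≤-reflexive (sym (card-cong h))) r

  -- No stuck set has size between K + 1 and 2K, so the union of all stuck sets of size at most K,
  -- which is again stuck, has size at most K as well.
  Small : Sub M → ℕ → Sub v → Set
  Small dom K S = ∀ T → T ⊆ dom → Stuck S T → card T ≤ K + K → card T ≤ K

  abstract
    -- Abstract, so that later proofs never unfold the union over all subsets.
    cl : Sub M → ℕ → Sub v → Sub M
    cl dom K S = ⋃ (λ T → does (Ok? dom K S T)) (allSubs M)

    cl-ok : ∀ {dom K S} → Small dom K S → Ok dom K S (cl dom K S)
    cl-ok {dom} {K} {S} small = ⋃-closed _ (Ok dom K S) (λ {T} → does-true (Ok? dom K S T))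
      ((λ c ()) , (λ x e → ⊥-elim (0≢1 (trans (sym (∑-0 (allFin M))) e))) , ≤-trans (≤-reflexive (∑-0 (allFin M))) z≤n)
      (λ {T} {U} → join {T} {U}) (allSubs M)
      where
      0≢1 : 0 ≢ 1
      0≢1 ()
      join : ∀ {T U} → Ok dom K S T → Ok dom K S U → Ok dom K S (T ∪ U)
      join {T} {U} (p , q , r) (p′ , q′ , r′) = sub , stuck-∪ {S} {T} {U} q q′ ,
        small (T ∪ U) sub (stuck-∪ {S} {T} {U} q q′) (≤-trans (card-∪ T U) (+-mono-≤ r r′))
        where
        sub : (T ∪ U) ⊆ dom
        sub c e with ∨-elim (T c) e
        ... | inj₁ t = p c t
        ... | inj₂ u = p′ c u

    cl-max : ∀ {dom K S T} → Ok dom K S T → T ⊆ cl dom K S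
    cl-max {dom} {K} {S} {T} ok c e with allSubs-complete T
    ... | U , U∈ , h = ⋃-∈ _ U∈ (dec-true (Ok? dom K S U) (Ok-cong (λ i → sym (h i)) ok)) c (trans (h c) e)

  cl-mono : ∀ {dom dom′ K S S′} → Small dom K S → dom ⊆ dom′ → S ⊆ S′ → cl dom K S ⊆ cl dom′ K S′
  cl-mono small d s with cl-ok small
  ... | p , q , r = cl-max ((λ c e → d c (p c e)) , (λ x e → s x (q x e)) , r)

  -- Some `c₁` in `P` owns a private variable `u` that is not frozen by `F`. The other constraints
  -- are solved first; toggling `u` then repairs `c₁` and disturbs none of them.
  peel : (F : Sub v) (k : ℕ) (P : Sub M) → card P ≤ k →
    (∀ Q → Q ⊆ P → (∃ λ c → Q c ≡ true) → ∃ λ u → mult nb Q u ≡ 1 × F u ≡ false) →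
    ∀ (g : Fin v → Bool) (target : Fin M → Bool) →
    ∃ λ g′ → (∀ u → F u ≡ true → g′ u ≡ g u) × (∀ c → P c ≡ true → val g′ c ≡ target c)
  peel F zero P small free g target = g , (λ _ _ → refl) ,
    λ c p → ⊥-elim (true≢false p (card-zero P (n≤0⇒n≡0 small) c))
  peel F (suc k) P small free g target with card P in eqP
  ... | zero = g , (λ _ _ → refl) , λ c p → ⊥-elim (true≢false p (card-zero P eqP c))
  ... | suc _ with ∑-pos (allFin M) (λ c → ⟦ P c ⟧) (≤-trans (s≤s z≤n) (≤-reflexive (sym eqP)))
  ... | c , _ , pc with free P (λ _ p → p) (c , ⟦⟧-pos pc)
  ... | u , mu , fu with ∑-pos (allFin M) (λ c → ⟦ P c ⟧ * inc nb c u) (≤-reflexive (sym mu))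
  ... | c₁ , _ , pc₁ = result
    where
    Pc₁ : P c₁ ≡ true
    Pc₁ = proj₁ (⟦⟧*-pos (P c₁) pc₁)
    P₁ : Sub M
    P₁ = P ∖ c₁
    inc-u : inc nb c₁ u + mult nb P₁ u ≡ 1
    inc-u = trans (sym (mult-∖ P Pc₁ u)) mu
    inc-pos′ : 1 ≤ inc nb c₁ u
    inc-pos′ = proj₂ (⟦⟧*-pos (P c₁) pc₁)
    inc≡1 : inc nb c₁ u ≡ 1
    inc≡1 = ≤-antisym (≤-trans (m≤m+n _ _) (≤-reflexive inc-u)) inc-pos′
    rest≡0 : mult nb P₁ u ≡ 0
    rest≡0 = suc-injective (trans (cong (_+ mult nb P₁ u) (sym inc≡1)) inc-u)
    P₁⊆P : P₁ ⊆ P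
    P₁⊆P i e = proj₁ (∧-true e)
    unaffected : ∀ {c} → P₁ c ≡ true → inc nb c u ≡ 0
    unaffected {c} e = n≤0⇒n≡0 (≤-trans (mult-∈ nb P₁ u e) (≤-reflexive rest≡0))
    in-P₁ : ∀ c → P c ≡ true → c ≢ c₁ → P₁ c ≡ true
    in-P₁ c e ne = ∧-intro e (cong not (dec-false (c ≟ c₁) ne))
    Res : Set
    Res = ∃ λ g′ → (∀ u → F u ≡ true → g′ u ≡ g u) × (∀ c → P c ≡ true → val g′ c ≡ target c)
    result : Res
    result with peel F k P₁ (s≤s⁻¹ (≤-trans (≤-reflexive (trans (sym (card-∖ P Pc₁)) eqP)) small))
                  (λ Q Q⊆ → free Q (λ i e → P₁⊆P i (Q⊆ i e))) g target
    ... | g₁ , keep , hit with val g₁ c₁ ≟ᵇ target c₁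
    ... | yes e = g₁ , keep , sat
      where
      sat : ∀ c → P c ≡ true → val g₁ c ≡ target c
      sat c p with c ≟ c₁
      ... | yes refl = e
      ... | no ne = hit c (in-P₁ c p ne)
    ... | no ne₁ = toggle u g₁ , keep′ , sat
      where
      keep′ : ∀ x → F x ≡ true → toggle u g₁ x ≡ g x
      keep′ x fx with x ≟ u
      ... | yes refl = ⊥-elim (true≢false fx fu)
      ... | no _ = keep x fx
      flip-≢ : ∀ a b → a ≢ b → not a ≡ b
      flip-≢ true true n = ⊥-elim (n refl)
      flip-≢ true false n = refl
      flip-≢ false true n = refl
      flip-≢ false false n = ⊥-elim (n refl)
      sat : ∀ c → P c ≡ true → val (toggle u g₁) c ≡ target c
      sat c p with c ≟ c₁
      ... | yes refl = trans (val-toggle u g₁ c) (trans (cong (λ m → odd m xor val g₁ c) inc≡1) (flip-≢ _ _ ne₁))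
      ... | no ne = trans (val-toggle u g₁ c) (trans (cong (λ m → odd m xor val g₁ c) (unaffected (in-P₁ c p ne)))
        (hit c (in-P₁ c p ne)))

  abstract
    -- If the closure together with a nonempty `Q ⊆ P` were stuck, it would have at most `K + K`
    -- constraints, hence at most `K` by `Small`, and would lie inside the closure, which `P`
    -- avoids. So it has a private variable outside `S`. The closure is stuck and cannot own it, so
    -- it is private to `Q`.
    extend : ∀ {dom K S} → Small dom K S → (P : Sub M) → P ⊆ dom → card P ≤ K →
      (∀ c → P c ≡ true → cl dom K S c ≡ false) →
      (F : Sub v) → (∀ u → S u ≡ false → mult nb (cl dom K S) u ≡ 0 → 1 ≤ mult nb P u → F u ≡ false) →
      ∀ (g : Fin v → Bool) (target : Fin M → Bool) →
      ∃ λ g′ → (∀ u → F u ≡ true → g′ u ≡ g u) × (∀ c → P c ≡ true → val g′ c ≡ target c)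
    extend {dom} {K} {S} small P P⊆ P≤K disjoint F F-free = peel F (card P) P ≤-refl free
      where
      T₀ : Sub M
      T₀ = cl dom K S
      T₀-ok : Ok dom K S T₀
      T₀-ok = cl-ok small
      free : ∀ Q → Q ⊆ P → (∃ λ c → Q c ≡ true) → ∃ λ u → mult nb Q u ≡ 1 × F u ≡ false
      free Q Q⊆P (c , qc) with ¬stuck {S} {T₀ ∪ Q} not-stuck
        where
        sub : (T₀ ∪ Q) ⊆ dom
        sub i e with ∨-elim (T₀ i) e
        ... | inj₁ t = proj₁ T₀-ok i t
        ... | inj₂ q = P⊆ i (Q⊆P i q)
        not-stuck : ¬ Stuck S (T₀ ∪ Q)
        not-stuck st = true≢false
          (cl-max {T = T₀ ∪ Q} (sub , st , small (T₀ ∪ Q) sub st (≤-trans (card-∪ T₀ Q)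
            (+-mono-≤ (proj₂ (proj₂ T₀-ok)) (≤-trans (card-mono Q⊆P) P≤K)))) c (∨-introʳ (T₀ c) qc))
          (disjoint c (Q⊆P c qc))
      ... | u , mu , su = u , ≤-antisym
          (≤-trans (mult-mono {Q} {T₀ ∪ Q} (λ i → ∨-introʳ (T₀ i)) u) (≤-reflexive mu)) Q≥1 ,
          F-free u su T₀≡0 (≤-trans Q≥1 (mult-mono Q⊆P u))
        where
        T₀≤1 : mult nb T₀ u ≤ 1
        T₀≤1 = ≤-trans (mult-mono {T₀} {T₀ ∪ Q} (λ i → ∨-introˡ (Q i)) u) (≤-reflexive mu)
        T₀≡0 : mult nb T₀ u ≡ 0
        T₀≡0 = n<1⇒n≡0 (≤∧≢⇒< T₀≤1 (λ e → true≢false (proj₁ (proj₂ T₀-ok) u e) su))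
        Q≥1 : 1 ≤ mult nb Q u
        Q≥1 = ≤-trans (≤-reflexive (sym mu)) (≤-trans (mult-∪ T₀ Q u) (≤-reflexive (cong (_+ mult nb Q u) T₀≡0)))

-- Sums over disjoint unions and products of index sets

∑-split : ∀ m {n} (f : Fin (m + n) → ℕ) →
  ∑ (allFin (m + n)) f ≡ ∑ (allFin m) (λ i → f (i ↑ˡ n)) + ∑ (allFin n) (λ i → f (m ↑ʳ i))
∑-split zero f = refl
∑-split (suc m) {n} f = begin
  ∑ (allFin (suc (m + n))) f                                         ≡⟨ ∑-suc f ⟩
  f Fin.zero + ∑ (allFin (m + n)) (λ i → f (Fin.suc i))              ≡⟨ cong (f Fin.zero +_) (∑-split m (λ i → f (Fin.suc i))) ⟩
  f Fin.zero + (∑ (allFin m) (λ i → f (Fin.suc (i ↑ˡ n))) + rest)     ≡⟨ sym (+-assoc (f Fin.zero) _ rest) ⟩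
  f Fin.zero + ∑ (allFin m) (λ i → f (Fin.suc (i ↑ˡ n))) + rest       ≡⟨ cong (_+ rest) (sym (∑-suc (λ i → f (i ↑ˡ n)))) ⟩
  ∑ (allFin (suc m)) (λ i → f (i ↑ˡ n)) + rest                       ∎
  where
  open ≡-Reasoning
  rest : ℕ
  rest = ∑ (allFin n) (λ i → f (suc m ↑ʳ i))

∑-combine : ∀ a b (f : Fin (a * b) → ℕ) →
  ∑ (allFin (a * b)) f ≡ ∑ (allFin a) (λ ℓ → ∑ (allFin b) (λ j → f (combine ℓ j)))
∑-combine zero b f = refl
∑-combine (suc a) b f = trans (∑-split b f) (trans
  (cong (∑ (allFin b) (λ i → f (i ↑ˡ (a * b))) +_) (∑-combine a b (λ i → f (b ↑ʳ i))))
  (sym (∑-suc {a} (λ ℓ → ∑ (allFin b) (λ j → f (combine {suc a} ℓ j))))))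

∑-inject₁ : ∀ n (f : Fin (suc n) → ℕ) → ∑ (allFin n) (λ i → f (inject₁ i)) ≤ ∑ (allFin (suc n)) f
∑-inject₁ zero f = z≤n
∑-inject₁ (suc n) f = subst₂ _≤_ (sym (∑-suc (λ i → f (inject₁ i)))) (sym (∑-suc f))
  (+-monoʳ-≤ (f Fin.zero) (∑-inject₁ n (λ i → f (Fin.suc i))))

combine-== : ∀ {a b} (i i′ : Fin a) (j j′ : Fin b) → ⟦ combine i j == combine i′ j′ ⟧ ≡ ⟦ i == i′ ⟧ * ⟦ j == j′ ⟧
combine-== i i′ j j′ = trans (cong ⟦_⟧ (bool-ext
  (λ p → let (e , e′) = combine-injective i j i′ j′ (==-true p) in
         ∧-intro (dec-true (i ≟ i′) e) (dec-true (j ≟ j′) e′))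
  (λ p → dec-true (combine i j ≟ combine i′ j′)
           (cong₂ combine (==-true {i = i} {i′} (proj₁ (∧-true p))) (==-true {i = j} {j′} (proj₂ (∧-true {i == i′} p)))))))
  (⟦⟧-∧ (i == i′) (j == j′))

module _ {M δ v : ℕ} (nb : Fin M → Fin δ → Fin v) where
  open System nb

  inc-witness : ∀ c x → 1 ≤ inc nb c x → ∃ λ i → nb c i ≡ x
  inc-witness c x h with ∑-pos (allFin δ) (λ i → ⟦ nb c i == x ⟧) h
  ... | i , _ , p = i , ==-true (⟦⟧-pos p)

  mult-witness : ∀ T x → 1 ≤ mult nb T x → ∃ λ c → T c ≡ true × ∃ λ i → nb c i ≡ x
  mult-witness T x h with ∑-pos (allFin M) (λ c → ⟦ T c ⟧ * inc nb c x) h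
  ... | c , _ , p with ⟦⟧*-pos (T c) p
  ... | t , q = c , t , inc-witness c x q

  mult-var : ∀ T {c} i → T c ≡ true → 1 ≤ mult nb T (nb c i)
  mult-var T {c} i t = ≤-trans (inc-pos nb c i) (mult-∈ nb T (nb c i) t)

  -- Every neighbour outside S is counted at least twice.
  stuck-nbhd : ∀ {S T} → Stuck S T → 2 * card (nbhd nb T) ≤ card T * δ + card S
  stuck-nbhd {S} {T} st = begin
    2 * card (nbhd nb T)                             ≡⟨ sym (∑-*ˡ (allFin v) 2 (λ x → ⟦ nbhd nb T x ⟧)) ⟩
    ∑ (allFin v) (λ x → 2 * ⟦ nbhd nb T x ⟧)         ≤⟨ ∑-mono (allFin v) pointwise ⟩
    ∑ (allFin v) (λ x → mult nb T x + ⟦ S x ⟧)       ≡⟨ ∑-+ (allFin v) (mult nb T) (λ x → ⟦ S x ⟧) ⟩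
    ∑ (allFin v) (mult nb T) + card S                ≡⟨ cong (_+ card S) (∑-mult nb T) ⟩
    card T * δ + card S                              ∎
    where
    open ≤-Reasoning
    pointwise : ∀ x → 2 * ⟦ nbhd nb T x ⟧ ≤ mult nb T x + ⟦ S x ⟧
    pointwise x with mult nb T x in eq
    ... | zero = z≤n
    ... | suc zero rewrite st x eq = ≤-refl
    ... | suc (suc m) = s≤s (s≤s z≤n)

  stuck-single : ∀ {S} c → (∀ i → S (nb c i) ≡ true) → Stuck S (single c)
  stuck-single {S} c h x e with inc-witness c x (≤-reflexive (trans (sym e) (∑-δ c (λ c′ → inc nb c′ x))))
  ... | i , refl = h i

card-single : ∀ {n} (a : Fin n) → card (single a) ≡ 1
card-single = ∑-δ1

-- The layered base system

module Layers (Lt w : ℕ) (P₀ : Fin w → Fin 8 → Fin w) (j₀ : Fin w) where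

  Y : ℕ
  Y = suc Lt * w

  layer : Fin Y → Fin (suc Lt)
  layer y = proj₁ (remQuot w y)

  column : Fin Y → Fin w
  column y = proj₂ (remQuot {suc Lt} w y)

  lay : Fin Y → ℕ
  lay y = toℕ (layer y)

  top : Fin Y
  top = combine (fromℕ Lt) j₀

  -- In layer 0 all nine summands of a constraint coincide, so it says that the variable vanishes.
  below : Fin (suc Lt) → Fin w → Fin 8 → Fin Y
  below Fin.zero j i = combine {suc Lt} Fin.zero j
  below (Fin.suc ℓ) j i = combine (inject₁ ℓ) (P₀ j i)

  -- One constraint per variable: above layer 0, `y` and the eight variables below it sum to 0.
  nby : Fin Y → Fin 9 → Fin Y
  nby y Fin.zero = y
  nby y (Fin.suc i) = below (layer y) (column y) i

  layer-combine : ∀ (ℓ : Fin (suc Lt)) (j : Fin w) → layer (combine ℓ j) ≡ ℓ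
  layer-combine ℓ j = cong proj₁ (remQuot-combine ℓ j)

  column-combine : ∀ (ℓ : Fin (suc Lt)) (j : Fin w) → column (combine ℓ j) ≡ j
  column-combine ℓ j = cong proj₂ (remQuot-combine ℓ j)

  lay-top : lay top ≡ Lt
  lay-top = trans (cong toℕ (layer-combine (fromℕ Lt) j₀)) (toℕ-fromℕ Lt)

  lay-below : ∀ ℓ j i → lay (below ℓ j i) ≡ toℕ ℓ ∸ 1
  lay-below Fin.zero j i = cong toℕ (layer-combine Fin.zero j)
  lay-below (Fin.suc ℓ) j i = trans (cong toℕ (layer-combine (inject₁ ℓ) (P₀ j i))) (toℕ-inject₁ ℓ)

  nby-zero : ∀ y → lay y ≡ 0 → ∀ i → nby y i ≡ y
  nby-zero y e Fin.zero = refl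
  nby-zero y e (Fin.suc i) with layer y in eq
  ... | Fin.zero = trans (cong (λ z → combine {suc Lt} z (column y)) (sym eq)) (combine-remQuot {suc Lt} w y)

  lay-nby≤ : ∀ y i → lay (nby y i) ≤ lay y
  lay-nby≤ y Fin.zero = ≤-refl
  lay-nby≤ y (Fin.suc i) = ≤-trans (≤-reflexive (lay-below (layer y) (column y) i)) (m∸n≤m (lay y) 1)

  lay-nby≥ : ∀ y i → lay y ∸ 1 ≤ lay (nby y i)
  lay-nby≥ y Fin.zero = m∸n≤m (lay y) 1
  lay-nby≥ y (Fin.suc i) = ≤-reflexive (sym (lay-below (layer y) (column y) i))

  open System nby

  row : Sub Y → Fin (suc Lt) → Sub w
  row T ℓ j = T (combine ℓ j)

  card-rows : ∀ T → card T ≡ ∑ (allFin (suc Lt)) (λ ℓ → card (row T ℓ))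
  card-rows T = ∑-combine (suc Lt) w (λ y → ⟦ T y ⟧)

  card-row≤ : ∀ T ℓ → card (row T ℓ) ≤ card T
  card-row≤ T ℓ = ≤-trans (∑-∈ (λ ℓ → card (row T ℓ)) (∈-allFin ℓ)) (≤-reflexive (sym (card-rows T)))

  Above0 : Sub Y → Set
  Above0 T = ∀ y → T y ≡ true → 1 ≤ lay y

  row-zero : ∀ {T} → Above0 T → ∀ j → T (combine {suc Lt} Fin.zero j) ≡ false
  row-zero above j = ≢true⇒false (λ t → <⇒≱ (above _ t) (≤-reflexive (cong toℕ (layer-combine Fin.zero j))))

  -- A variable occurs in its own constraint and, as prescribed by `P₀`, in constraints one layer
  -- higher. `Above0` excludes layer 0, whose constraints contain their variable nine times.
  mult-row : ∀ {T} → Above0 T → (ℓ : Fin Lt) (j : Fin w) →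
    mult nby T (combine (inject₁ ℓ) j) ≡ ⟦ T (combine (inject₁ ℓ) j) ⟧ + mult P₀ (row T (Fin.suc ℓ)) j
  mult-row {T} above ℓ j = begin
    mult nby T u
      ≡⟨ ∑-cong (allFin Y) (λ y → trans (cong (⟦ T y ⟧ *_) (∑-suc (λ i → ⟦ nby y i == u ⟧)))
           (trans (*-distribˡ-+ ⟦ T y ⟧ ⟦ y == u ⟧ _) (cong (_+ ⟦ T y ⟧ * down y) (*-comm ⟦ T y ⟧ ⟦ y == u ⟧)))) ⟩
    ∑ (allFin Y) (λ y → ⟦ y == u ⟧ * ⟦ T y ⟧ + ⟦ T y ⟧ * down y)
      ≡⟨ ∑-+ (allFin Y) (λ y → ⟦ y == u ⟧ * ⟦ T y ⟧) (λ y → ⟦ T y ⟧ * down y) ⟩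
    ∑ (allFin Y) (λ y → ⟦ y == u ⟧ * ⟦ T y ⟧) + ∑ (allFin Y) (λ y → ⟦ T y ⟧ * down y)
      ≡⟨ cong₂ _+_ (∑-δ u (λ y → ⟦ T y ⟧)) lower ⟩
    ⟦ T u ⟧ + mult P₀ (row T (Fin.suc ℓ)) j ∎
    where
    open ≡-Reasoning
    u : Fin Y
    u = combine (inject₁ ℓ) j
    down : Fin Y → ℕ
    down y = ∑ (allFin 8) (λ i → ⟦ below (layer y) (column y) i == u ⟧)
    down′ : Fin (suc Lt) → Fin w → ℕ
    down′ ℓ′ j′ = ∑ (allFin 8) (λ i → ⟦ below ℓ′ j′ i == u ⟧)
    inject₁-== : ∀ (ℓ′ : Fin Lt) → inject₁ ℓ′ == inject₁ ℓ ≡ ℓ′ == ℓ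
    inject₁-== ℓ′ = bool-ext
      (λ p → dec-true (ℓ′ ≟ ℓ) (inject₁-injective (==-true p)))
      (λ p → dec-true (inject₁ ℓ′ ≟ inject₁ ℓ) (cong inject₁ (==-true {i = ℓ′} p)))
    down-suc : ∀ ℓ′ j′ → down′ (Fin.suc ℓ′) j′ ≡ ⟦ ℓ′ == ℓ ⟧ * inc P₀ j′ j
    down-suc ℓ′ j′ = trans
      (∑-cong (allFin 8) (λ i → trans (combine-== (inject₁ ℓ′) (inject₁ ℓ) (P₀ j′ i) j)
        (cong (λ b → ⟦ b ⟧ * ⟦ P₀ j′ i == j ⟧) (inject₁-== ℓ′))))
      (∑-*ˡ (allFin 8) ⟦ ℓ′ == ℓ ⟧ (λ i → ⟦ P₀ j′ i == j ⟧))
    left-comm : ∀ a b c → a * (b * c) ≡ b * (a * c)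
    left-comm = solve-∀
    lower : ∑ (allFin Y) (λ y → ⟦ T y ⟧ * down y) ≡ mult P₀ (row T (Fin.suc ℓ)) j
    lower = begin
      ∑ (allFin Y) (λ y → ⟦ T y ⟧ * down y) ≡⟨ ∑-combine (suc Lt) w (λ y → ⟦ T y ⟧ * down y) ⟩
      ∑ (allFin (suc Lt)) (λ ℓ′ → ∑ (allFin w) (λ j′ → ⟦ T (combine ℓ′ j′) ⟧ * down (combine ℓ′ j′)))
        ≡⟨ ∑-cong (allFin (suc Lt)) (λ ℓ′ → ∑-cong (allFin w) (λ j′ → cong (⟦ T (combine ℓ′ j′) ⟧ *_)
             (cong₂ down′ (layer-combine ℓ′ j′) (column-combine ℓ′ j′)))) ⟩
      ∑ (allFin (suc Lt)) (λ ℓ′ → ∑ (allFin w) (λ j′ → ⟦ T (combine ℓ′ j′) ⟧ * down′ ℓ′ j′))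
        ≡⟨ ∑-suc (λ ℓ′ → ∑ (allFin w) (λ j′ → ⟦ T (combine ℓ′ j′) ⟧ * down′ ℓ′ j′)) ⟩
      ∑ (allFin w) (λ j′ → ⟦ T (combine {suc Lt} Fin.zero j′) ⟧ * down′ Fin.zero j′)
        + ∑ (allFin Lt) (λ ℓ′ → ∑ (allFin w) (λ j′ → ⟦ T (combine (Fin.suc ℓ′) j′) ⟧ * down′ (Fin.suc ℓ′) j′))
        ≡⟨ cong₂ _+_
             (trans (∑-cong (allFin w) (λ j′ → cong (λ b → ⟦ b ⟧ * down′ Fin.zero j′) (row-zero {T} above j′))) (∑-0 (allFin w)))
             (∑-cong (allFin Lt) (λ ℓ′ → trans
               (∑-cong (allFin w) (λ j′ → trans (cong (⟦ T (combine (Fin.suc ℓ′) j′) ⟧ *_) (down-suc ℓ′ j′))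
                 (left-comm ⟦ T (combine (Fin.suc ℓ′) j′) ⟧ ⟦ ℓ′ == ℓ ⟧ (inc P₀ j′ j))))
               (∑-*ˡ (allFin w) ⟦ ℓ′ == ℓ ⟧ (λ j′ → ⟦ T (combine (Fin.suc ℓ′) j′) ⟧ * inc P₀ j′ j)))) ⟩
      ∑ (allFin Lt) (λ ℓ′ → ⟦ ℓ′ == ℓ ⟧ * mult P₀ (row T (Fin.suc ℓ′)) j)
        ≡⟨ ∑-δ ℓ (λ ℓ′ → mult P₀ (row T (Fin.suc ℓ′)) j) ⟩
      mult P₀ (row T (Fin.suc ℓ)) j ∎

  -- As `2 * 5 - 8 = 2`, a row `U` of `T` has at least `2 * card U` neighbours that it meets only
  -- once. Each of them either has its own constraint in `T` or is private to `T`, hence in `C` and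
  -- in `E`. So twice a row of `T` is at most the row of `T` plus the row of `E` one layer lower;
  -- summing over the layers gives `2 * card T ≤ card T + card E`.
  stuck-small : ∀ {s} → IsExpander s 5 P₀ → ∀ {C E : Sub Y} → (∀ y → C y ≡ true → lay y < Lt → E y ≡ true) →
    ∀ T → Above0 T → Stuck C T → card T ≤ s → card T ≤ card E
  stuck-small {s} expand {C} {E} C⊆E T above st T≤s = +-cancelˡ-≤ (card T) (card T) (card E) (begin
    card T + card T
      ≡⟨ cong₂ _+_ card-T (trans card-T (sym (+-identityʳ _))) ⟩
    2 * ∑ (allFin Lt) (λ ℓ → card (row T (Fin.suc ℓ)))
      ≡⟨ sym (∑-*ˡ (allFin Lt) 2 (λ ℓ → card (row T (Fin.suc ℓ)))) ⟩
    ∑ (allFin Lt) (λ ℓ → 2 * card (row T (Fin.suc ℓ)))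
      ≤⟨ ∑-mono (allFin Lt) per-row ⟩
    ∑ (allFin Lt) (λ ℓ → card (row T (inject₁ ℓ)) + card (row E (inject₁ ℓ)))
      ≡⟨ ∑-+ (allFin Lt) (λ ℓ → card (row T (inject₁ ℓ))) (λ ℓ → card (row E (inject₁ ℓ))) ⟩
    ∑ (allFin Lt) (λ ℓ → card (row T (inject₁ ℓ))) + ∑ (allFin Lt) (λ ℓ → card (row E (inject₁ ℓ)))
      ≤⟨ +-mono-≤ (total T) (total E) ⟩
    card T + card E ∎)
    where
    open ≤-Reasoning
    total : ∀ U → ∑ (allFin Lt) (λ ℓ → card (row U (inject₁ ℓ))) ≤ card U
    total U = ≤-trans (∑-inject₁ Lt (λ ℓ → card (row U ℓ))) (≤-reflexive (sym (card-rows U)))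
    card-T : card T ≡ ∑ (allFin Lt) (λ ℓ → card (row T (Fin.suc ℓ)))
    card-T = trans (card-rows T) (trans (∑-suc (λ ℓ → card (row T ℓ)))
      (cong (_+ ∑ (allFin Lt) (λ ℓ → card (row T (Fin.suc ℓ))))
        (trans (∑-cong (allFin w) (λ j → cong ⟦_⟧ (row-zero {T} above j))) (∑-0 (allFin w)))))
    per-row : ∀ ℓ → 2 * card (row T (Fin.suc ℓ)) ≤ card (row T (inject₁ ℓ)) + card (row E (inject₁ ℓ))
    per-row ℓ = ≤-trans
      (+-cancelˡ-≤ (card U * 8) (2 * card U) (card unique) (≤-trans (≤-reflexive (ten (card U)))
        (≤-trans (*-monoʳ-≤ 2 (expand U (≤-trans (card-row≤ T (Fin.suc ℓ)) T≤s)))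
          (stuck-nbhd P₀ {unique} {U} (λ x e → dec-true (mult P₀ U x ≟ℕ 1) e)))))
      (≤-trans (card-mono {S = unique} {U = row T (inject₁ ℓ) ∪ row E (inject₁ ℓ)} unique⊆)
        (card-∪ (row T (inject₁ ℓ)) (row E (inject₁ ℓ))))
      where
      U unique : Sub w
      U = row T (Fin.suc ℓ)
      unique x = does (mult P₀ U x ≟ℕ 1)
      ten : ∀ t → t * 8 + 2 * t ≡ 2 * (5 * t)
      ten = solve-∀
      unique⊆ : unique ⊆ (row T (inject₁ ℓ) ∪ row E (inject₁ ℓ))
      unique⊆ j p with T (combine (inject₁ ℓ) j) in eq
      ... | true = refl
      ... | false = C⊆E (combine (inject₁ ℓ) j)
        (st _ (trans (mult-row {T} above ℓ j) (cong₂ _+_ (cong ⟦_⟧ eq) (does-true (mult P₀ U j ≟ℕ 1) p))))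
        (subst (_< Lt) (sym (trans (cong toℕ (layer-combine (inject₁ ℓ) j)) (toℕ-inject₁ ℓ))) (toℕ<n ℓ))

-- Pigeonhole for layers

∑-at-most-one : ∀ n x b → ∑ (allFin n) (λ i → ⟦ does (x ≟ℕ b + toℕ i) ⟧) ≤ 1
∑-at-most-one zero x b = z≤n
∑-at-most-one (suc n) x b = subst (_≤ 1) (sym (∑-suc (λ i → ⟦ does (x ≟ℕ b + toℕ {suc n} i) ⟧))) (split (x ≟ℕ b + 0))
  where
  rest : ℕ
  rest = ∑ (allFin n) (λ i → ⟦ does (x ≟ℕ b + suc (toℕ i)) ⟧)
  split : Dec (x ≡ b + 0) → ⟦ does (x ≟ℕ b + 0) ⟧ + rest ≤ 1
  split (yes e) = +-mono-≤ (⟦⟧≤1 (does (x ≟ℕ b + 0)))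
    (≤-reflexive (trans (∑-cong (allFin n) (λ i → cong ⟦_⟧ (dec-false (x ≟ℕ b + suc (toℕ i))
      (λ e′ → m≢1+m+n b (trans (sym (+-identityʳ b)) (trans (sym e) (trans e′ (+-suc b (toℕ i)))))))))
      (∑-0 (allFin n))))
  split (no ne) = +-mono-≤ (≤-reflexive (cong ⟦_⟧ (dec-false (x ≟ℕ b + 0) ne)))
    (≤-trans (≤-reflexive (∑-cong (allFin n) (λ i → cong (λ z → ⟦ does (x ≟ℕ z) ⟧) (+-suc b (toℕ i)))))
      (∑-at-most-one n x (suc b)))

∑-small : ∀ n (f : Fin n → ℕ) → ∑ (allFin n) f < n → ∃ λ i → f i ≡ 0
∑-small n f h with ∑-average (allFin n) f (≤-trans (s≤s z≤n) (≤-trans h (≤-reflexive (sym (length-allFin n)))))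
... | i , avg with f i in eq
... | zero = i , eq
... | suc m = ⊥-elim (<⇒≱ h (≤-trans (m≤m*n n (suc m)) (subst (λ z → z * suc m ≤ ∑ (allFin n) f) (length-allFin n) avg)))

empty-layer : ∀ {Y} (lay : Fin Y → ℕ) (U : Sub Y) b γ → card U < γ →
  ∃ λ m → b ≤ m × m < b + γ × (∀ y → U y ≡ true → lay y ≢ m)
empty-layer {Y} lay U b γ U<γ with ∑-small γ (λ i → ∑ (allFin Y) (λ y → ⟦ U y ⟧ * ⟦ does (lay y ≟ℕ b + toℕ i) ⟧)) (begin-strict
    ∑ (allFin γ) (λ i → ∑ (allFin Y) (λ y → ⟦ U y ⟧ * ⟦ does (lay y ≟ℕ b + toℕ i) ⟧))
      ≡⟨ ∑-swap (allFin γ) (allFin Y) _ ⟩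
    ∑ (allFin Y) (λ y → ∑ (allFin γ) (λ i → ⟦ U y ⟧ * ⟦ does (lay y ≟ℕ b + toℕ i) ⟧))
      ≤⟨ ∑-mono (allFin Y) (λ y → ≤-trans (≤-reflexive (∑-*ˡ (allFin γ) ⟦ U y ⟧ (λ i → ⟦ does (lay y ≟ℕ b + toℕ i) ⟧)))
           (≤-trans (*-monoʳ-≤ ⟦ U y ⟧ (∑-at-most-one γ (lay y) b)) (≤-reflexive (*-identityʳ _)))) ⟩
    card U
      <⟨ U<γ ⟩
    γ ∎)
  where open ≤-Reasoning
... | i , e = b + toℕ i , m≤m+n b _ , +-monoʳ-< b (toℕ<n i) , λ y u l → 1+n≢0 (n≤0⇒n≡0
    (≤-trans (≤-reflexive (sym (cong₂ (λ p q → ⟦ p ⟧ * ⟦ q ⟧) u (dec-true (lay y ≟ℕ b + toℕ i) l))))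
      (≤-trans (∑-∈ (λ y → ⟦ U y ⟧ * ⟦ does (lay y ≟ℕ b + toℕ i) ⟧) (∈-allFin y)) (≤-reflexive e))))

-- Winning positions for Duplicator

module Condensation (K h Lt w v : ℕ) (K-pos : 1 ≤ K) (h-pos : 1 ≤ h)
  (P₀ : Fin w → Fin 8 → Fin w) (j₀ : Fin w) (P₀-expands : IsExpander (K + K) 5 P₀)
  (nbx : Fin (suc Lt * w) → Fin (3 * h) → Fin v) (nbx-expands : IsExpander (K + K) (2 * h) nbx) where

  open Layers Lt w P₀ j₀ public
  private
    module 𝕏 = System nbx
    module 𝕐 = System nby

  -- One more than the bound `K + K` on the active sets before and after a move together, so that
  -- among `γ` consecutive layers one is free of both.
  γ : ℕ
  γ = suc (K + K)

  everything : Sub Y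
  everything _ = true

  above : ℕ → Sub Y
  above a y = does (a <? lay y)

  determined : Sub v → Sub Y
  determined S = 𝕏.cl everything K S

  -- `g` records flips of base variables. `top` is always flipped, as the two structures differ
  -- exactly in its value, and therefore counts as known.
  known : Sub v → Sub Y
  known S = determined S ∪ single top

  active : ℕ → Sub v → Sub Y
  active a S = 𝕐.cl (above a) K (known S)

  -- As `2 * (2 * h) - 3 * h = h`, expansion yields on average at least `h` private variables per
  -- constraint of `T`, and all of them lie in `S`.
  stuckX : ∀ {S T} → 𝕏.Stuck S T → card T ≤ K + K → card T ≤ card S
  stuckX {S} {T} st T≤ = ≤-trans (m≤n*m (card T) h {{>-nonZero h-pos}})
    (+-cancelˡ-≤ (card T * (3 * h)) (h * card T) (card S) (≤-trans (≤-reflexive (four h (card T)))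
      (≤-trans (*-monoʳ-≤ 2 (nbx-expands T T≤)) (stuck-nbhd nbx {S} {T} st))))
    where
    four : ∀ h t → t * (3 * h) + h * t ≡ 2 * (2 * h * t)
    four = solve-∀

  smallX : ∀ {S} → card S ≤ K → 𝕏.Small everything K S
  smallX S≤ T _ st T≤ = ≤-trans (stuckX st T≤) S≤

  determined≤ : ∀ {S} → card S ≤ K → card (determined S) ≤ card S
  determined≤ S≤ with 𝕏.cl-ok (smallX S≤)
  ... | _ , st , c≤ = stuckX st (≤-trans c≤ (m≤m+n K K))

  above0 : ∀ {a T} → T ⊆ above a → Above0 T
  above0 {a} h y t = ≤-trans (s≤s z≤n) (does-true (a <? lay y) (h y t))

  known-low : ∀ S y → known S y ≡ true → lay y < Lt → determined S y ≡ true
  known-low S y k l with ∨-elim (determined S y) k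
  ... | inj₁ e = e
  ... | inj₂ e = ⊥-elim (<⇒≢ l (trans (cong lay (==-true {i = y} e)) lay-top))

  stuckY : ∀ {a S T} → T ⊆ above a → 𝕐.Stuck (known S) T → card T ≤ K + K → card T ≤ card (determined S)
  stuckY {a} {S} {T} sub st T≤ = stuck-small P₀-expands (known-low S) T (above0 sub) st T≤

  smallY : ∀ {a S} → card S ≤ K → 𝕐.Small (above a) K (known S)
  smallY S≤ T sub st T≤ = ≤-trans (stuckY sub st T≤) (≤-trans (determined≤ S≤) S≤)

  determined-mono : ∀ {S S′} → card S ≤ K → S ⊆ S′ → determined S ⊆ determined S′
  determined-mono S≤ sub = 𝕏.cl-mono (smallX S≤) (λ _ p → p) sub

  active-mono : ∀ {a S S′} → card S ≤ K → S ⊆ S′ → active a S ⊆ active a S′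
  active-mono {a} {S} {S′} S≤ sub = 𝕐.cl-mono (smallY S≤) (λ _ p → p) known-mono
    where
    known-mono : known S ⊆ known S′
    known-mono y k with ∨-elim (determined S y) k
    ... | inj₁ e = ∨-introˡ _ (determined-mono S≤ sub y e)
    ... | inj₂ e = ∨-introʳ (determined S′ y) e

  -- With r rounds to go Duplicator pretends that all layers up to suc r * γ vanish
  -- and respects the active constraints above layer r * γ.
  record Good (r : ℕ) (S : Sub v) (f : Fin v → Bool) : Set where
    field
      f* : Fin v → Bool
      g : Fin Y → Bool
      agrees : ∀ x → S x ≡ true → f* x ≡ f x
      defines : ∀ y → determined S y ≡ true → 𝕏.val f* y ≡ g y
      top-set : g top ≡ true
      satisfied : ∀ y → active (r * γ) S y ≡ true → 𝕐.val g y ≡ false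
      vanishes : ∀ y → determined S y ≡ true → lay y ≤ suc r * γ → g y ≡ false

  good-restrict : ∀ {r S S′ f} → card S′ ≤ K → S ⊆ S′ → Good r S′ f → Good r S f
  good-restrict {r} {S} {S′} S′≤ sub good = record
    { f* = G.f* ; g = G.g
    ; agrees = λ x p → G.agrees x (sub x p)
    ; defines = λ y p → G.defines y (determined-mono S≤ sub y p)
    ; top-set = G.top-set
    ; satisfied = λ y p → G.satisfied y (active-mono S≤ sub y p)
    ; vanishes = λ y p → G.vanishes y (determined-mono S≤ sub y p)
    }
    where
    module G = Good good
    S≤ : card S ≤ K
    S≤ = ≤-trans (card-mono sub) S′≤

  good-cong : ∀ {r S f f′} → (∀ x → S x ≡ true → f x ≡ f′ x) → Good r S f → Good r S f′
  good-cong e good = record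
    { f* = G.f* ; g = G.g
    ; agrees = λ x p → trans (G.agrees x p) (e x p)
    ; defines = G.defines ; top-set = G.top-set ; satisfied = G.satisfied ; vanishes = G.vanishes }
    where module G = Good good

  ∅ : Sub v
  ∅ _ = false

  -- Without pebbles nothing is determined, so no constraint is active and `top` can be flipped
  -- alone.
  good-start : ∀ r → Good r ∅ ∅
  good-start r = record
    { f* = λ _ → false ; g = single top
    ; agrees = λ x ()
    ; defines = λ y p → ⊥-elim (true≢false p (card-zero (determined ∅) none y))
    ; top-set = ==-refl top
    ; satisfied = λ y p → ⊥-elim (true≢false p (card-zero (active (r * γ) ∅) none′ y))
    ; vanishes = λ y p → ⊥-elim (true≢false p (card-zero (determined ∅) none y)) }
    where
    card-∅ : card ∅ ≡ 0
    card-∅ = ∑-0 (allFin v)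
    ∅≤ : card ∅ ≤ K
    ∅≤ = ≤-trans (≤-reflexive card-∅) z≤n
    none : card (determined ∅) ≡ 0
    none = n≤0⇒n≡0 (≤-trans (determined≤ ∅≤) (≤-reflexive card-∅))
    none′ : card (active (r * γ) ∅) ≡ 0
    none′ with 𝕐.cl-ok (smallY {r * γ} ∅≤)
    ... | sub , st , c≤ = n≤0⇒n≡0 (≤-trans (stuckY sub st (≤-trans c≤ (m≤m+n K K))) (≤-reflexive none))

  module Step {r S S′ f} (S′≤ : card S′ ≤ K) (sub : S ⊆ S′) (good : Good (suc r) S f) where
    module G = Good good

    a : ℕ
    a = suc r * γ

    T₀ T′ : Sub Y
    T₀ = active a S
    T′ = active (r * γ) S′

    S≤ : card S ≤ K
    S≤ = ≤-trans (card-mono sub) S′≤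

    T₀≤ : card T₀ ≤ K
    T₀≤ = proj₂ (proj₂ (𝕐.cl-ok (smallY S≤)))

    T′≤ : card T′ ≤ K
    T′≤ = proj₂ (proj₂ (𝕐.cl-ok (smallY S′≤)))

    gap : ∃ λ m → suc a ≤ m × m < suc a + γ × (∀ y → (T₀ ∪ T′) y ≡ true → lay y ≢ m)
    gap = empty-layer lay (T₀ ∪ T′) (suc a) γ (s≤s (≤-trans (card-∪ T₀ T′) (+-mono-≤ T₀≤ T′≤)))

    -- Layer `m` becomes the gap: everything below it is reset to 0, and newly active constraints
    -- above it are solved by `extend`. Only constraints of layer `m` straddle the seam, and none of
    -- them is active.
    module Cut (m : ℕ) (a<m : a < m) (m≤ : m ≤ suc (suc r) * γ) (m≤Lt : m ≤ Lt)
               (free : ∀ y → (T₀ ∪ T′) y ≡ true → lay y ≢ m) where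

      free′ : ∀ y → T′ y ≡ true → lay y ≢ m
      free′ y t = free y (∨-introʳ (T₀ y) t)
      g₁ : Fin Y → Bool
      g₁ y = does (m ≤? lay y) ∧ G.g y
      g₁-high : ∀ {y} → m ≤ lay y → g₁ y ≡ G.g y
      g₁-high {y} p = cong (_∧ G.g y) (dec-true (m ≤? lay y) p)
      g₁-low : ∀ {y} → lay y < m → g₁ y ≡ false
      g₁-low {y} p = cong (_∧ G.g y) (dec-false (m ≤? lay y) (<⇒≱ p))
      fixed : Sub Y
      fixed u = does (lay u <? m) ∨ (known S u ∨ nbhd nby T₀ u)
      P : Sub Y
      P y = T′ y ∧ (not (T₀ y) ∧ does (m <? lay y))
      P-T′ : ∀ {y} → P y ≡ true → T′ y ≡ true
      P-T′ p = proj₁ (∧-true p)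
      P-T₀ : ∀ {y} → P y ≡ true → T₀ y ≡ false
      P-T₀ {y} p with T₀ y | proj₂ (∧-true {T′ y} p)
      ... | false | _ = refl
      P-lay : ∀ {y} → P y ≡ true → m < lay y
      P-lay {y} p = does-true (m <? lay y) (proj₂ (∧-true {not (T₀ y)} (proj₂ (∧-true {T′ y} p))))
      -- A constraint above layer `m` has its variables in layers at least `m`, so `u` is not among
      -- the variables reset to 0.
      fixed-free : ∀ u → known S u ≡ false → mult nby T₀ u ≡ 0 → 1 ≤ mult nby P u → fixed u ≡ false
      fixed-free u ku mu pu with mult-witness nby P u pu
      ... | c , pc , i , refl = cong₂ _∨_
        (dec-false (lay u <? m) (≤⇒≯ (≤-trans (∸-monoˡ-≤ 1 (P-lay pc)) (lay-nby≥ c i))))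
        (cong₂ _∨_ ku (dec-false (1 ≤? mult nby T₀ u) (λ q → 1+n≰n (≤-trans q (≤-reflexive mu)))))
      extendedY : ∃ λ g′ → (∀ u → fixed u ≡ true → g′ u ≡ g₁ u) × (∀ c → P c ≡ true → 𝕐.val g′ c ≡ false)
      extendedY = 𝕐.extend (smallY {a} S≤) P
        (λ y p → dec-true (a <? lay y) (<-trans a<m (P-lay p)))
        (≤-trans (card-mono {S = P} {U = T′} (λ y → P-T′)) T′≤)
        (λ c → P-T₀) fixed fixed-free g₁ (λ _ → false)

      module CutY (g′ : Fin Y → Bool) (keepY : ∀ u → fixed u ≡ true → g′ u ≡ g₁ u)
                  (satY : ∀ c → P c ≡ true → 𝕐.val g′ c ≡ false) where

        g′-low : ∀ {u} → lay u < m → g′ u ≡ false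
        g′-low {u} p = trans (keepY u (∨-introˡ _ (dec-true (lay u <? m) p))) (g₁-low p)
        g′-known : ∀ {u} → known S u ≡ true → g′ u ≡ g₁ u
        g′-known {u} p = keepY u (∨-introʳ (does (lay u <? m)) (∨-introˡ _ p))
        g′-T₀ : ∀ {y} i → T₀ y ≡ true → g′ (nby y i) ≡ g₁ (nby y i)
        g′-T₀ {y} i t = keepY (nby y i) (∨-introʳ (does (lay (nby y i) <? m))
          (∨-introʳ (known S (nby y i)) (dec-true (1 ≤? mult nby T₀ (nby y i)) (mult-var nby T₀ i t))))
        low-sat : ∀ {y} → lay y < m → 𝕐.val g′ y ≡ false
        low-sat {y} p = ⨁-false (λ i → g′-low (≤-<-trans (lay-nby≤ y i) p))
        sat′ : ∀ y → T′ y ≡ true → 𝕐.val g′ y ≡ false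
        sat′ y t with <-cmp (lay y) m
        ... | tri< l _ _ = low-sat l
        ... | tri≈ _ l _ = ⊥-elim (free′ y t l)
        ... | tri> _ _ l with T₀ y in eq
        ...   | true = trans (⨁-cong (λ i → trans (g′-T₀ i eq) (g₁-high (≤-trans (∸-monoˡ-≤ 1 l) (lay-nby≥ y i)))))
            (G.satisfied y eq)
        ...   | false = satY y (∧-intro t (∧-intro (cong not eq) (dec-true (m <? lay y) l)))
        -- The reset changes no determined value, because `G.g` already vanishes on determined
        -- variables up to a layer that is at least `m`.
        g′-determined : ∀ y → determined S y ≡ true → g′ y ≡ G.g y
        g′-determined y p with m ≤? lay y
        ... | yes l = trans (g′-known (∨-introˡ _ p)) (g₁-high l)
        ... | no l = trans (g′-low (≰⇒> l)) (sym (G.vanishes y p (≤-trans (<⇒≤ (≰⇒> l)) m≤)))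
        E E′ Px : Sub Y
        E = determined S
        E′ = determined S′
        Px y = E′ y ∧ not (E y)
        fixedX : Sub v
        fixedX x = S x ∨ nbhd nbx E x
        Px-E : ∀ y → Px y ≡ true → E y ≡ false
        Px-E y p with E y | proj₂ (∧-true {E′ y} p)
        ... | false | _ = refl
        extendedX : ∃ λ f′ → (∀ x → fixedX x ≡ true → f′ x ≡ G.f* x) × (∀ y → Px y ≡ true → 𝕏.val f′ y ≡ g′ y)
        extendedX = 𝕏.extend (smallX S≤) Px (λ _ _ → refl)
          (≤-trans (card-mono {S = Px} {U = E′} (λ y p → proj₁ (∧-true p))) (≤-trans (determined≤ S′≤) S′≤))
          Px-E fixedX (λ x sx mx _ → cong₂ _∨_ sx (dec-false (1 ≤? mult nbx E x) (λ q → 1+n≰n (≤-trans q (≤-reflexive mx)))))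
          G.f* g′

        module CutX (f′ : Fin v → Bool) (keepX : ∀ x → fixedX x ≡ true → f′ x ≡ G.f* x)
                    (satX : ∀ y → Px y ≡ true → 𝕏.val f′ y ≡ g′ y) where

          defines′ : ∀ y → E′ y ≡ true → 𝕏.val f′ y ≡ g′ y
          defines′ y p with E y in eq
          ... | true = trans (⨁-cong (λ i → keepX (nbx y i)
                (∨-introʳ (S (nbx y i)) (dec-true (1 ≤? mult nbx E (nbx y i)) (mult-var nbx E i eq)))))
              (trans (G.defines y eq) (sym (g′-determined y eq)))
          ... | false = satX y (∧-intro p (cong not eq))
          result : ∃ λ f′ → Good r S′ f′ × (∀ x → S x ≡ true → f′ x ≡ f x)
          result = f′ , record
              { f* = f′ ; g = g′ ; agrees = λ _ _ → refl ; defines = defines′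
              ; top-set = trans (g′-known (∨-introʳ (determined S top) (==-refl top)))
                  (trans (g₁-high (≤-trans m≤Lt (≤-reflexive (sym lay-top)))) G.top-set)
              ; satisfied = sat′
              ; vanishes = λ y _ l → g′-low (≤-<-trans l a<m) }
            , λ x p → trans (keepX x (∨-introˡ _ p)) (G.agrees x p)

      result : ∃ λ f′ → Good r S′ f′ × (∀ x → S x ≡ true → f′ x ≡ f x)
      result with extendedY
      ... | g′ , keepY , satY with CutY.extendedX g′ keepY satY
      ... | f′ , keepX , satX = CutY.CutX.result g′ keepY satY f′ keepX satX

  -- The first hypothesis keeps the gap at or below the top layer, so that `top` retains its value.
  good-step : ∀ {r S S′ f} → suc (suc r) * γ ≤ Lt → card S′ ≤ K → S ⊆ S′ → Good (suc r) S f →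
    ∃ λ f′ → Good r S′ f′ × (∀ x → S x ≡ true → f′ x ≡ f x)
  good-step {r} {S} {S′} {f} room S′≤ sub good = pick (Step.gap S′≤ sub good)
    where
    open Step {r} {S} {S′} {f} S′≤ sub good using (a; T₀; T′; module Cut)
    pick : (∃ λ m → suc a ≤ m × m < suc a + γ × (∀ y → (T₀ ∪ T′) y ≡ true → lay y ≢ m)) →
      ∃ λ f′ → Good r S′ f′ × (∀ x → S x ≡ true → f′ x ≡ f x)
    pick (m , a<m , m<a+γ , free) = Cut.result m a<m m≤ (≤-trans m≤ room) free
      where
      m≤ : m ≤ suc (suc r) * γ
      m≤ = ≤-trans (s≤s⁻¹ m<a+γ) (≤-reflexive (+-comm a γ))

  val-good : ∀ {r S f} → card S ≤ K → (good : Good r S f) → ∀ y → (∀ i → S (nbx y i) ≡ true) →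
    determined S y ≡ true × 𝕏.val f y ≡ Good.g good y
  val-good {r} {S} S≤ good y h = y-det ,
    trans (⨁-cong (λ i → sym (Good.agrees good (nbx y i) (h i)))) (Good.defines good y y-det)
    where
    y-det : determined S y ≡ true
    y-det = 𝕏.cl-max {T = single y} ((λ _ _ → refl) , stuck-single nbx {S} y h ,
      ≤-trans (≤-reflexive (card-single y)) K-pos) y (==-refl y)

  -- Above layer `r * γ` a fully pebbled constraint is stuck by itself, hence active and satisfied.
  -- Lower down, its nine determined summands all vanish.
  good-con : ∀ {r S f} → card S ≤ K → Good r S f → ∀ y → (∀ m i → S (nbx (nby y m) i) ≡ true) →
    ⨁ (λ m → ⨁ (λ i → f (nbx (nby y m) i))) ≡ false
  good-con {r} {S} S≤ good y h = trans (⨁-cong (λ m → proj₂ (val-good S≤ good (nby y m) (h m)))) holds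
    where
    det : ∀ m → determined S (nby y m) ≡ true
    det m = proj₁ (val-good S≤ good (nby y m) (h m))
    holds : 𝕐.val (Good.g good) y ≡ false
    holds with r * γ <? lay y
    ... | yes l = Good.satisfied good y (𝕐.cl-max {T = single y}
        ((λ c e → subst (λ z → above (r * γ) z ≡ true) (sym (==-true {i = c} e)) (dec-true (r * γ <? lay y) l)) ,
         stuck-single nby {known S} y (λ m → ∨-introˡ _ (det m)) ,
         ≤-trans (≤-reflexive (card-single y)) K-pos) y (==-refl y))
    ... | no l = ⨁-false (λ m → Good.vanishes good (nby y m) (det m)
        (≤-trans (lay-nby≤ y m) (≤-trans (≮⇒≥ l) (m≤n+m (r * γ) γ))))

  good-top : ∀ {r S f} → card S ≤ K → Good r S f → (∀ i → S (nbx top i) ≡ true) → ⨁ (λ i → f (nbx top i)) ≡ true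
  good-top S≤ good h = trans (proj₂ (val-good S≤ good top h)) (Good.top-set good)

-- Relations indexed by symbols

_=ᵐ_ : ∀ {v} → Maybe (Fin v) → Maybe (Fin v) → Bool
a =ᵐ b = does (maybe-≡-dec _≟_ a b)

=ᵐ-true : ∀ {v} {a b : Maybe (Fin v)} → a =ᵐ b ≡ true → a ≡ b
=ᵐ-true {a = a} {b} = does-true (maybe-≡-dec _≟_ a b)

=ᵐ-intro : ∀ {v} {a b : Maybe (Fin v)} → a ≡ b → a =ᵐ b ≡ true
=ᵐ-intro {a = a} {b} = dec-true (maybe-≡-dec _≟_ a b)

-- Recursion on the list of symbols makes the arity `lookup (map ar ss) i` compute.
relations : ∀ {n} {Sym : Set} (ar : Sym → ℕ) → (∀ s → Tuple n (ar s) → Bool) → (ss : List Sym) →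
  (i : Fin (length (map ar ss))) → Tuple n (lookup (map ar ss) i) → Bool
relations ar R (s ∷ ss) Fin.zero = R s
relations ar R (s ∷ ss) (Fin.suc i) = relations ar R ss i

module _ {n : ℕ} {Sym : Set} (ar : Sym → ℕ) (R R′ : ∀ s → Tuple n (ar s) → Bool) where

  relations-≡ : (Q : Fin n → Fin n → Set) →
    (∀ s (t t′ : Tuple n (ar s)) → (∀ j → Q (t j) (t′ j)) → R s t ≡ R′ s t′) →
    ∀ ss i (t t′ : Tuple n (lookup (map ar ss) i)) → (∀ j → Q (t j) (t′ j)) →
    relations ar R ss i t ≡ relations ar R′ ss i t′
  relations-≡ Q h (s ∷ ss) Fin.zero = h s
  relations-≡ Q h (s ∷ ss) (Fin.suc i) = relations-≡ Q h ss i

  relations-∈ : ∀ {m} (u t : Tuple n m) ss →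
    (∀ i f → f ∈ allFuns (lookup (map ar ss) i) m →
      relations ar R ss i (λ j → u (f j)) ≡ relations ar R′ ss i (λ j → t (f j))) →
    ∀ {s} → s ∈ ss → ∀ f → f ∈ allFuns (ar s) m → R s (λ j → u (f j)) ≡ R′ s (λ j → t (f j))
  relations-∈ u t (s ∷ ss) h (here refl) = h Fin.zero
  relations-∈ u t (s ∷ ss) h (there s∈) = relations-∈ u t ss (λ i → h (Fin.suc i)) s∈

-- Structures whose elements are the two values of each variable, and some padding

module XorStructures {n v : ℕ}
  (el : Fin v → Bool → Fin n) (view : Fin n → Maybe (Fin v × Bool))
  (view-el : ∀ x b → view (el x b) ≡ just (x , b))
  (el-view : ∀ e {x b} → view e ≡ just (x , b) → el x b ≡ e)
  {Sym : Set} (syms : List Sym) (ar : Sym → ℕ) (vars : ∀ s → Fin (ar s) → Fin v)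
  (holds : Bool → Sym → Bool → Bool) where

  varOf : Maybe (Fin v × Bool) → Maybe (Fin v)
  varOf (just (x , _)) = just x
  varOf nothing = nothing

  bitOf : Maybe (Fin v × Bool) → Bool
  bitOf (just (_ , b)) = b
  bitOf nothing = false

  var : Fin n → Maybe (Fin v)
  var e = varOf (view e)

  bit : Fin n → Bool
  bit e = bitOf (view e)

  flipOf : (Fin v → Bool) → Fin n → Maybe (Fin v × Bool) → Fin n
  flipOf f e (just (x , b)) = el x (f x xor b)
  flipOf f e nothing = e

  flip : (Fin v → Bool) → Fin n → Fin n
  flip f e = flipOf f e (view e)

  -- Membership depends on the values only through their parity, so a flip `f` acts on it through
  -- the sum of `f` over `vars s`.
  R : Bool → ∀ s → Tuple n (ar s) → Bool
  R B? s t = allF (λ j → var (t j) =ᵐ just (vars s j)) ∧ holds B? s (⨁ (λ j → bit (t j)))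

  σ : List ℕ
  σ = map ar syms

  𝔖 : Bool → Structure n σ
  𝔖 B? = record { rel = relations ar (R B?) syms }

  R-cong : ∀ B? s {t t′ : Tuple n (ar s)} → t ≗ t′ → R B? s t ≡ R B? s t′
  R-cong B? s h = cong₂ _∧_ (allF-cong (λ j → cong (λ e → var e =ᵐ just (vars s j)) (h j)))
    (cong (holds B? s) (⨁-cong (λ j → cong bit (h j))))

  view-flip : ∀ f e → view (flip f e) ≡ view e ⊎ (∃ λ x → ∃ λ b → view e ≡ just (x , b) × view (flip f e) ≡ just (x , f x xor b))
  view-flip f e with view e in eq
  ... | just (x , b) = inj₂ (x , b , refl , view-el x (f x xor b))
  ... | nothing = inj₁ eq

  var-flip : ∀ f e → var (flip f e) ≡ var e
  var-flip f e with view-flip f e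
  ... | inj₁ p = cong varOf p
  ... | inj₂ (x , b , p , q) = trans (cong varOf q) (sym (cong varOf p))

  flip-just : ∀ f e {x b} → view e ≡ just (x , b) → flip f e ≡ el x (f x xor b)
  flip-just f e p = cong (flipOf f e) p

  flip-nothing : ∀ f e → view e ≡ nothing → flip f e ≡ e
  flip-nothing f e p = cong (flipOf f e) p

  var-just : ∀ e {x} → var e ≡ just x → view e ≡ just (x , bit e)
  var-just e p with view e
  var-just e refl | just (x , b) = refl

  bit-flip : ∀ f e {x} → var e ≡ just x → bit (flip f e) ≡ f x xor bit e
  bit-flip f e {x} p = cong bitOf (trans (cong view (flip-just f e (var-just e p))) (view-el x _))

  xor-cancel : ∀ a b → a xor (a xor b) ≡ b
  xor-cancel true true = refl
  xor-cancel true false = refl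
  xor-cancel false b = refl

  flip-involutive : ∀ f e → flip f (flip f e) ≡ e
  flip-involutive f e with view e in eq
  ... | just (x , b) = trans (flip-just f (el x (f x xor b)) (view-el x _))
      (trans (cong (el x) (xor-cancel (f x) b)) (el-view e eq))
  ... | nothing = flip-nothing f e eq

  flip-cong : ∀ f f′ e → (∀ x → var e ≡ just x → f x ≡ f′ x) → flip f e ≡ flip f′ e
  flip-cong f f′ e h with view e
  ... | just (x , b) = cong (λ c → el x (c xor b)) (h x refl)
  ... | nothing = refl

  flip-== : ∀ f e e′ → does (e ≟ e′) ≡ does (flip f e ≟ flip f e′)
  flip-== f e e′ = bool-ext
    (λ p → dec-true (flip f e ≟ flip f e′) (cong (flip f) (==-true {i = e} p)))
    (λ p → dec-true (e ≟ e′) (trans (sym (flip-involutive f e))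
      (trans (cong (flip f) (==-true {i = flip f e} p)) (flip-involutive f e′))))

  sameCol-≗ : ∀ {m} r B? (u t : Tuple n m) → u ≗ t → sameCol r (𝔖 B?) (𝔖 B?) u t ≡ true
  sameCol-≗ zero B? u t h = sameAtp-intro (𝔖 B?) (𝔖 B?) u t
    (λ i j → cong₂ (λ a b → does (a ≟ b)) (h i) (h j))
    (λ i f _ → relations-≡ ar (R B?) (R B?) _≡_ (λ s _ _ → R-cong B? s) syms i _ _ (λ j → h (f j)))
  sameCol-≗ (suc r) B? u t h = ∧-intro (sameCol-≗ r B? u t h)
    (msetEq-bijection r (𝔖 B?) (𝔖 B?) u t (λ x → x) (λ _ → refl)
      (λ x i → sameCol-≗ r B? (upd u i x) (upd t i x) (λ j → cong (λ z → if does (j ≟ i) then x else z) (h j))))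

  -- `Good r S f` abstracts a position that Duplicator can hold for `r` rounds with `S` pebbled and
  -- the two sides differing by the flip `f`. Sizes go up to `suc d` because the reply is fixed
  -- before it is known which pebble moves.
  module Game (d : ℕ) (Good : ℕ → Sub v → (Fin v → Bool) → Set) (R₀ : ℕ)
    (restrict : ∀ {r S S′ f} → card S′ ≤ suc d → S ⊆ S′ → Good r S′ f → Good r S f)
    (congruent : ∀ {r S f f′} → (∀ x → S x ≡ true → f x ≡ f′ x) → Good r S f → Good r S f′)
    (start : ∀ r → ∃ λ f → Good r (λ _ → false) f)
    (step : ∀ {r S S′ f} → r ≤ R₀ → card S′ ≤ suc d → S ⊆ S′ → Good (suc r) S f →
      ∃ λ f′ → Good r S′ f′ × (∀ x → S x ≡ true → f′ x ≡ f x))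
    (local : ∀ {r S f} → card S ≤ suc d → Good r S f → ∀ s → (∀ j → S (vars s j) ≡ true) →
      ∀ b → holds false s b ≡ holds true s (⨁ (λ j → f (vars s j)) xor b)) where

    𝔄 𝔅 : Structure n σ
    𝔄 = 𝔖 false
    𝔅 = 𝔖 true

    -- Duplicator's first move must depend on a tuple only up to _≡_ of this code to be an involution
    -- (the sets vset are functions and there is no function extensionality).
    code : Tuple n d → Vec (Maybe (Fin v)) d
    code u = tabulateᵛ (λ i → var (u i))

    vset : Vec (Maybe (Fin v)) d → Sub v
    vset c x = does (1 ≤? ∑ (allFin d) (λ i → ⟦ lookupᵛ c i =ᵐ just x ⟧))

    vset-elim : ∀ u x → vset (code u) x ≡ true → ∃ λ i → var (u i) ≡ just x
    vset-elim u x p with ∑-pos (allFin d) (λ i → ⟦ lookupᵛ (code u) i =ᵐ just x ⟧) (does-true (1 ≤? _) p)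
    ... | i , _ , q = i , trans (sym (lookup∘tabulate (λ i → var (u i)) i)) (=ᵐ-true (⟦⟧-pos q))

    vset-intro : ∀ u {x} i → var (u i) ≡ just x → vset (code u) x ≡ true
    vset-intro u {x} i p = dec-true (1 ≤? _) (card-pos (λ i → lookupᵛ (code u) i =ᵐ just x) {i}
      (=ᵐ-intro (trans (lookup∘tabulate (λ i → var (u i)) i) p)))

    ∑-var : ∀ (a : Maybe (Fin v)) → ∑ (allFin v) (λ x → ⟦ a =ᵐ just x ⟧) ≤ 1
    ∑-var nothing = ≤-trans (≤-reflexive (∑-0 (allFin v))) z≤n
    ∑-var (just y) = ≤-trans (∑-mono (allFin v) (λ x → ⟦⟧-mono {just y =ᵐ just x}
      (λ p → dec-true (x ≟ y) (sym (just-injective (=ᵐ-true p)))))) (≤-reflexive (∑-δ1 y))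

    card-vset : ∀ c → card (vset c) ≤ d
    card-vset c = ≤-trans (∑-mono (allFin v) (λ x → ⟦1≤?⟧ (∑ (allFin d) (λ i → ⟦ lookupᵛ c i =ᵐ just x ⟧))))
      (≤-trans (≤-reflexive (∑-swap (allFin v) (allFin d) _))
        (≤-trans (∑-mono (allFin d) (λ i → ∑-var (lookupᵛ c i)))
          (≤-reflexive (trans (∑-const (allFin d) 1) (trans (*-identityʳ _) (length-allFin d))))))

    vset≤ : ∀ c → card (vset c) ≤ suc d
    vset≤ c = ≤-trans (card-vset c) (n≤1+n d)

    atomic : ∀ {r} (u t : Tuple n d) f → (∀ i → t i ≡ flip f (u i)) → Good r (vset (code u)) f → sameAtp 𝔄 𝔅 u t ≡ true
    atomic u t f h good = sameAtp-intro 𝔄 𝔅 u t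
      (λ i j → trans (flip-== f (u i) (u j)) (cong₂ (λ a b → does (a ≟ b)) (sym (h i)) (sym (h j))))
      (λ i p _ → relations-≡ ar (R false) (R true) (λ e e′ → ∃ λ p → e ≡ u p × e′ ≡ t p) preserved syms i _ _
        (λ j → p j , refl , refl))
      where
      preserved : ∀ s (q q′ : Tuple n (ar s)) → (∀ j → ∃ λ p → q j ≡ u p × q′ j ≡ t p) → R false s q ≡ R true s q′
      preserved s q q′ hq with allF (λ j → var (q j) =ᵐ just (vars s j)) in eq
      ... | false = sym (cong (_∧ holds true s (⨁ (λ j → bit (q′ j))))
        (trans (allF-cong (λ j → cong (_=ᵐ just (vars s j)) (same-var j))) eq))
        where
        same-var : ∀ j → var (q′ j) ≡ var (q j)
        same-var j with hq j
        ... | p , e , e′ = trans (cong var (trans e′ (h p))) (trans (var-flip f (u p)) (cong var (sym e)))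
      ... | true = sym (trans
        (cong₂ _∧_ (allF-intro (λ j → =ᵐ-intro (trans (same-var j) (matches j))))
          (cong (holds true s) (trans (⨁-cong same-bit) (⨁-xor (λ j → f (vars s j)) (λ j → bit (q j))))))
        (sym (local (vset≤ (code u)) good s in-vset (⨁ (λ j → bit (q j))))))
        where
        matches : ∀ j → var (q j) ≡ just (vars s j)
        matches j = =ᵐ-true (allF-elim eq j)
        flipped : ∀ j → q′ j ≡ flip f (q j)
        flipped j with hq j
        ... | p , e , e′ = trans e′ (trans (h p) (cong (flip f) (sym e)))
        same-var : ∀ j → var (q′ j) ≡ var (q j)
        same-var j = trans (cong var (flipped j)) (var-flip f (q j))
        same-bit : ∀ j → bit (q′ j) ≡ f (vars s j) xor bit (q j)
        same-bit j = trans (cong bit (flipped j)) (bit-flip f (q j) (matches j))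
        in-vset : ∀ j → vset (code u) (vars s j) ≡ true
        in-vset j with hq j
        ... | p , e , e′ = vset-intro u p (trans (cong var (sym e)) (matches j))

    upd-self : ∀ (u : Tuple n d) i e j → upd u i e j ≡ e ⊎ (upd u i e j ≡ u j)
    upd-self u i e j with does (j ≟ i)
    ... | true = inj₁ refl
    ... | false = inj₂ refl

    upd-flip : ∀ (u t : Tuple n d) i e e′ f → e′ ≡ flip f e → (∀ j → t j ≡ flip f (u j)) →
      ∀ j → upd t i e′ j ≡ flip f (upd u i e j)
    upd-flip u t i e e′ f p h j with does (j ≟ i)
    ... | true = p
    ... | false = h j

    -- Each variable `x` is flipped by `φ x`, read off at `x` from an extension made for `x` alone.
    -- Both elements of `x` get the same answer, so the moves combine to an involution although the
    -- extensions for different `x` are unrelated.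
    good-sound : ∀ r → r ≤ suc R₀ → (u t : Tuple n d) (f : Fin v → Bool) → (∀ i → t i ≡ flip f (u i)) →
      Good r (vset (code u)) f → sameCol r 𝔄 𝔅 u t ≡ true
    good-sound zero _ u t f h good = atomic u t f h good
    good-sound (suc r) (s≤s r≤) u t f h good = ∧-intro (good-sound r r≤′ u t f h good⁻)
      (msetEq-bijection r 𝔄 𝔅 u t (flip φ) (flip-involutive φ) reply)
      where
      S : Sub v
      S = vset (code u)
      r≤′ : r ≤ suc R₀
      r≤′ = ≤-trans r≤ (n≤1+n R₀)
      good⁻ : Good r S f
      good⁻ with step {S′ = S} r≤ (vset≤ (code u)) (λ _ p → p) good
      ... | f′ , good′ , keep = congruent keep good′
      S+ : Fin v → Sub v
      S+ x = S ∪ single x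
      S+≤ : ∀ x → card (S+ x) ≤ suc d
      S+≤ x = ≤-trans (card-∪ S (single x)) (≤-trans (+-mono-≤ (card-vset (code u)) (≤-reflexive (card-single x)))
        (≤-reflexive (+-comm d 1)))
      F : ∀ x → ∃ λ f′ → Good r (S+ x) f′ × (∀ z → S z ≡ true → f′ z ≡ f z)
      F x = step r≤ (S+≤ x) (λ z → ∨-introˡ _) good
      φ : Fin v → Bool
      φ x = proj₁ (F x) x
      reply : ∀ e i → sameCol r 𝔄 𝔅 (upd u i e) (upd t i (flip φ e)) ≡ true
      reply e i with view e in eq
      ... | just (x , b) = good-sound r r≤′ (upd u i e) (upd t i (el x (φ x xor b))) (proj₁ (F x))
          (upd-flip u t i e (el x (φ x xor b)) (proj₁ (F x)) (sym (flip-just (proj₁ (F x)) e eq))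
            (λ j → trans (h j) (flip-cong f (proj₁ (F x)) (u j)
              (λ z p → sym (proj₂ (proj₂ (F x)) z (vset-intro u j p))))))
          (restrict (S+≤ x) inside (proj₁ (proj₂ (F x))))
        where
        inside : vset (code (upd u i e)) ⊆ S+ x
        inside z p with vset-elim (upd u i e) z p
        ... | j , q with upd-self u i e j
        ... | inj₁ s = ∨-introʳ (S z) (dec-true (z ≟ x)
            (just-injective (trans (sym q) (trans (cong var s) (cong varOf eq)))))
        ... | inj₂ s = ∨-introˡ _ (vset-intro u j (trans (cong var (sym s)) q))
      -- Padding carries no variable: `f` stays and only the round counter drops.
      ... | nothing = good-sound r r≤′ (upd u i e) (upd t i e) f
          (upd-flip u t i e e f (sym (flip-nothing f e eq)) h)
          (restrict (vset≤ (code u)) inside good⁻)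
        where
        inside : vset (code (upd u i e)) ⊆ S
        inside z p with vset-elim (upd u i e) z p
        ... | j , q with upd-self u i e j
        ... | inj₁ s = ⊥-elim (absurd (trans (sym (cong varOf eq)) (trans (cong var (sym s)) q)))
          where
          absurd : ∀ {z : Fin v} → nothing ≡ just z → ⊥
          absurd ()
        ... | inj₂ s = vset-intro u j (trans (cong var (sym s)) q)

    module _ {r : ℕ} (r≤ : r ≤ R₀) where

      -- All pebbles are placed in one step from the empty position, at the price of one extra round
      -- in `start`.
      initial : ∀ c → ∃ λ f′ → Good r (vset c) f′ × (∀ x → false ≡ true → f′ x ≡ _)
      initial c = step r≤ (vset≤ c) (λ _ ()) (proj₂ (start (suc r)))

      ψ : Tuple n d → Tuple n d
      ψ u i = flip (proj₁ (initial (code u))) (u i)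

      ψ-same : ∀ u → sameCol r 𝔄 𝔅 u (ψ u) ≡ true
      ψ-same u = good-sound r (≤-trans r≤ (n≤1+n R₀)) u (ψ u) (proj₁ (initial (code u))) (λ _ → refl)
        (proj₁ (proj₂ (initial (code u))))

      -- `ψ` preserves `code`, so the same flip is chosen for `u` and `t`, and it undoes itself.
      ψ-sym : ∀ u t → u ≗ ψ t → t ≗ ψ u
      ψ-sym u t h i = sym (trans (cong (λ c → flip (proj₁ (initial c)) (u i)) code≡)
        (trans (cong (flip f) (h i)) (flip-involutive f (t i))))
        where
        f : Fin v → Bool
        f = proj₁ (initial (code t))
        code≡ : code u ≡ code t
        code≡ = tabulateᵛ-cong (λ i → trans (cong var (h i)) (var-flip f (t i)))

      colCount≡ : ∀ B? (t : Tuple n d) → colCount d r 𝔄 (𝔖 B?) t ≡ colCount d r 𝔅 (𝔖 B?) t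
      colCount≡ B? t = begin
        count (λ u → sameCol r 𝔄 ℭ u t) (allFuns d n)      ≡⟨ count-cong (allFuns d n) (λ u → sameCol-swapˡ r 𝔄 𝔅 ℭ u (ψ u) t (ψ-same u)) ⟩
        count (λ u → sameCol r 𝔅 ℭ (ψ u) t) (allFuns d n)  ≡⟨ count-∑ _ (allFuns d n) ⟩
        ∑ (allFuns d n) (λ u → ⟦ sameCol r 𝔅 ℭ (ψ u) t ⟧)
          ≡⟨ ∑-involution (allFuns d n) eqT ∑-eqT (λ u → ⟦ sameCol r 𝔅 ℭ u t ⟧)
               (λ {u} {u′} e → cong ⟦_⟧ (sameCol-swapˡ r 𝔅 𝔅 ℭ u u′ t (sameCol-≗ r true u u′ (eqT-true e)))) ψ
               (λ u u′ → bool-ext (λ e → eqT-intro (ψ-sym u u′ (eqT-true e))) (λ e → eqT-intro (ψ-sym u′ u (eqT-true e)))) ⟩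
        ∑ (allFuns d n) (λ u → ⟦ sameCol r 𝔅 ℭ u t ⟧)      ≡⟨ sym (count-∑ _ (allFuns d n)) ⟩
        count (λ u → sameCol r 𝔅 ℭ u t) (allFuns d n)      ∎
        where
        open ≡-Reasoning
        ℭ : Structure n σ
        ℭ = 𝔖 B?

      indistinguishable : ¬ DistAfter d r 𝔄 𝔅
      indistinguishable (inj₁ (t , ne)) = ne (colCount≡ false t)
      indistinguishable (inj₂ (t , ne)) = ne (colCount≡ true t)

-- Parities over products, and a transposition

⨁-split : ∀ m {n} (f : Fin (m + n) → Bool) → ⨁ f ≡ ⨁ (λ i → f (i ↑ˡ n)) xor ⨁ (λ i → f (m ↑ʳ i))
⨁-split zero f = refl
⨁-split (suc m) f = trans (cong (f Fin.zero xor_) (⨁-split m (λ i → f (Fin.suc i))))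
  (sym (xor-assoc (f Fin.zero) _ _))

⨁-combine : ∀ a b (f : Fin (a * b) → Bool) → ⨁ f ≡ ⨁ {a} (λ m → ⨁ {b} (λ i → f (combine m i)))
⨁-combine zero b f = refl
⨁-combine (suc a) b f = trans (⨁-split b f) (cong (⨁ (λ i → f (i ↑ˡ (a * b))) xor_) (⨁-combine a b (λ i → f (b ↑ʳ i))))

⨁-remQuot : ∀ a b (F : Fin a → Fin b → Bool) →
  ⨁ {a * b} (λ p → F (proj₁ (remQuot b p)) (proj₂ (remQuot {a} b p))) ≡ ⨁ (λ m → ⨁ (λ i → F m i))
⨁-remQuot a b F = trans (⨁-combine a b _)
  (⨁-cong (λ m → ⨁-cong (λ i → cong (λ q → F (proj₁ q) (proj₂ q)) (remQuot-combine {a} m i))))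

xor-cancelʳ : ∀ {a b} c → a xor c ≡ b xor c → a ≡ b
xor-cancelʳ {true} {true} c e = refl
xor-cancelʳ {false} {false} c e = refl
xor-cancelʳ {true} {false} true ()
xor-cancelʳ {true} {false} false ()
xor-cancelʳ {false} {true} true ()
xor-cancelʳ {false} {true} false ()

not-injective : ∀ {a b} → not a ≡ not b → a ≡ b
not-injective {true} {true} _ = refl
not-injective {false} {false} _ = refl

-- Transposes 0 and `c`: the variable of a constraint is entry 0 of `nby`, but its pebbles may sit
-- in block `c`.
swap : ∀ {n} → Fin (suc n) → Fin (suc n) → Fin (suc n)
swap c m with m ≟ Fin.zero | m ≟ c
... | yes _ | _ = c
... | no _ | yes _ = Fin.zero
... | no _ | no _ = m

swap-self : ∀ {n} (c : Fin (suc n)) → swap c c ≡ Fin.zero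
swap-self c with c ≟ Fin.zero | c ≟ c
... | yes e | _ = e
... | no _ | yes _ = refl
... | no _ | no ne = ⊥-elim (ne refl)

swap-involutive : ∀ {n} (c m : Fin (suc n)) → swap c (swap c m) ≡ m
swap-involutive c m with m ≟ Fin.zero | m ≟ c
... | yes refl | _ = swap-self c
... | no _ | yes refl = refl
... | no z | no ne with m ≟ Fin.zero | m ≟ c
... | yes e | _ = ⊥-elim (z e)
... | no _ | yes e = ⊥-elim (ne e)
... | no _ | no _ = refl

-- The two structures and Spoiler's win with `k` pebbles

data Sym (v Y : ℕ) : Set where
  col : Fin v → Sym v Y
  con : Fin Y → Sym v Y
  tp : Sym v Y

module Construction {n v : ℕ}
  (el : Fin v → Bool → Fin n) (view : Fin n → Maybe (Fin v × Bool))
  (view-el : ∀ x b → view (el x b) ≡ just (x , b))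
  (el-view : ∀ e {x b} → view e ≡ just (x , b) → el x b ≡ e)
  (Lt w : ℕ) (P₀ : Fin w → Fin 8 → Fin w) (j₀ : Fin w)
  (Δ : ℕ) (nbx : Fin (suc Lt * w) → Fin Δ → Fin v) where

  open Layers Lt w P₀ j₀

  syms : List (Sym v Y)
  syms = map col (allFin v) ++ (map con (allFin Y) ++ tp ∷ [])

  col∈ : ∀ x → col x ∈ syms
  col∈ x = ∈-++⁺ˡ (∈-map⁺ col (∈-allFin x))

  con∈ : ∀ y → con y ∈ syms
  con∈ y = ∈-++⁺ʳ (map col (allFin v)) (∈-++⁺ˡ (∈-map⁺ con (∈-allFin y)))

  tp∈ : tp ∈ syms
  tp∈ = ∈-++⁺ʳ (map col (allFin v)) (∈-++⁺ʳ (map con (allFin Y)) (here refl))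

  ar : Sym v Y → ℕ
  ar (col x) = 1
  ar (con y) = 9 * Δ
  ar tp = Δ

  member : Fin (9 * Δ) → Fin 9
  member p = proj₁ (remQuot {9} Δ p)

  index : Fin (9 * Δ) → Fin Δ
  index p = proj₂ (remQuot {9} Δ p)

  vars : ∀ s → Fin (ar s) → Fin v
  vars (col x) _ = x
  vars (con y) p = nbx (nby y (member p)) (index p)
  vars tp i = nbx top i

  -- Only `tp` tells the structures apart; `col` ignores the value and reveals to which variable an
  -- element belongs.
  holds : Bool → Sym v Y → Bool → Bool
  holds _ (col x) b = true
  holds _ (con y) b = not b
  holds false tp b = not b
  holds true tp b = b

  open XorStructures el view view-el el-view syms ar vars holds public

  arities : ∀ {k} → 1 ≤ k → 9 * Δ ≤ k → All (_≤ k) σ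
  arities {k} 1≤k 9Δ≤k = map⁺ (universal bound syms)
    where
    bound : ∀ s → ar s ≤ k
    bound (col x) = 1≤k
    bound (con y) = 9Δ≤k
    bound tp = ≤-trans (m≤m+n Δ (8 * Δ)) 9Δ≤k

  𝔄 𝔅 : Structure n σ
  𝔄 = 𝔖 false
  𝔅 = 𝔖 true

  module Upper {k : ℕ} (9Δ≤k : 9 * Δ ≤ k) (x₀ : Fin v) where

    -- The pebbles form nine blocks, one per summand of a constraint; the remaining positions stay
    -- idle.
    pos : Fin 9 → Fin Δ → Fin k
    pos m i = inject≤ (combine m i) 9Δ≤k

    decode : Fin k → Maybe (Fin 9 × Fin Δ)
    decode p with toℕ p <? 9 * Δ
    ... | yes l = just (remQuot Δ (fromℕ< l))
    ... | no _ = nothing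

    decode-pos : ∀ m i → decode (pos m i) ≡ just (m , i)
    decode-pos m i with toℕ (pos m i) <? 9 * Δ
    ... | yes l = cong just (trans (cong (remQuot Δ)
        (trans (fromℕ<-cong _ _ (toℕ-inject≤ (combine m i) 9Δ≤k) l (toℕ<n (combine m i)))
          (fromℕ<-toℕ (combine m i) (toℕ<n (combine m i))))) (remQuot-combine m i))
    ... | no l = ⊥-elim (l (subst (_< 9 * Δ) (sym (toℕ-inject≤ (combine m i) 9Δ≤k)) (toℕ<n (combine m i))))

    sameCol⇒Atp : ∀ r (u t : Tuple n k) → sameCol r 𝔄 𝔅 u t ≡ true → sameAtp 𝔄 𝔅 u t ≡ true
    sameCol⇒Atp zero u t h = h
    sameCol⇒Atp (suc r) u t h = sameCol⇒Atp r u t (proj₁ (∧-true h))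

    same-R : ∀ (u t : Tuple n k) → sameAtp 𝔄 𝔅 u t ≡ true → ∀ {s} → s ∈ syms → (f : Fin (ar s) → Fin k) →
      R false s (λ j → u (f j)) ≡ R true s (λ j → t (f j))
    same-R u t h {s} s∈ f with allFuns-complete f
    ... | f′ , f′∈ , e = trans (R-cong false s (λ j → cong u (sym (e j))))
      (trans (relations-∈ ar (R false) (R true) u t syms (sameAtp-rel 𝔄 𝔅 u t h) s∈ f′ f′∈)
        (R-cong true s (λ j → cong t (e j))))

    same-var : ∀ (u t : Tuple n k) → sameAtp 𝔄 𝔅 u t ≡ true → ∀ p {x} → var (u p) ≡ just x → var (t p) ≡ just x
    same-var u t h p {x} e = =ᵐ-true (proj₁ (∧-true (proj₁ (∧-true
      (trans (sym (same-R u t h (col∈ x) (λ _ → p))) (∧-intro (∧-intro (=ᵐ-intro e) refl) refl))))))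

    same-holds : ∀ (u t : Tuple n k) → sameAtp 𝔄 𝔅 u t ≡ true → ∀ {s} → s ∈ syms → (f : Fin (ar s) → Fin k) →
      (∀ j → var (u (f j)) ≡ just (vars s j)) →
      holds false s (⨁ (λ j → bit (u (f j)))) ≡ holds true s (⨁ (λ j → bit (t (f j))))
    same-holds u t h {s} s∈ f e = trans
      (sym (cong (_∧ holds false s (⨁ (λ j → bit (u (f j))))) (allF-intro (λ j → =ᵐ-intro (e j)))))
      (trans (same-R u t h s∈ f)
        (cong (_∧ holds true s (⨁ (λ j → bit (t (f j))))) (allF-intro (λ j → =ᵐ-intro (same-var u t h (f j) (e j))))))

    con-parity : ∀ (u t : Tuple n k) → sameAtp 𝔄 𝔅 u t ≡ true → ∀ y (q : Fin 9 → Fin Δ → Fin k) →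
      (∀ m i → var (u (q m i)) ≡ just (nbx (nby y m) i)) →
      ⨁ (λ m → ⨁ (λ i → bit (u (q m i)))) ≡ ⨁ (λ m → ⨁ (λ i → bit (t (q m i))))
    con-parity u t h y q e = trans (sym (⨁-remQuot 9 Δ (λ m i → bit (u (q m i)))))
      (trans (not-injective (same-holds u t h (con∈ y) (λ p → q (member p) (index p)) (λ p → e (member p) (index p))))
        (⨁-remQuot 9 Δ (λ m i → bit (t (q m i)))))

    -- Spoiler resets all positions outside keep to u*.
    rounds : (keep : Fin k → Bool) (u* : Tuple n k) (ps : List (Fin k)) → ∀ r u t →
      sameCol (length ps + r) 𝔄 𝔅 u t ≡ true → ∃ λ u′ → ∃ λ t′ → sameCol r 𝔄 𝔅 u′ t′ ≡ true ×
      (∀ p → keep p ≡ true → u′ p ≡ u p × t′ p ≡ t p) ×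
      (∀ p → p ∈ ps ⊎ u p ≡ u* p → keep p ≡ false → u′ p ≡ u* p)
    rounds keep u* [] r u t h = u , t , h , (λ _ _ → refl , refl) , λ { p (inj₂ e) _ → e }
    rounds keep u* (p ∷ ps) r u t h with keep p in eq
    ... | true with rounds keep u* ps r u t (proj₁ (∧-true h))
    ...   | u′ , t′ , h′ , kept , set = u′ , t′ , h′ , kept ,
          λ { q (inj₁ (here refl)) ne → ⊥-elim (true≢false eq ne)
            ; q (inj₁ (there q∈)) → set q (inj₁ q∈)
            ; q (inj₂ e) → set q (inj₂ e) }
    rounds keep u* (p ∷ ps) r u t h | false
      with msetEq-reply (length ps + r) 𝔄 𝔅 u t (proj₂ (∧-true {sameCol (length ps + r) 𝔄 𝔅 u t} h)) (u* p)
    ... | y , ny with rounds keep u* ps r (upd u p (u* p)) (upd t p y) (allᵇ-fin ny p)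
    ... | u′ , t′ , h′ , kept , set = u′ , t′ , h′ , kept′ , set′
      where
      kept′ : ∀ q → keep q ≡ true → u′ q ≡ u q × t′ q ≡ t q
      kept′ q kq = trans (proj₁ (kept q kq)) (cong (λ b → if b then u* p else u q) ne) ,
                   trans (proj₂ (kept q kq)) (cong (λ b → if b then y else t q) ne)
        where
        ne : does (q ≟ p) ≡ false
        ne = dec-false (q ≟ p) (λ { refl → true≢false kq eq })
      set-upd : ∀ q → (q ≡ p ⊎ u q ≡ u* q) → upd u p (u* p) q ≡ u* q
      set-upd q c with q ≟ p
      set-upd q c | yes refl = refl
      set-upd q (inj₁ e) | no ne = ⊥-elim (ne e)
      set-upd q (inj₂ e) | no ne = e
      set′ : ∀ q → q ∈ (p ∷ ps) ⊎ u q ≡ u* q → keep q ≡ false → u′ q ≡ u* q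
      set′ q (inj₁ (here e)) = set q (inj₂ (set-upd q (inj₁ e)))
      set′ q (inj₁ (there q∈)) = set q (inj₁ q∈)
      set′ q (inj₂ e) = set q (inj₂ (set-upd q (inj₂ e)))

    Block : Tuple n k → Fin 9 → Fin Y → Set
    Block u c y = ∀ i → var (u (pos c i)) ≡ just (nbx y i)

    parity : Tuple n k → Fin 9 → Bool
    parity u c = ⨁ (λ i → bit (u (pos c i)))

    var-el : ∀ x b → var (el x b) ≡ just x
    var-el x b = cong varOf (view-el x b)

    nine : ∀ b → ⨁ {9} (λ _ → b) ≡ b
    nine true = refl
    nine false = refl

    -- Induction on the layer, at `k` rounds each. Spoiler keeps block `c` on `y` and moves the
    -- other eight blocks to the variables below. Their parities agree by induction, and since the
    -- constraint is evaluated alike on both sides, so does the parity of `y`. In layer 0 all nine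
    -- blocks of the constraint are `y` itself, and nine is odd.
    same-parity : ∀ ℓ y → lay y ≡ ℓ → ∀ c u t → Block u c y → sameCol (ℓ * k) 𝔄 𝔅 u t ≡ true → parity u c ≡ parity t c
    same-parity zero y ly c u t block h = trans (sym (nine (parity u c))) (trans
      (con-parity u t h y (λ _ → pos c) (λ m i → trans (block i) (cong (λ z → just (nbx z i)) (sym (nby-zero y ly m)))))
      (nine (parity t c)))
    same-parity (suc ℓ) y ly c u t block h = answer (rounds keep u* (allFin k) (ℓ * k) u t
        (subst (λ z → sameCol (z + ℓ * k) 𝔄 𝔅 u t ≡ true) (sym (length-allFin k)) h))
      where
      keepAt : Maybe (Fin 9 × Fin Δ) → Bool
      keepAt (just (b , _)) = b == c
      keepAt nothing = true
      keep : Fin k → Bool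
      keep p = keepAt (decode p)
      targetAt : Fin n → Maybe (Fin 9 × Fin Δ) → Fin n
      targetAt e (just (b , i)) = el (nbx (nby y (swap c b)) i) false
      targetAt e nothing = e
      u* : Tuple n k
      u* p = targetAt (u p) (decode p)
      lay-pred : ∀ m → lay (nby y (Fin.suc m)) ≡ ℓ
      lay-pred m = trans (lay-below (layer y) (column y) m) (cong (_∸ 1) ly)
      answer : (∃ λ u′ → ∃ λ t′ → sameCol (ℓ * k) 𝔄 𝔅 u′ t′ ≡ true ×
        (∀ p → keep p ≡ true → u′ p ≡ u p × t′ p ≡ t p) ×
        (∀ p → p ∈ allFin k ⊎ u p ≡ u* p → keep p ≡ false → u′ p ≡ u* p)) → parity u c ≡ parity t c
      answer (u′ , t′ , h′ , kept , set) =
        trans (⨁-cong (λ i → cong bit (sym (proj₁ (kept-c i)))))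
          (trans same₀ (⨁-cong (λ i → cong bit (proj₂ (kept-c i)))))
        where
        kept-c : ∀ i → u′ (pos c i) ≡ u (pos c i) × t′ (pos c i) ≡ t (pos c i)
        kept-c i = kept (pos c i) (trans (cong keepAt (decode-pos c i)) (==-refl c))
        blocks : ∀ b → Block u′ b (nby y (swap c b))
        blocks b i = split (b ≟ c)
          where
          split : Dec (b ≡ c) → var (u′ (pos b i)) ≡ just (nbx (nby y (swap c b)) i)
          split (yes refl) = trans (cong var (proj₁ (kept-c i))) (trans (block i)
            (cong (λ m → just (nbx (nby y m) i)) (sym (swap-self c))))
          split (no ne) = trans (cong var (trans
            (set (pos b i) (inj₁ (∈-allFin (pos b i))) (trans (cong keepAt (decode-pos b i)) (dec-false (b ≟ c) ne)))
            (cong (targetAt (u (pos b i))) (decode-pos b i)))) (var-el _ false)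
        block-swap : ∀ m → Block u′ (swap c m) (nby y m)
        block-swap m i = trans (blocks (swap c m) i) (cong (λ z → just (nbx (nby y z) i)) (swap-involutive c m))
        rest-same : ⨁ (λ m → parity u′ (swap c (Fin.suc m))) ≡ ⨁ (λ m → parity t′ (swap c (Fin.suc m)))
        rest-same = ⨁-cong (λ m → same-parity ℓ (nby y (Fin.suc m)) (lay-pred m) (swap c (Fin.suc m)) u′ t′
          (block-swap (Fin.suc m)) h′)
        same₀ : parity u′ c ≡ parity t′ c
        same₀ = xor-cancelʳ (⨁ (λ m → parity t′ (swap c (Fin.suc m)))) (trans
          (cong (parity u′ c xor_) (sym rest-same))
          (con-parity u′ t′ (sameCol⇒Atp (ℓ * k) u′ t′ h′) y (λ m → pos (swap c m)) block-swap))

    startAt : Maybe (Fin 9 × Fin Δ) → Fin n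
    startAt (just (_ , i)) = el (nbx top i) false
    startAt nothing = el x₀ false

    u₀ : Tuple n k
    u₀ p = startAt (decode p)

    u₀-block : Block u₀ Fin.zero top
    u₀-block i = trans (cong (λ z → var (startAt z)) (decode-pos Fin.zero i)) (var-el _ false)

    -- `tp` demands opposite parities of the top variable in the two structures, while `same-parity`
    -- makes them equal.
    u₀-unique : ∀ t → sameCol (Lt * k) 𝔄 𝔅 u₀ t ≡ true → ⊥
    u₀-unique t h = contra (parity t Fin.zero) (trans
      (sym (cong not (same-parity Lt top lay-top Fin.zero u₀ t u₀-block h)))
      (same-holds u₀ t (sameCol⇒Atp (Lt * k) u₀ t h) tp∈ (pos Fin.zero) u₀-block))
      where
      contra : ∀ b → not b ≡ b → ⊥
      contra true ()
      contra false ()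

    distinguishes : Distinguishes k 𝔄 𝔅
    distinguishes = Lt * k , inj₁ (u₀ , λ e → 1+n≰n (≤-trans occurs (≤-reflexive (trans e never))))
      where
      occurs : 1 ≤ colCount k (Lt * k) 𝔄 𝔄 u₀
      occurs with allFuns-complete u₀
      ... | f , f∈ , f≗ = ≤-trans (≤-trans (≤-reflexive (sym (cong ⟦_⟧ (sameCol-≗ (Lt * k) false f u₀ f≗))))
          (∑-∈ (λ f → ⟦ sameCol (Lt * k) 𝔄 𝔄 f u₀ ⟧) f∈))
        (≤-reflexive (sym (count-∑ (λ f → sameCol (Lt * k) 𝔄 𝔄 f u₀) (allFuns k n))))
      never : colCount k (Lt * k) 𝔅 𝔄 u₀ ≡ 0
      never = trans (count-∑ (λ t → sameCol (Lt * k) 𝔅 𝔄 t u₀) (allFuns k n))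
        (trans (∑-cong (allFuns k n) (λ t → cong ⟦_⟧ (≢true⇒false (λ h → u₀-unique t (sameCol-sym (Lt * k) 𝔅 𝔄 t u₀ h)))))
          (∑-0 (allFuns k n)))

-- The universe: two elements per variable, then padding

module Elements (v rest : ℕ) where

  el : Fin v → Bool → Fin (v + v + rest)
  el x false = (x ↑ˡ v) ↑ˡ rest
  el x true = (v ↑ʳ x) ↑ˡ rest

  value : Fin v ⊎ Fin v → Fin v × Bool
  value (inj₁ x) = x , false
  value (inj₂ x) = x , true

  viewAt : Fin (v + v) ⊎ Fin rest → Maybe (Fin v × Bool)
  viewAt (inj₁ i) = just (value (splitAt v i))
  viewAt (inj₂ _) = nothing

  view : Fin (v + v + rest) → Maybe (Fin v × Bool)
  view e = viewAt (splitAt (v + v) e)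

  view-el : ∀ x b → view (el x b) ≡ just (x , b)
  view-el x false = trans (cong viewAt (splitAt-↑ˡ (v + v) (x ↑ˡ v) rest)) (cong (just ∘ value) (splitAt-↑ˡ v x v))
  view-el x true = trans (cong viewAt (splitAt-↑ˡ (v + v) (v ↑ʳ x) rest)) (cong (just ∘ value) (splitAt-↑ʳ v v x))

  el-value : ∀ i → el (proj₁ (value (splitAt v i))) (proj₂ (value (splitAt v i))) ≡ i ↑ˡ rest
  el-value i with splitAt v i in eq
  ... | inj₁ x = cong (_↑ˡ rest) (splitAt⁻¹-↑ˡ eq)
  ... | inj₂ x = cong (_↑ˡ rest) (splitAt⁻¹-↑ʳ eq)

  el-view : ∀ e {x b} → view e ≡ just (x , b) → el x b ≡ e
  el-view e p with splitAt (v + v) e in eq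
  ... | inj₁ i with p
  ...   | refl = trans (el-value i) (splitAt⁻¹-↑ˡ eq)

Separated : ℕ → ℕ → ℕ → ℕ → Set
Separated d k R₀ n = Σ (List ℕ) λ σ → All (_≤ k) σ × Σ (Structure n σ) λ A → Σ (Structure n σ) λ B →
  Distinguishes k A B × (∀ r → r ≤ R₀ → ¬ DistAfter d r A B)

module _ (d k h Lt w v rest R₀ : ℕ) (h-pos : 1 ≤ h) (k-pos : 1 ≤ k) (fits : 9 * (3 * h) ≤ k)
  (x₀ : Fin v) (j₀ : Fin w) (room : suc (suc R₀) * suc (suc d + suc d) ≤ Lt)
  (P₀ : Fin w → Fin 8 → Fin w) (P₀-expands : IsExpander (suc d + suc d) 5 P₀)
  (nbx : Fin (suc Lt * w) → Fin (3 * h) → Fin v) (nbx-expands : IsExpander (suc d + suc d) (2 * h) nbx) where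

  private
    module E = Elements v rest
    module C = Construction E.el E.view E.view-el E.el-view Lt w P₀ j₀ (3 * h) nbx
    module G = Condensation (suc d) h Lt w v (s≤s z≤n) h-pos P₀ j₀ P₀-expands nbx nbx-expands

    local : ∀ {r S f} → card S ≤ suc d → G.Good r S f → ∀ s → (∀ j → S (C.vars s j) ≡ true) →
      ∀ b → C.holds false s b ≡ C.holds true s (⨁ (λ j → f (C.vars s j)) xor b)
    local S≤ good (col x) inS b = refl
    local {S = S} {f} S≤ good (con y) inS b = sym (cong (λ c → not (c xor b)) (trans
      (⨁-remQuot 9 (3 * h) (λ m i → f (nbx (G.nby y m) i)))
      (G.good-con S≤ good y (λ m i → subst (λ q → S (nbx (G.nby y (proj₁ q)) (proj₂ q)) ≡ true)
        (remQuot-combine m i) (inS (combine m i))))))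
    local S≤ good tp inS b = sym (cong (_xor b) (G.good-top S≤ good inS))

    module D = C.Game d G.Good R₀ G.good-restrict G.good-cong (λ r → _ , G.good-start r)
      (λ r≤ → G.good-step (≤-trans (*-monoˡ-≤ (suc (suc d + suc d)) (s≤s (s≤s r≤))) room)) local

  separated : Separated d k R₀ (v + v + rest)
  separated = C.σ , C.arities k-pos fits , C.𝔄 , C.𝔅 , C.Upper.distinguishes fits x₀ , λ r r≤ → D.indistinguishable r≤

-- Choice of parameters

^-distribʳ-* : ∀ a m n → (m * n) ^ a ≡ m ^ a * n ^ a
^-distribʳ-* zero m n = refl
^-distribʳ-* (suc a) m n = trans (cong (m * n *_) (^-distribʳ-* a m n)) (*-interchange m n (m ^ a) (n ^ a))
  where
  *-interchange : ∀ m n p q → m * n * (p * q) ≡ m * p * (n * q)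
  *-interchange = solve-∀

module Sizes (d k n g : ℕ) (g-pos : 1 ≤ g) (216g≤k : 216 * g ≤ k) (k≤d : k ≤ d)
             (large : 1024 * (d ^ 8 * k ^ 6) ≤ n) where

  1≤k : 1 ≤ k
  1≤k = ≤-trans g-pos (≤-trans (m≤n*m g 216) 216g≤k)

  1≤d : 1 ≤ d
  1≤d = ≤-trans 1≤k k≤d

  -- `c` bounds the largest range `2 * h * s` of the condensing expander. The cube is its degree
  -- `3 * h` over the exponent `h` that expansion `2 * h` leaves.
  c M : ℕ
  c = k * d
  M = c ^ 3

  1≤c : 1 ≤ c
  1≤c = *-mono-≤ 1≤k 1≤d

  1≤M : 1 ≤ M
  1≤M = m^n>0 c {{>-nonZero 1≤c}} 3

  instance
    2M-nonZero : NonZero (2 * M)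
    2M-nonZero = >-nonZero (≤-trans 1≤M (m≤m+n M _))

  large′ : M * M * (1024 * (d * d)) ≤ n
  large′ = ≤-trans (≤-reflexive (regroup 1024 d k)) large
    where
    open +-*-Solver
    regroup : ∀ a d k → (k * d) ^ 3 * (k * d) ^ 3 * (a * (d * d)) ≡ a * (d ^ 8 * k ^ 6)
    regroup = solve 3 (λ a d k → (k :* d) :^ 3 :* (k :* d) :^ 3 :* (a :* (d :* d)) := a :* (d :^ 8 :* k :^ 6)) refl

  1≤dd : 1 ≤ d * d
  1≤dd = *-mono-≤ 1≤d 1≤d

  16MM≤n : 16 * (M * M) ≤ n
  16MM≤n = ≤-trans (≤-trans (≤-reflexive (*-comm 16 (M * M))) (*-monoʳ-≤ (M * M)
    (≤-trans (toWitness {a? = 16 ≤? 1024} _) (*-monoʳ-≤ 1024 1≤dd)))) large′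

  -- All sizes are powers of z; note n ≤ z * z below.
  z : ℕ
  z = n / (2 * M)

  2zM≤n : z * (2 * M) ≤ n
  2zM≤n = m/n*n≤m n (2 * M)

  2M≤n : 2 * M ≤ n
  2M≤n = ≤-trans (*-mono-≤ (toWitness {a? = 2 ≤? 16} _) (m≤m*n M M {{>-nonZero 1≤M}})) 16MM≤n

  n<[1+z]2M : n < suc z * (2 * M)
  n<[1+z]2M = subst (_< suc z * (2 * M)) (sym (m≡m%n+[m/n]*n n (2 * M))) (+-monoˡ-< (z * (2 * M)) (m%n<n n (2 * M)))

  1≤z : 1 ≤ z
  1≤z with z | n<[1+z]2M
  ... | zero | lt = ⊥-elim (<⇒≱ lt (≤-trans (≤-reflexive (*-identityˡ (2 * M))) 2M≤n))
  ... | suc _ | _ = s≤s z≤n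

  n≤4zM : n ≤ 4 * (z * M)
  n≤4zM = ≤-trans (<⇒≤ n<[1+z]2M) (≤-trans (*-monoˡ-≤ (2 * M) (+-monoˡ-≤ z 1≤z)) (≤-reflexive (regroup z M)))
    where
    regroup : ∀ z M → (z + z) * (2 * M) ≡ 4 * (z * M)
    regroup = solve-∀

  -- Squares `n ≤ 4 * (z * M)` and cancels against `16 * (M * M) ≤ n`; it turns powers of `n` into
  -- powers of `z`.
  n≤zz : n ≤ z * z
  n≤zz = *-cancelˡ-≤ n {{>-nonZero (≤-trans 1≤M (≤-trans (m≤m+n M _) 2M≤n))}} (begin
    n * n                            ≤⟨ *-mono-≤ n≤4zM n≤4zM ⟩
    4 * (z * M) * (4 * (z * M))      ≡⟨ regroup z M ⟩
    16 * (M * M) * (z * z)           ≤⟨ *-monoˡ-≤ (z * z) 16MM≤n ⟩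
    n * (z * z)                      ∎)
    where
    open ≤-Reasoning
    regroup : ∀ z M → 4 * (z * M) * (4 * (z * M)) ≡ 16 * (M * M) * (z * z)
    regroup = solve-∀

  32d≤z : 32 * d ≤ z
  32d≤z with ≤-total (32 * d) z
  ... | inj₁ p = p
  ... | inj₂ p = ≤-reflexive (sym (≤-antisym p (≮⇒≥ λ lt → <⇒≱ (*-mono-< lt lt) (begin
    32 * d * (32 * d)          ≡⟨ regroup d ⟩
    1024 * (d * d)             ≤⟨ m≤n*m (1024 * (d * d)) (M * M) {{>-nonZero (*-mono-≤ 1≤M 1≤M)}} ⟩
    M * M * (1024 * (d * d))   ≤⟨ large′ ⟩
    n                          ≤⟨ n≤zz ⟩
    z * z                      ∎))))
    where
    open ≤-Reasoning
    regroup : ∀ d → 32 * d * (32 * d) ≡ 1024 * (d * d)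
    regroup = solve-∀

  linear≤z : ∀ a b → a + b ≤ 32 → a * d + b ≤ z
  linear≤z a b h = ≤-trans (+-monoʳ-≤ (a * d) (m≤m*n b d {{>-nonZero 1≤d}}))
    (≤-trans (≤-reflexive (sym (*-distribʳ-+ d a b))) (≤-trans (*-monoˡ-≤ d h) 32d≤z))

  -- `h` makes `z ^ (g + 7) ≤ z ^ h`. `s` is twice the closure bound `suc d`. In the layer expander
  -- `w ^ 2` has to absorb `z ^ 9`, whence `w = z ^ 5`. `Lt` allots one gap width `suc s` to each of
  -- `R₀ + 2` levels.
  h s w R₀ Lt v : ℕ
  h = 8 * g
  s = suc d + suc d
  w = z ^ 5
  R₀ = z ^ g
  Lt = suc (suc R₀) * suc s
  v = z * M

  z^-pos : ∀ a → 1 ≤ z ^ a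
  z^-pos = m^n>0 z {{>-nonZero 1≤z}}

  z^-mono : ∀ {a b} → a ≤ b → z ^ a ≤ z ^ b
  z^-mono = ^-monoʳ-≤ z {{>-nonZero 1≤z}}

  8s≤z : 8 * s ≤ z
  8s≤z = ≤-trans (≤-reflexive (regroup d)) (linear≤z 16 16 ≤-refl)
    where
    regroup : ∀ d → 8 * ((1 + d) + (1 + d)) ≡ 16 * d + 16
    regroup = solve-∀

  5s≤z : 5 * s ≤ z
  5s≤z = ≤-trans (*-monoˡ-≤ s (toWitness {a? = 5 ≤? 8} _)) 8s≤z

  sparseY : 2 * w * (4 * s * w ^ 5 * (5 * s) ^ 8) ≤ w ^ 8
  sparseY = begin
    2 * w * (4 * s * w ^ 5 * (5 * s) ^ 8)    ≡⟨ regroup w s (w ^ 5) ((5 * s) ^ 8) ⟩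
    w ^ 6 * (8 * s * (5 * s) ^ 8)            ≤⟨ *-monoʳ-≤ (w ^ 6) (*-mono-≤ 8s≤z (^-monoˡ-≤ 8 5s≤z)) ⟩
    w ^ 6 * z ^ 9                            ≤⟨ *-monoʳ-≤ (w ^ 6) (z^-mono (n≤1+n 9)) ⟩
    w ^ 6 * z ^ 10                           ≡⟨ cong (w ^ 6 *_) (trans (^-distribˡ-+-* z 5 5) (cong (w *_) (sym (*-identityʳ w)))) ⟩
    w ^ 6 * w ^ 2                            ≡⟨ sym (^-distribˡ-+-* w 6 2) ⟩
    w ^ 8                                    ∎
    where
    open ≤-Reasoning
    regroup : ∀ w s q p → 2 * w * (4 * s * q * p) ≡ w * q * (8 * s * p)
    regroup = solve-∀

  layers≤ : suc Lt ≤ z ^ (g + 1)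
  layers≤ = begin
    suc (suc (suc R₀) * suc s)     ≤⟨ +-mono-≤ (z^-pos g) (*-monoˡ-≤ (suc s) (+-mono-≤ (z^-pos g) (+-monoˡ-≤ R₀ (z^-pos g)))) ⟩
    R₀ + (R₀ + (R₀ + R₀)) * suc s  ≡⟨ regroup R₀ d ⟩
    R₀ * (6 * d + 10)              ≤⟨ *-monoʳ-≤ R₀ (linear≤z 6 10 (toWitness {a? = 16 ≤? 32} _)) ⟩
    R₀ * z                         ≡⟨ cong (R₀ *_) (sym (*-identityʳ z)) ⟩
    z ^ g * z ^ 1                  ≡⟨ sym (^-distribˡ-+-* z g 1) ⟩
    z ^ (g + 1)                    ∎
    where
    open ≤-Reasoning
    regroup : ∀ r d → r + (r + (r + r)) * (1 + ((1 + d) + (1 + d))) ≡ r * (6 * d + 10)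
    regroup = solve-∀

  8sN≤z^h : 8 * s * (suc Lt * w) ≤ z ^ h
  8sN≤z^h = begin
    8 * s * (suc Lt * w)             ≤⟨ *-mono-≤ 8s≤z (*-monoˡ-≤ w layers≤) ⟩
    z * (z ^ (g + 1) * z ^ 5)        ≡⟨ cong (z *_) (sym (^-distribˡ-+-* z (g + 1) 5)) ⟩
    z ^ suc (g + 1 + 5)              ≤⟨ z^-mono (≤-trans (≤-reflexive (regroup g)) (+-monoʳ-≤ g (*-monoʳ-≤ 7 g-pos))) ⟩
    z ^ h                            ∎
    where
    open ≤-Reasoning
    regroup : ∀ g → 1 + (g + 1 + 5) ≡ g + 7 * 1
    regroup = solve-∀

  2hs≤c : 2 * h * s ≤ c
  2hs≤c = begin
    2 * (8 * g) * s       ≡⟨ regroup g d ⟩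
    g * (32 * d + 32)     ≤⟨ *-monoʳ-≤ g (+-monoʳ-≤ (32 * d) (m≤m*n 32 d {{>-nonZero 1≤d}})) ⟩
    g * (32 * d + 32 * d) ≡⟨ regroup′ g d ⟩
    64 * g * d            ≤⟨ *-monoˡ-≤ d (≤-trans (*-monoˡ-≤ g (toWitness {a? = 64 ≤? 216} _)) 216g≤k) ⟩
    k * d                 ∎
    where
    open ≤-Reasoning
    regroup : ∀ g d → 2 * (8 * g) * ((1 + d) + (1 + d)) ≡ g * (32 * d + 32)
    regroup = solve-∀
    regroup′ : ∀ g d → g * (32 * d + 32 * d) ≡ 64 * g * d
    regroup′ = solve-∀

  sparseX : 2 * (suc Lt * w) * (4 * s * v ^ (2 * h) * (2 * h * s) ^ (3 * h)) ≤ v ^ (3 * h)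
  sparseX = begin
    2 * N * (4 * s * v ^ (2 * h) * (2 * h * s) ^ (3 * h))   ≡⟨ regroup N s (v ^ (2 * h)) _ ⟩
    v ^ (2 * h) * (8 * s * N * (2 * h * s) ^ (3 * h))
      ≤⟨ *-monoʳ-≤ (v ^ (2 * h)) (*-mono-≤ 8sN≤z^h (^-monoˡ-≤ (3 * h) 2hs≤c)) ⟩
    v ^ (2 * h) * (z ^ h * c ^ (3 * h))   ≡⟨ cong (λ q → v ^ (2 * h) * (z ^ h * q)) (sym (^-*-assoc c 3 h)) ⟩
    v ^ (2 * h) * (z ^ h * M ^ h)         ≡⟨ cong (v ^ (2 * h) *_) (sym (^-distribʳ-* h z M)) ⟩
    v ^ (2 * h) * v ^ h                   ≡⟨ sym (^-distribˡ-+-* v (2 * h) h) ⟩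
    v ^ (2 * h + h)                       ≡⟨ cong (v ^_) (three h) ⟩
    v ^ (3 * h)                           ∎
    where
    open ≤-Reasoning
    N : ℕ
    N = suc Lt * w
    regroup : ∀ N s p q → 2 * N * (4 * s * p * q) ≡ p * (8 * s * N * q)
    regroup = solve-∀
    three : ∀ h → 2 * h + h ≡ 3 * h
    three = solve-∀

  1≤v : 1 ≤ v
  1≤v = *-mono-≤ 1≤z 1≤M

  separation : Separated d k R₀ n
  separation = subst (Separated d k R₀) total
    (separated d k h Lt w v (n ∸ (v + v)) R₀ (≤-trans g-pos (m≤m+n g _)) 1≤k
      (≤-trans (≤-reflexive (regroup g)) 216g≤k) (fromℕ< 1≤v) (fromℕ< (z^-pos 5)) ≤-refl
      (proj₁ Pʸ) (proj₂ Pʸ) (proj₁ Pˣ) (proj₂ Pˣ))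
    where
    Pʸ : ∃ λ (nb : Fin w → Fin 8 → Fin w) → IsExpander s 5 nb
    Pʸ = ExpanderExists.expander w 8 w 5 s (z^-pos 5) (z^-pos 5) sparseY
    Pˣ : ∃ λ (nb : Fin (suc Lt * w) → Fin (3 * h) → Fin v) → IsExpander s (2 * h) nb
    Pˣ = ExpanderExists.expander v (3 * h) (suc Lt * w) (2 * h) s 1≤v
      (≤-trans (z^-pos 5) (m≤m+n w _)) sparseX
    regroup : ∀ g → 9 * (3 * (8 * g)) ≡ 216 * g
    regroup = solve-∀
    double : ∀ z M → z * M + z * M ≡ z * (2 * M)
    double = solve-∀
    total : v + v + (n ∸ (v + v)) ≡ n
    total = m+[n∸m]≡n (≤-trans (≤-reflexive (double z M)) 2zM≤n)

  rounds≤ : ∀ q → 2 * k ≤ g * q → 1 ≤ q → ∀ r → r ^ q ≤ n ^ k → r ≤ R₀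
  rounds≤ q 2k≤ q-pos r h = ≮⇒≥ λ lt → <⇒≱ (^-monoˡ-< q {{>-nonZero q-pos}} lt) (begin
    r ^ q            ≤⟨ h ⟩
    n ^ k            ≤⟨ ^-monoˡ-≤ k n≤zz ⟩
    (z * z) ^ k      ≡⟨ cong (_^ k) (cong (z *_) (sym (*-identityʳ z))) ⟩
    (z ^ 2) ^ k      ≡⟨ ^-*-assoc z 2 k ⟩
    z ^ (2 * k)      ≤⟨ z^-mono 2k≤ ⟩
    z ^ (g * q)      ≡⟨ sym (^-*-assoc z g q) ⟩
    (z ^ g) ^ q      ∎)
    where open ≤-Reasoning

-- Rounding `k / 216`, and the final constants

quotient-pos : ∀ k → 216 ≤ k → 1 ≤ k / 216
quotient-pos k h with k / 216 | m≡m%n+[m/n]*n k 216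
... | zero | e = ⊥-elim (<⇒≱ (m%n<n k 216) (≤-trans h (≤-reflexive (trans e (+-identityʳ _)))))
... | suc _ | _ = s≤s z≤n

quotient-large : ∀ k → 216 ≤ k → 2 * k ≤ k / 216 * 864
quotient-large k h = begin
  2 * k                          ≡⟨ cong (2 *_) (m≡m%n+[m/n]*n k 216) ⟩
  2 * (k % 216 + g * 216)        ≤⟨ *-monoʳ-≤ 2 (+-monoˡ-≤ (g * 216) (≤-trans (<⇒≤ (m%n<n k 216)) (m≤n*m 216 g {{>-nonZero (quotient-pos k h)}}))) ⟩
  2 * (g * 216 + g * 216)        ≡⟨ regroup g ⟩
  g * 864                        ∎
  where
  open ≤-Reasoning
  g : ℕ
  g = k / 216
  regroup : ∀ g → 2 * (g * 216 + g * 216) ≡ g * 864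
  regroup = solve-∀

-- Here `α = a / b` and `ε = p / q`, so that the bound of `n` to the power `ε k` on `r` reads
-- `r ^ q ≤ n ^ (p * k)`.
theorem1p2 : Σ ℕ λ k0 → Σ ℕ λ a → Σ ℕ λ b → Σ ℕ λ p → Σ ℕ λ q →
    0 < a × 0 < b × 0 < p × 0 < q ×
    ((d k : ℕ) → k0 ≤ k → k ≤ d → (n : ℕ) → a * (d ^ 8 * k ^ 6) ≤ b * n →
    Σ (List ℕ) λ σ → All (_≤ k) σ × Σ (Structure n σ) λ A → Σ (Structure n σ) λ B →
    Distinguishes k A B ×
    ((r : ℕ) → r ^ q ≤ n ^ (p * k) → ¬ DistAfter d r A B))
-- 216 is the arity `9 * (3 * h)` of a constraint for `g = 1`, and 1024 is the square of 32 in
-- `32 * d ≤ z`. Rounding `k / 216` costs a factor of at most 2 and `n ≤ z * z` another, so `q` is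
-- four times 216.
theorem1p2 = 216 , 1024 , 1 , 1 , 864 , s≤s z≤n , s≤s z≤n , s≤s z≤n , s≤s z≤n , prove
  where
  prove : (d k : ℕ) → 216 ≤ k → k ≤ d → (n : ℕ) → 1024 * (d ^ 8 * k ^ 6) ≤ 1 * n →
    Σ (List ℕ) λ σ → All (_≤ k) σ × Σ (Structure n σ) λ A → Σ (Structure n σ) λ B →
    Distinguishes k A B ×
    ((r : ℕ) → r ^ 864 ≤ n ^ (1 * k) → ¬ DistAfter d r A B)
  prove d k 216≤k k≤d n large = extract Z.separation
    where
    module Z = Sizes d k n (k / 216) (quotient-pos k 216≤k)
      (≤-trans (≤-reflexive (*-comm 216 (k / 216))) (m/n*n≤m k 216)) k≤d
      (≤-trans large (≤-reflexive (*-identityˡ n)))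
    extract : Separated d k Z.R₀ n → Σ (List ℕ) λ σ → All (_≤ k) σ × Σ (Structure n σ) λ A → Σ (Structure n σ) λ B →
      Distinguishes k A B × ((r : ℕ) → r ^ 864 ≤ n ^ (1 * k) → ¬ DistAfter d r A B)
    extract (σ , small , A , B , dist , indist) = σ , small , A , B , dist , λ r h → indist r
      (Z.rounds≤ 864 (quotient-large k 216≤k) (s≤s z≤n) r (≤-trans h (≤-reflexive (cong (n ^_) (*-identityˡ k)))))
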